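{- There is an absolute constant $C$ such that for every integer $n\ge 4$ and every forest $F$ on $n$ vertices, $\mathrm{cp}(\overline{F})\le C\, n\log\log n$; that is, $\mathrm{cp}(\overline{F})=O(n\log\log n)$.
   Context: Logarithms are base $2$. A clique partition of a graph $G$ is a collection of complete subgraphs of $G$ whose edge sets partition $E(G)$; the clique partition number $\mathrm{cp}(G)$ is the minimum number of cliques in a clique partition of $G$. $\overline{F}$ denotes the complement of the graph $F$ (on the same vertex set). -}

module Defs where

open import Data.Nat using (ℕ; zero; suc; _+_; _*_; _≤_)
open import Data.Nat.Logarithm using (⌊log₂_⌋) public
open import Data.Bool using (Bool; true; false; not; _∧_)
open import Data.Fin using (Fin; zero; suc; inject₁; fromℕ; _≟_)
open import Data.Fin.Subset using (Subset; _∈_)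
open import Data.List using (List; length; lookup)
open import Data.Product using (_×_; Σ; ∃; _,_)
open import Relation.Nullary using (¬_)
open import Relation.Nullary.Decidable using (⌊_⌋)
open import Relation.Binary.PropositionalEquality using (_≡_; _≢_)
open import Function.Definitions using (Injective)

Graph : ℕ → Set
Graph n = Fin n → Fin n → Bool

Edge : {n : ℕ} → Graph n → Fin n → Fin n → Set
Edge G u v = G u v ≡ true

IsSimple : {n : ℕ} → Graph n → Set
IsSimple G = (∀ u v → G u v ≡ G v u) × (∀ v → G v v ≡ false)

complement : {n : ℕ} → Graph n → Graph n
complement G u v = not (G u v) ∧ not ⌊ u ≟ v ⌋

HasCycle : {n : ℕ} → Graph n → Set
HasCycle {n} G =
  Σ ℕ λ k → Σ (Fin (suc (suc (suc k))) → Fin n) λ c →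
    Injective _≡_ _≡_ c
    × (∀ (i : Fin (suc (suc k))) → Edge G (c (inject₁ i)) (c (suc i)))
    × Edge G (c (fromℕ (suc (suc k)))) (c zero)

IsForest : {n : ℕ} → Graph n → Set
IsForest G = IsSimple G × ¬ HasCycle G

IsCliquePartition : {n : ℕ} → Graph n → List (Subset n) → Set
IsCliquePartition {n} G cs =
  (∀ (i : Fin (length cs)) (u v : Fin n) → u ∈ lookup cs i → v ∈ lookup cs i → u ≢ v → Edge G u v)
  × (∀ (u v : Fin n) → Edge G u v →
       Σ (Fin (length cs)) λ i → (u ∈ lookup cs i × v ∈ lookup cs i)
         × (∀ (j : Fin (length cs)) → u ∈ lookup cs j → v ∈ lookup cs j → j ≡ i))

CpAtMost : {n : ℕ} → Graph n → ℕ → Set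
CpAtMost G k = ∃ λ cs → IsCliquePartition G cs × length cs ≤ k

{-# OPTIONS --safe #-}
module Submission where

-- Root the forest. Cutting it bottom-up at O(√n) hubs leaves trees with at most h ~ √n vertices.
-- Choose a prime p ~ √n and place every tree inside one column of the p × p grid. The lines of the
-- grid are p² = O(n) cliques covering every pair of vertices in different columns exactly once, and a
-- hub, given a slope of its own, joins all lines of that slope, except the bad ones, which contain a
-- neighbour of the hub. The trees hanging from a hub are placed greedily with their roots on few
-- lines of its slope, so there are only O(√n) bad lines; on those, and among the hubs, single edges
-- suffice. What remains is a forest of at most p vertices in each column. These have n vertices in
-- total, so each of the O(log log n) rounds of taking square roots costs O(n) cliques.
open import Defs
open import Data.Bool using (Bool; true; false; _∧_; _∨_; not; if_then_else_)
import Data.Bool as Bool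
open import Data.Bool.Properties using (∧-comm; ∧-zeroʳ)
open import Data.Empty using (⊥-elim)
open import Data.Fin using (Fin; zero; suc; toℕ; inject₁; fromℕ)
import Data.Fin as Fin
open import Data.Fin.Properties using (toℕ-injective)
open import Data.Fin.Subset using (Subset) renaming (_∈_ to _∈ˢ_)
open import Data.List using (List; []; _∷_; _++_; length; map; lookup; filter; concatMap; upTo; allFin)
open import Data.List.Membership.Propositional using (_∈_; _∉_; find; lose)
open import Data.List.Membership.Propositional.Properties
open import Data.List.Properties
  using (length-upTo; length-++; length-map; length-tabulate; filter-all; filter-none; filter-++; ++-assoc; ++-identityʳ)
open import Data.List.Relation.Binary.Permutation.Propositional
  using (_↭_; prep; ↭-refl; ↭-trans; ↭-reflexive; ↭-sym; ↭⇒↭ₛ; module PermutationReasoning)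
open import Data.List.Relation.Binary.Permutation.Propositional.Properties
  using (++⁺; ++⁺ˡ; ++⁺ʳ; ++-comm; ∈-resp-↭; ↭-length; shift)
import Data.List.Relation.Binary.Permutation.Setoid.Properties as PermSetoid
open import Data.List.Relation.Unary.All as All using (All; []; _∷_)
import Data.List.Relation.Unary.All.Properties as All
open import Data.List.Relation.Unary.AllPairs using ([]; _∷_)
open import Data.List.Relation.Unary.Any using (here; there; any?)
open import Data.List.Relation.Unary.Linked using (Linked; []; [-]; _∷_)
open import Data.List.Relation.Unary.Unique.Propositional using (Unique)
open import Data.List.Relation.Unary.Unique.Propositional.Properties using (upTo⁺; allFin⁺; filter⁺)
open import Data.Maybe using (Maybe; just; nothing)
import Data.Maybe as Maybe
open import Data.Nat hiding (_≟_)
open import Data.Nat.Combinatorics using (_C_; nC1≡n; k>n⇒nCk≡0; nCk≡n!/k![n-k]!; nCk+nC[k+1]≡[n+1]C[k+1]; k![n∸k]!∣n!)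
open import Data.Nat.Coprimality using (Coprime; coprime-divisor; coprime-Bézout)
open import Data.Nat.Divisibility
open import Data.Nat.DivMod
open import Data.Nat.GCD using (module Bézout)
open import Data.Nat.Induction using (<-wellFounded)
open import Data.Nat.ListAction using (product)
open import Data.Nat.Logarithm using (⌊log₂⌋-mono-≤; ⌊log₂[2^n]⌋≡n)
open import Data.Nat.Primality
open import Data.Nat.Primality.Factorisation using (factorise)
open import Data.Nat.Properties hiding (_≟_)
import Data.Nat.Properties as ℕ
open import Data.Nat.Tactic.RingSolver using (solve-∀)
open import Data.Product using (_×_; _,_; Σ; ∃; ∃₂; proj₁; proj₂)
open import Data.Product.Properties using (≡-dec)
open import Data.Sum using (_⊎_; inj₁; inj₂)
open import Data.Unit using (⊤; tt)
open import Data.Vec as Vec using (tabulate)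
open import Data.Vec.Properties using (lookup∘tabulate; []=⇒lookup; lookup⇒[]=)
open import Induction.WellFounded using (Acc; acc)
open import Relation.Binary.Definitions using (tri<; tri≈; tri>; DecidableEquality)
open import Relation.Binary.PropositionalEquality
open import Relation.Nullary
open import Relation.Nullary.Decidable using (dec-true; dec-false; _×-dec_; ¬?)

-- A line of a hub's slope that contains a neighbour of the hub has to do without the hub, which
-- costs up to `p` single edges. Slopes and intercepts both number about √n, so freely scattered
-- neighbours could spoil all n lines and cost n^(3/2). Hence the roots below a hub are stacked: a
-- hanging forest of t vertices uses at most 2 + t/h lines of the slope. Every hub owns at least h
-- vertices, so there are at most n/h hubs, and these counts sum to O(n/h) = O(√n) lines, O(n)
-- single edges. A tree may not leave its column because two cells in different columns always share
-- a line, so an edge of the forest between them would be covered. Two cells of the same column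
-- share none; the price is that the pairs inside each column still have to be partitioned, and this
-- is the recursion. The bound carried along is a multiple of the number of vertices, so that the
-- bounds for the columns add up. Primality makes differences of columns invertible. The prime only
-- has to be within a constant factor of √n, so a Chebyshev-type estimate is enough.

private variable
  A B : Set

-- Primes

C-absorb : ∀ n k → suc k * (suc n C suc k) ≡ suc n * (n C k)
C-absorb zero zero = refl
C-absorb zero (suc k) rewrite k>n⇒nCk≡0 {1} {suc (suc k)} (s<s z<s) | k>n⇒nCk≡0 {0} {suc k} z<s = *-zeroʳ k
C-absorb (suc n) zero rewrite nC1≡n (suc (suc n)) = trans (+-identityʳ _) (sym (*-identityʳ _))
C-absorb (suc n) (suc k) = begin
  suc (suc k) * (suc (suc n) C suc (suc k))
    ≡⟨ cong (suc (suc k) *_) (sym (nCk+nC[k+1]≡[n+1]C[k+1] (suc n) (suc k))) ⟩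
  suc (suc k) * (X + (suc n C suc (suc k)))
    ≡⟨ *-distribˡ-+ (suc (suc k)) X _ ⟩
  (X + suc k * X) + suc (suc k) * (suc n C suc (suc k))
    ≡⟨ cong₂ (λ a b → (X + a) + b) (C-absorb n k) (C-absorb n (suc k)) ⟩
  (X + suc n * (n C k)) + suc n * (n C suc k)
    ≡⟨ +-assoc X _ _ ⟩
  X + (suc n * (n C k) + suc n * (n C suc k))
    ≡⟨ cong (X +_) (trans (sym (*-distribˡ-+ (suc n) (n C k) _)) (cong (suc n *_) (nCk+nC[k+1]≡[n+1]C[k+1] n k))) ⟩
  suc (suc n) * X ∎
  where
  open ≡-Reasoning
  X = suc n C suc k

-- Absorption evaluates `suc j` times the sum of two neighbouring coefficients; cancelling
-- `suc j * X` leaves the ratio of neighbours in one row.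
C-step : ∀ j r → suc j * ((j + r) C suc j) ≡ r * ((j + r) C j)
C-step j r = +-cancelˡ-≡ (suc j * X) _ _ (begin
  suc j * X + suc j * ((j + r) C suc j) ≡⟨ sym (*-distribˡ-+ (suc j) X _) ⟩
  suc j * (X + ((j + r) C suc j)) ≡⟨ cong (suc j *_) (nCk+nC[k+1]≡[n+1]C[k+1] (j + r) j) ⟩
  suc j * (suc (j + r) C suc j) ≡⟨ C-absorb (j + r) j ⟩
  (suc j + r) * X ≡⟨ *-distribʳ-+ X (suc j) r ⟩
  suc j * X + r * X ∎)
  where
  open ≡-Reasoning
  X = (j + r) C j

-- The entries of Leibniz' harmonic triangle are 1 / ((n + 1) (n C j)), and each is the
-- difference of two entries to its left; hence they all have D as a common denominator.
leibniz-∣ : ∀ n j D → j ≤ n → (∀ i → 1 ≤ i → i ≤ suc n → i ∣ D) → suc n * (n C j) ∣ D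
leibniz-∣ n zero D _ all = subst (_∣ D) (sym (*-identityʳ (suc n))) (all (suc n) (s≤s z≤n) ≤-refl)
leibniz-∣ (suc n) (suc j) D (s≤s j≤n) all
  with leibniz-∣ n j D j≤n (λ i p q → all i p (≤-trans q (n≤1+n _)))
     | leibniz-∣ (suc n) j D (≤-trans j≤n (n≤1+n _)) all
... | divides x ex | divides y ey = ∣m+n∣m⇒∣n (divides x (*-cancelˡ-≡ _ _ (suc j) e)) (n∣m*n y)
  where
  open ≡-Reasoning
  r = suc n ∸ j
  jr : j + r ≡ suc n
  jr = m+[n∸m]≡n (≤-trans j≤n (n≤1+n _))
  l = suc (suc n) * (suc n C suc j)
  l₁ : suc j * l ≡ suc (suc n) * (suc n * (n C j))
  l₁ = trans (comm (suc j) (suc (suc n)) (suc n C suc j)) (cong (suc (suc n) *_) (C-absorb n j))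
    where
    comm : ∀ a b c → a * (b * c) ≡ b * (a * c)
    comm = solve-∀
  l₂ : suc j * l ≡ r * (suc (suc n) * (suc n C j))
  l₂ = trans (comm (suc j) (suc (suc n)) (suc n C suc j))
    (trans (cong (suc (suc n) *_) (subst (λ z → suc j * (z C suc j) ≡ r * (z C j)) jr (C-step j r)))
      (comm (suc (suc n)) r (suc n C j)))
    where
    comm : ∀ a b c → a * (b * c) ≡ b * (a * c)
    comm = solve-∀
  -- The recurrence of the triangle, multiplied by `D`, reads `D / l = x - y`. It is kept as
  -- `y * l + D = x * l` to avoid subtraction, and with a factor `suc j` so that both expressions
  -- for `l` apply.
  e : suc j * (y * l + D) ≡ suc j * (x * l)
  e = begin
    suc j * (y * l + D)                                ≡⟨ a₁ (suc j) y l D ⟩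
    y * (suc j * l) + suc j * D                        ≡⟨ cong (λ z → y * z + suc j * D) l₂ ⟩
    y * (r * (suc (suc n) * (suc n C j))) + suc j * D  ≡⟨ cong (_+ suc j * D) (a₂ y r _) ⟩
    r * (y * (suc (suc n) * (suc n C j))) + suc j * D  ≡⟨ cong (λ z → r * z + suc j * D) (sym ey) ⟩
    r * D + suc j * D                                  ≡⟨ sym (*-distribʳ-+ D r (suc j)) ⟩
    (r + suc j) * D                                    ≡⟨ cong (_* D) (trans (+-suc r j) (cong suc (trans (+-comm r j) jr))) ⟩
    suc (suc n) * D                                    ≡⟨ cong (suc (suc n) *_) ex ⟩
    suc (suc n) * (x * (suc n * (n C j)))              ≡⟨ a₂ (suc (suc n)) x _ ⟩
    x * (suc (suc n) * (suc n * (n C j)))              ≡⟨ cong (x *_) (sym l₁) ⟩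
    x * (suc j * l)                                    ≡⟨ a₂ x (suc j) l ⟩
    suc j * (x * l) ∎
    where
    a₁ : ∀ j y l D → j * (y * l + D) ≡ y * (j * l) + j * D
    a₁ = solve-∀
    a₂ : ∀ a b c → a * (b * c) ≡ b * (a * c)
    a₂ = solve-∀

central : ℕ → ℕ
central n = (n + n) C n

-- By absorption, `n * central n` equals 2n times the coefficient of n - 1 in row 2n - 1. That is a
-- Leibniz denominator of this row, whose condition asks exactly for the divisors up to 2n.
central-∣ : ∀ n D → 1 ≤ n → (∀ i → 1 ≤ i → i ≤ n + n → i ∣ D) → central n ∣ D
central-∣ (suc k) D _ all = ∣-trans (n∣m*n (suc k) {central (suc k)})
  (subst (_∣ D) (sym (C-absorb (k + suc k) k)) (leibniz-∣ (k + suc k) k D (m≤m+n k _) all))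

C≤2^ : ∀ n k → n C k ≤ 2 ^ n
C≤2^ zero zero = ≤-refl
C≤2^ zero (suc k) rewrite k>n⇒nCk≡0 {0} {suc k} z<s = z≤n
C≤2^ (suc n) zero = m^n>0 2 (suc n)
C≤2^ (suc n) (suc k) = begin
  suc n C suc k           ≡⟨ sym (nCk+nC[k+1]≡[n+1]C[k+1] n k) ⟩
  (n C k) + (n C suc k)   ≤⟨ +-mono-≤ (C≤2^ n k) (C≤2^ n (suc k)) ⟩
  2 ^ n + 2 ^ n           ≡⟨ cong (2 ^ n +_) (sym (+-identityʳ _)) ⟩
  2 ^ suc n ∎
  where open ≤-Reasoning

-- Each of the two coefficients that Pascal's rule adds up to `central (suc n)` is at least
-- `central n`. Doubling per step is weaker than the true growth, about 4^n, but suffices.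
2^≤central : ∀ n → 2 ^ n ≤ central n
2^≤central zero = ≤-refl
2^≤central (suc n) = begin
  2 * 2 ^ n                                      ≤⟨ *-monoʳ-≤ 2 (2^≤central n) ⟩
  2 * central n                                  ≡⟨ cong (central n +_) (+-identityʳ _) ⟩
  central n + central n                          ≤⟨ +-mono-≤ lo hi ⟩
  (suc (n + n) C n) + (suc (n + n) C suc n)      ≡⟨ nCk+nC[k+1]≡[n+1]C[k+1] (suc (n + n)) n ⟩
  suc (suc (n + n)) C suc n                      ≡⟨ cong (λ z → suc z C suc n) (sym (+-suc n n)) ⟩
  central (suc n) ∎
  where
  open ≤-Reasoning
  lo′ : ∀ n → central n ≤ suc (n + n) C n
  lo′ zero = ≤-refl
  lo′ (suc m) = ≤-trans (m≤n+m _ ((suc m + suc m) C m)) (≤-reflexive (nCk+nC[k+1]≡[n+1]C[k+1] (suc m + suc m) m))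
  lo = lo′ n
  hi : central n ≤ suc (n + n) C suc n
  hi = ≤-trans (m≤m+n _ _) (≤-reflexive (nCk+nC[k+1]≡[n+1]C[k+1] (n + n) n))

prime∣!⇒≤ : ∀ {p} n → Prime p → p ∣ n ! → p ≤ n
prime∣!⇒≤ zero pr d = ⊥-elim (¬prime[1] (subst Prime (∣1⇒≡1 d) pr))
prime∣!⇒≤ (suc n) pr d with euclidsLemma (suc n) (n !) pr d
... | inj₁ d′ = ∣⇒≤ d′
... | inj₂ d′ = ≤-trans (prime∣!⇒≤ n pr d′) (n≤1+n n)

∣-! : ∀ {m n} → 1 ≤ m → m ≤ n → m ∣ n !
∣-! {suc m} _ m≤n = ∣-trans (m∣m*n (m !)) (m≤n⇒m!∣n! m≤n)

central-! : ∀ n → central n * (n ! * n !) ≡ (n + n) !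
central-! n = trans (cong (_* (n ! * n !)) (trans (nCk≡n!/k![n-k]! (m≤m+n n n)) (/-congʳ e)))
           (m/n*n≡m (subst (λ z → n ! * z ! ∣ (n + n) !) (m+n∸n≡m n n) (k![n∸k]!∣n! (m≤m+n n n))))
  where
  e = cong (λ z → n ! * z !) (m+n∸n≡m n n)
  instance
    _ = n !* n !≢0
    _ = n !* ((n + n) ∸ n) !≢0

-- Such a prime divides `(n + n) !` but not `n !`, so it survives in the quotient.
prime∣central : ∀ {p} n → Prime p → n < p → p ≤ n + n → p ∣ central n
prime∣central {p} n pr n<p p≤2n
  with euclidsLemma (central n) (n ! * n !) pr
         (subst (p ∣_) (sym (central-! n)) (∣-! (≤-trans (s≤s z≤n) n<p) p≤2n))
... | inj₁ d = d
... | inj₂ d with euclidsLemma (n !) (n !) pr d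
...   | inj₁ d′ = ⊥-elim (<⇒≱ n<p (prime∣!⇒≤ n pr d′))
...   | inj₂ d′ = ⊥-elim (<⇒≱ n<p (prime∣!⇒≤ n pr d′))

-- A multiple of all primes up to 2^k, of the size of their product.
primorial-bound : ∀ k → ∃ λ B → B ≤ 2 ^ (2 * 2 ^ k) × 1 ≤ B × (∀ p → Prime p → p ≤ 2 ^ k → p ∣ B)
primorial-bound zero = 1 , s≤s z≤n , ≤-refl , λ p pr p≤1 → ⊥-elim (≤⇒≯ p≤1 (nonTrivial⇒n>1 p {{prime⇒nonTrivial pr}}))
primorial-bound (suc k) with primorial-bound k
-- The central coefficient contributes the primes between `n` and `2n` at a cost of at most 4^n,
-- which doubles the exponent of the bound.
... | B , B≤ , 1≤B , all = B * central n , bnd , *-mono-≤ 1≤B (≤-trans (m^n>0 2 n) (2^≤central n)) , all′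
  where
  n = 2 ^ k
  open ≤-Reasoning
  bnd : B * central n ≤ 2 ^ (2 * 2 ^ suc k)
  bnd = begin
    B * central n               ≤⟨ *-mono-≤ B≤ (C≤2^ (n + n) n) ⟩
    2 ^ (2 * n) * 2 ^ (n + n)   ≡⟨ sym (^-distribˡ-+-* 2 (2 * n) (n + n)) ⟩
    2 ^ (2 * n + (n + n))       ≡⟨ cong (2 ^_) (e n) ⟩
    2 ^ (2 * 2 ^ suc k) ∎
    where
    e : ∀ n → 2 * n + (n + n) ≡ 2 * (2 * n)
    e = solve-∀
  all′ : ∀ p → Prime p → p ≤ 2 ^ suc k → p ∣ B * central n
  all′ p pr p≤ with p ≤? n
  ... | yes p≤n = ∣m⇒∣m*n (central n) (all p pr p≤n)
  ... | no p≰n = ∣n⇒∣m*n B (prime∣central n pr (≰⇒> p≰n) (≤-trans p≤ (≤-reflexive (cong (n +_) (+-identityʳ n)))))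

-- The witness is the largest power of `i` not above `N`; all smaller powers divide it. The search
-- goes down from exponent `N`, which is high enough because `k < i ^ k`.
largestPower : ∀ N i → 2 ≤ i → 1 ≤ N → ∃ λ a → a ≤ N × 1 ≤ a × (∀ k → i ^ k ≤ N → i ^ k ∣ a)
largestPower N i 2≤i 1≤N = go N (λ k h → ≤-trans (<⇒≤ (i^>k k)) h)
  where
  instance _ = >-nonZero (≤-trans (s≤s z≤n) 2≤i)
  i^>k : ∀ k → k < i ^ k
  i^>k zero = s≤s z≤n
  i^>k (suc k) = begin-strict
    suc k        ≤⟨ i^>k k ⟩
    i ^ k        <⟨ ^-monoʳ-< i 2≤i (n<1+n k) ⟩
    i ^ suc k ∎
    where open ≤-Reasoning
  go : ∀ e → (∀ k → i ^ k ≤ N → k ≤ e) → ∃ λ a → a ≤ N × 1 ≤ a × (∀ k → i ^ k ≤ N → i ^ k ∣ a)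
  go zero h = 1 , 1≤N , ≤-refl , λ k p → subst (λ z → i ^ z ∣ 1) (sym (n≤0⇒n≡0 (h k p))) ∣-refl
  go (suc e) h with i ^ suc e ≤? N
  ... | yes q = i ^ suc e , q , m^n>0 i (suc e) , λ k p → subst (λ z → i ^ k ∣ i ^ z) (m+[n∸m]≡n (h k p))
                  (subst (i ^ k ∣_) (sym (^-distribˡ-+-* i k (suc e ∸ k))) (m∣m*n _))
  ... | no ¬q = go e (λ k p → s≤s⁻¹ (≤∧≢⇒< (h k p) λ { refl → ¬q p }))

-- The product of the largest powers of all bases from 2 to `j`, prime or not. It is applied with
-- `j` = √N, since a prime power with exponent at least two and size at most `N` has its base below
-- √N.
powers-bound : ∀ N j → 1 ≤ N →
  ∃ λ A → A ≤ N ^ j × 1 ≤ A × (∀ i k → 2 ≤ i → i ≤ j → i ^ k ≤ N → i ^ k ∣ A)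
powers-bound N zero 1≤N = 1 , ≤-refl , ≤-refl , λ i k p q → ⊥-elim (<⇒≱ p (≤-trans q z≤n))
powers-bound N (suc j) 1≤N with powers-bound N j 1≤N | 2 ≤? suc j
... | A , A≤ , 1≤A , all | no ¬2 = A , ≤-trans A≤ (m≤n*m (N ^ j) N {{>-nonZero 1≤N}}) , 1≤A
    , λ i k p q → ⊥-elim (¬2 (≤-trans p q))
... | A , A≤ , 1≤A , all | yes 2≤ with largestPower N (suc j) 2≤ 1≤N
...   | a , a≤ , 1≤a , aall = a * A , *-mono-≤ a≤ A≤ , *-mono-≤ 1≤a 1≤A , all′
  where
  all′ : ∀ i k → 2 ≤ i → i ≤ suc j → i ^ k ≤ N → i ^ k ∣ a * A
  all′ i k p q r with i ℕ.≟ suc j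
  ... | yes refl = ∣m⇒∣m*n A (aall k r)
  ... | no i≢ = ∣n⇒∣m*n a (all i k p (s≤s⁻¹ (≤∧≢⇒< q i≢)) r)

prime∤⇒coprime : ∀ {p j} → Prime p → ¬ (p ∣ j) → Coprime j p
prime∤⇒coprime pr p∤j (d∣j , d∣p) with prime⇒irreducible pr d∣p
... | inj₁ d≡1 = d≡1
... | inj₂ refl = ⊥-elim (p∤j d∣j)

∤⇒≥1 : ∀ {p} j → ¬ (p ∣ j) → 1 ≤ j
∤⇒≥1 {p} zero p∤0 = ⊥-elim (p∤0 (p ∣0))
∤⇒≥1 (suc _) _ = s≤s z≤n

strip : ∀ {p} → Prime p → ∀ i → Acc _<_ i → 1 ≤ i → ∃₂ λ k j → i ≡ p ^ k * j × ¬ (p ∣ j)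
strip {p} pr i (acc rs) 1≤i with p ∣? i
... | no p∤i = 0 , i , sym (*-identityˡ i) , p∤i
... | yes (divides q refl) with q | 1≤i
...   | suc q′ | _ with strip pr (suc q′) (rs lt) (s≤s z≤n)
  where
  lt : suc q′ < suc q′ * p
  lt = m<m*n (suc q′) p (nonTrivial⇒n>1 p {{prime⇒nonTrivial pr}})
...     | k , j , e , p∤j = suc k , j , trans (cong (_* p) e) (c (p ^ k) j p) , p∤j
  where
  c : ∀ a b c → a * b * c ≡ c * a * b
  c = solve-∀

-- Split off the full power of one prime. It divides `D` by assumption, the cofactor `j` divides `D`
-- by induction, and since `j` is coprime to the prime it must divide the complementary factor `c`.
primePowers⇒∣ : ∀ D i → Acc _<_ i → 1 ≤ i → (∀ p k → Prime p → p ^ k ∣ i → p ^ k ∣ D) → i ∣ D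
primePowers⇒∣ D i (acc rs) 1≤i h with factorise i {{>-nonZero 1≤i}}
... | record { factors = [] ; isFactorisation = refl } = 1∣ D
... | record { factors = p ∷ ps ; isFactorisation = e ; factorsPrime = pr ∷ _ }
  with strip pr i (<-wellFounded i) 1≤i
...   | zero , j , e′ , p∤j = ⊥-elim (p∤j (subst (p ∣_) (trans (sym e) (trans e′ (*-identityˡ j))) (m∣m*n (product ps))))
...   | suc k , j , refl , p∤j with h p (suc k) pr (m∣m*n j)
...     | divides c refl = subst (_∣ c * p ^ suc k) (*-comm j (p ^ suc k))
          (*-monoˡ-∣ (p ^ suc k) (cop (suc k) c
             (subst (j ∣_) (*-comm c (p ^ suc k)) (primePowers⇒∣ (c * p ^ suc k) j (rs lt) 1≤j
               (λ q l qr d → h q l qr (∣n⇒∣m*n (p ^ suc k) d))))))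
  where
  1≤j = ∤⇒≥1 j p∤j
  lt : j < p ^ suc k * j
  lt = subst (j <_) (*-comm j _) (m<m*n j (p ^ suc k) {{>-nonZero 1≤j}} (≤-trans
         (nonTrivial⇒n>1 p {{prime⇒nonTrivial pr}}) (m≤m*n p (p ^ k) {{m^n≢0 p k {{prime⇒nonZero pr}}}})))
  cop : ∀ k c → j ∣ p ^ k * c → j ∣ c
  cop zero c d = subst (j ∣_) (*-identityˡ c) d
  cop (suc k) c d = cop k c (coprime-divisor (prime∤⇒coprime pr p∤j) (subst (j ∣_) (*-assoc p (p ^ k) c) d))

prime-between : ∀ m n → (∃ λ p → Prime p × m < p × p ≤ n) ⊎ (∀ p → Prime p → p ≤ n → p ≤ m)
prime-between m zero = inj₂ λ p _ q → ≤-trans q z≤n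
prime-between m (suc n) with prime-between m n
... | inj₁ (p , pr , a , b) = inj₁ (p , pr , a , ≤-trans b (n≤1+n n))
... | inj₂ h with prime? (suc n) | m <? suc n
...   | yes pr | yes lt = inj₁ (suc n , pr , lt , ≤-refl)
...   | no ¬pr | _ = inj₂ λ p pr q → h p pr (s≤s⁻¹ (≤∧≢⇒< q λ { refl → ¬pr pr }))
...   | yes _ | no ¬lt = inj₂ λ p pr q → ≤-trans q (≮⇒≥ ¬lt)

8k<2^k : ∀ k → 8 * (6 + k) < 2 ^ (6 + k)
8k<2^k zero = m<m+n 48 {16} z<s
8k<2^k (suc k) = begin-strict
  8 * (7 + k)                 ≡⟨ e k ⟩
  8 + 8 * (6 + k)             ≤⟨ +-monoˡ-≤ (8 * (6 + k)) (m≤m*n 8 (6 + k)) ⟩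
  8 * (6 + k) + 8 * (6 + k)   <⟨ +-mono-< (8k<2^k k) (8k<2^k k) ⟩
  2 ^ (6 + k) + 2 ^ (6 + k)   ≡⟨ cong (2 ^ (6 + k) +_) (sym (+-identityʳ _)) ⟩
  2 ^ (7 + k) ∎
  where
  open ≤-Reasoning
  e : ∀ k → 8 * (7 + k) ≡ 8 + 8 * (6 + k)
  e = solve-∀

-- If the primes up to N = 4^K were all at most 2^M = N/8, then lcm(1..N) would divide A * B with
-- A ≤ N^√N (prime powers with exponent at least two) and B ≤ 4^(N/8), against lcm(1..N) ≥ 2^(N/2).
prime-in-[4^K/8,4^K] : ∀ K M → 3 + M ≡ K + K → 8 * K < 2 ^ K →
  ∃ λ p → Prime p × 2 ^ M < p × p ≤ 2 ^ (K + K)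
prime-in-[4^K/8,4^K] K M eK 8K< with prime-between (2 ^ M) (2 ^ (K + K))
... | inj₁ r = r
... | inj₂ none with powers-bound (2 ^ (K + K)) (2 ^ K) (m^n>0 2 (K + K)) | primorial-bound M
...   | A , A≤ , 1≤A , Aall | B , B≤ , 1≤B , Ball = ⊥-elim (<-irrefl refl (begin-strict
    2 ^ n                                       ≤⟨ 2^≤central n ⟩
    central n                                   ≤⟨ ∣⇒≤ {{>-nonZero (*-mono-≤ 1≤A 1≤B)}} (central-∣ n (A * B) (m^n>0 2 (2 + M)) div) ⟩
    A * B                                       ≤⟨ *-mono-≤ A≤ B≤ ⟩
    (2 ^ (K + K)) ^ (2 ^ K) * 2 ^ (2 * 2 ^ M)   ≡⟨ cong (_* 2 ^ (2 * 2 ^ M)) (^-*-assoc 2 (K + K) (2 ^ K)) ⟩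
    2 ^ ((K + K) * 2 ^ K) * 2 ^ (2 * 2 ^ M)     ≡⟨ sym (^-distribˡ-+-* 2 ((K + K) * 2 ^ K) (2 * 2 ^ M)) ⟩
    2 ^ ((K + K) * 2 ^ K + 2 * 2 ^ M)           <⟨ ^-monoʳ-< 2 (s≤s (s≤s z≤n)) expo ⟩
    2 ^ n ∎))
  where
  open ≤-Reasoning
  n = 2 ^ (2 + M)
  nn : n + n ≡ 2 ^ (K + K)
  nn = trans (cong (n +_) (sym (+-identityʳ n))) (cong (2 ^_) eK)
  -- Four times the first summand is below 4^K by `8 * K < 2 ^ K`, four times the second equals 4^K,
  -- and `n` is half of 4^K.
  expo : (K + K) * 2 ^ K + 2 * 2 ^ M < n
  expo = *-cancelˡ-< 4 _ _ (begin-strict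
    4 * ((K + K) * 2 ^ K + 2 * 2 ^ M)   ≡⟨ e₁ K (2 ^ K) (2 ^ M) ⟩
    8 * K * 2 ^ K + 2 ^ (3 + M)         ≡⟨ cong (λ z → 8 * K * 2 ^ K + 2 ^ z) eK ⟩
    8 * K * 2 ^ K + 2 ^ (K + K)         <⟨ +-monoˡ-< (2 ^ (K + K)) (*-monoˡ-< (2 ^ K) {{m^n≢0 2 K}} 8K<) ⟩
    2 ^ K * 2 ^ K + 2 ^ (K + K)         ≡⟨ cong (_+ 2 ^ (K + K)) (sym (^-distribˡ-+-* 2 K K)) ⟩
    2 ^ (K + K) + 2 ^ (K + K)           ≡⟨ cong (λ z → 2 ^ z + 2 ^ z) (sym eK) ⟩
    2 ^ (3 + M) + 2 ^ (3 + M)           ≡⟨ e₂ (2 ^ M) ⟩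
    4 * n ∎)
    where
    e₁ : ∀ K a b → 4 * ((K + K) * a + 2 * b) ≡ 8 * K * a + 2 * (2 * (2 * b))
    e₁ = solve-∀
    e₂ : ∀ b → 2 * (2 * (2 * b)) + 2 * (2 * (2 * b)) ≡ 4 * (2 * (2 * b))
    e₂ = solve-∀
  div : ∀ i → 1 ≤ i → i ≤ n + n → i ∣ A * B
  div i 1≤i i≤ = primePowers⇒∣ (A * B) i (<-wellFounded i) 1≤i pp
    where
    pp : ∀ p k → Prime p → p ^ k ∣ i → p ^ k ∣ A * B
    pp p zero pr d = 1∣ (A * B)
    pp p (suc zero) pr d = subst (_∣ A * B) (sym (*-identityʳ p)) (∣n⇒∣m*n A (Ball p pr (none p pr
      (≤-trans (subst (_≤ i) (*-identityʳ p) (∣⇒≤ {{>-nonZero 1≤i}} d)) (≤-trans i≤ (≤-reflexive nn))))))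
    pp p (suc (suc k)) pr d = ∣m⇒∣m*n B (Aall p (2 + k) (nonTrivial⇒n>1 p {{prime⇒nonTrivial pr}}) p≤ pN)
      where
      pN : p ^ (2 + k) ≤ 2 ^ (K + K)
      pN = ≤-trans (∣⇒≤ {{>-nonZero 1≤i}} d) (≤-trans i≤ (≤-reflexive nn))
      instance _ = prime⇒nonZero pr
      p≤ : p ≤ 2 ^ K
      p≤ = ≮⇒≥ λ lt → <⇒≱ (*-mono-< lt lt) (begin
        p * p             ≤⟨ *-monoʳ-≤ p (m≤m*n p (p ^ k) {{m^n≢0 p k}}) ⟩
        p ^ (2 + k)       ≤⟨ pN ⟩
        2 ^ (K + K)       ≡⟨ ^-distribˡ-+-* 2 K K ⟩
        2 ^ K * 2 ^ K ∎)

log₁₆-bracket : ∀ x → 2 ≤ x → ∃ λ K → 2 ^ (K * 4) < x × x ≤ 2 ^ (suc K * 4)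
log₁₆-bracket x 2≤x = go x (n≤ x)
  where
  n≤ : ∀ x → x ≤ 2 ^ (x * 4)
  n≤ x = ≤-trans (go′ x) (^-monoʳ-≤ 2 (m≤m*n x 4))
    where
    go′ : ∀ k → k ≤ 2 ^ k
    go′ zero = z≤n
    go′ (suc k) = ≤-trans (≤-reflexive (+-comm 1 k))
      (+-mono-≤ (go′ k) (≤-trans (m^n>0 2 k) (m≤m+n _ 0)))
  go : ∀ k → x ≤ 2 ^ (k * 4) → ∃ λ K → 2 ^ (K * 4) < x × x ≤ 2 ^ (suc K * 4)
  go zero h = ⊥-elim (<⇒≱ 2≤x h)
  go (suc k) h with x ≤? 2 ^ (k * 4)
  ... | yes q = go k q
  ... | no ¬q = k , ≰⇒> ¬q , h

scale : ∀ K → 5 ≤ K → (∃ λ M → 3 + M ≡ suc K + suc K) × 8 * suc K < 2 ^ suc K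
scale K 5≤K with m≤n⇒∃[o]m+o≡n 5≤K
... | k , refl = (k + (9 + k) , e k) , 8k<2^k k
  where
  e : ∀ k → 3 + (k + (9 + k)) ≡ (6 + k) + (6 + k)
  e = solve-∀

-- With 16^K < n * 2^10 ≤ 16^L and L = K + 1, the prime lies between 4^L / 8 and 4^L. Squaring loses
-- 2^6 below 16^L, which leaves 2^4 of the 2^10; above, the bracket is wide by 2^4, which gives
-- 2^14.
prime-near-√ : ∀ n → 2 ^ 10 < n → ∃ λ p → Prime p × n * 2 ^ 4 ≤ p * p × p * p ≤ n * 2 ^ 14
prime-near-√ n n> = p , pr , lower , upper
  where
  open ≤-Reasoning
  bracket = log₁₆-bracket (n * 2 ^ 10) (≤-trans (≤-trans (s≤s (s≤s z≤n)) (<⇒≤ n>)) (m≤m*n n (2 ^ 10)))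
  K = proj₁ bracket
  lo = proj₁ (proj₂ bracket)
  hi = proj₂ (proj₂ bracket)
  -- `8 * L < 2 ^ L` needs L ≥ 6. For K < 5 the bracket would give n * 2^10 ≤ 2^20, against n >
  -- 2^10.
  K≮5 : ¬ (K < 5)
  K≮5 K<5 = <⇒≱ n> (*-cancelʳ-≤ n (2 ^ 10) (2 ^ 10) (≤-trans hi l))
    where
    l : 2 ^ (suc K * 4) ≤ 2 ^ (5 * 4)
    l = ^-monoʳ-≤ 2 {suc K * 4} {5 * 4} (*-monoˡ-≤ 4 K<5)
  L = suc K
  sc = scale K (≮⇒≥ K≮5)
  M = proj₁ (proj₁ sc)
  eM : 3 + M ≡ L + L
  eM = proj₂ (proj₁ sc)
  found = prime-in-[4^K/8,4^K] L M eM (proj₂ sc)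
  p = proj₁ found
  pr = proj₁ (proj₂ found)
  p> = proj₁ (proj₂ (proj₂ found))
  p≤ = proj₂ (proj₂ (proj₂ found))
  e₁ : (M + M) + 6 ≡ L * 4
  e₁ = trans (a M) (trans (cong₂ _+_ eM eM) (b L))
    where
    a : ∀ m → (m + m) + 6 ≡ (3 + m) + (3 + m)
    a = solve-∀
    b : ∀ l → (l + l) + (l + l) ≡ l * 4
    b = solve-∀
  e₂ : ∀ K → (suc K + suc K) + (suc K + suc K) ≡ K * 4 + 4
  e₂ = solve-∀
  lower : n * 2 ^ 4 ≤ p * p
  lower = *-cancelʳ-≤ (n * 2 ^ 4) (p * p) (2 ^ 6) (begin
    n * 2 ^ 4 * 2 ^ 6           ≡⟨ *-assoc n (2 ^ 4) (2 ^ 6) ⟩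
    n * 2 ^ 10                  ≤⟨ hi ⟩
    2 ^ (L * 4)                 ≡⟨ cong (2 ^_) (sym e₁) ⟩
    2 ^ ((M + M) + 6)           ≡⟨ ^-distribˡ-+-* 2 (M + M) 6 ⟩
    2 ^ (M + M) * 2 ^ 6         ≡⟨ cong (_* 2 ^ 6) (^-distribˡ-+-* 2 M M) ⟩
    2 ^ M * 2 ^ M * 2 ^ 6       ≤⟨ *-monoˡ-≤ (2 ^ 6) (*-mono-≤ (<⇒≤ p>) (<⇒≤ p>)) ⟩
    p * p * 2 ^ 6 ∎)
  upper : p * p ≤ n * 2 ^ 14
  upper = begin
    p * p                               ≤⟨ *-mono-≤ p≤ p≤ ⟩
    2 ^ (L + L) * 2 ^ (L + L)           ≡⟨ sym (^-distribˡ-+-* 2 (L + L) (L + L)) ⟩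
    2 ^ ((L + L) + (L + L))             ≡⟨ cong (2 ^_) (e₂ K) ⟩
    2 ^ (K * 4 + 4)                     ≡⟨ ^-distribˡ-+-* 2 (K * 4) 4 ⟩
    2 ^ (K * 4) * 2 ^ 4                 ≤⟨ *-monoˡ-≤ (2 ^ 4) (<⇒≤ lo) ⟩
    n * 2 ^ 10 * 2 ^ 4                  ≡⟨ *-assoc n (2 ^ 10) (2 ^ 4) ⟩
    n * 2 ^ 14 ∎

-- Finite sums

∑ : List A → (A → ℕ) → ℕ
∑ [] f = 0
∑ (x ∷ xs) f = f x + ∑ xs f

ind : Bool → ℕ
ind true = 1
ind false = 0

ind≤1 : ∀ b → ind b ≤ 1
ind≤1 true = ≤-refl
ind≤1 false = z≤n

ind-yes : {P : Set} (d : Dec P) → P → ind (does d) ≡ 1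
ind-yes (yes _) _ = refl
ind-yes (no ¬p) p = ⊥-elim (¬p p)

ind-no : {P : Set} (d : Dec P) → ¬ P → ind (does d) ≡ 0
ind-no (yes p) ¬p = ⊥-elim (¬p p)
ind-no (no _) _ = refl

ind-∧ : ∀ a b → ind (a ∧ b) ≡ ind a * ind b
ind-∧ true b = sym (+-identityʳ _)
ind-∧ false b = refl

∑-cong : (xs : List A) {f g : A → ℕ} → (∀ x → x ∈ xs → f x ≡ g x) → ∑ xs f ≡ ∑ xs g
∑-cong [] h = refl
∑-cong (x ∷ xs) h = cong₂ _+_ (h x (here refl)) (∑-cong xs λ y p → h y (there p))

∑-mono : (xs : List A) {f g : A → ℕ} → (∀ x → x ∈ xs → f x ≤ g x) → ∑ xs f ≤ ∑ xs g
∑-mono [] h = z≤n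
∑-mono (x ∷ xs) h = +-mono-≤ (h x (here refl)) (∑-mono xs λ y p → h y (there p))

∑-+ : (xs : List A) (f g : A → ℕ) → ∑ xs (λ x → f x + g x) ≡ ∑ xs f + ∑ xs g
∑-+ [] f g = refl
∑-+ (x ∷ xs) f g = trans (cong (f x + g x +_) (∑-+ xs f g)) (e (f x) (g x) (∑ xs f) (∑ xs g))
  where
  e : ∀ a b c d → a + b + (c + d) ≡ a + c + (b + d)
  e = solve-∀

∑-* : (xs : List A) (c : ℕ) (f : A → ℕ) → ∑ xs (λ x → c * f x) ≡ c * ∑ xs f
∑-* [] c f = sym (*-zeroʳ c)
∑-* (x ∷ xs) c f = trans (cong (c * f x +_) (∑-* xs c f)) (sym (*-distribˡ-+ c (f x) (∑ xs f)))

∑-const : (xs : List A) (c : ℕ) → ∑ xs (λ _ → c) ≡ length xs * c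
∑-const [] c = refl
∑-const (x ∷ xs) c = cong (c +_) (∑-const xs c)

∑-≤ : (xs : List A) {f : A → ℕ} (c : ℕ) → (∀ x → x ∈ xs → f x ≤ c) → ∑ xs f ≤ length xs * c
∑-≤ xs c h = ≤-trans (∑-mono xs h) (≤-reflexive (∑-const xs c))

∑-0 : (xs : List A) {f : A → ℕ} → (∀ x → x ∈ xs → f x ≡ 0) → ∑ xs f ≡ 0
∑-0 xs h = n≤0⇒n≡0 (≤-trans (∑-≤ xs 0 (λ x p → ≤-reflexive (h x p))) (≤-reflexive (*-zeroʳ (length xs))))

∑-++ : (xs ys : List A) (f : A → ℕ) → ∑ (xs ++ ys) f ≡ ∑ xs f + ∑ ys f
∑-++ [] ys f = refl
∑-++ (x ∷ xs) ys f = trans (cong (f x +_) (∑-++ xs ys f)) (sym (+-assoc (f x) _ _))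

∑-map : (xs : List A) (g : A → B) (f : B → ℕ) → ∑ (map g xs) f ≡ ∑ xs (λ x → f (g x))
∑-map [] g f = refl
∑-map (x ∷ xs) g f = cong (f (g x) +_) (∑-map xs g f)

∑-concatMap : (xs : List A) (g : A → List B) (f : B → ℕ) → ∑ (concatMap g xs) f ≡ ∑ xs (λ x → ∑ (g x) f)
∑-concatMap [] g f = refl
∑-concatMap (x ∷ xs) g f = trans (∑-++ (g x) _ f) (cong (∑ (g x) f +_) (∑-concatMap xs g f))

length-∑ : (xs : List A) → length xs ≡ ∑ xs (λ _ → 1)
length-∑ [] = refl
length-∑ (x ∷ xs) = cong suc (length-∑ xs)

∑-swap : (xs : List A) (ys : List B) (f : A → B → ℕ) →
  ∑ xs (λ x → ∑ ys (f x)) ≡ ∑ ys (λ y → ∑ xs (λ x → f x y))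
∑-swap [] ys f = sym (∑-0 ys λ _ _ → refl)
∑-swap (x ∷ xs) ys f = trans (cong (∑ ys (f x) +_) (∑-swap xs ys f)) (sym (∑-+ ys (f x) _))

∑-∈ : {xs : List A} {x : A} (f : A → ℕ) → x ∈ xs → f x ≤ ∑ xs f
∑-∈ f (here refl) = m≤m+n _ _
∑-∈ f (there p) = ≤-trans (∑-∈ f p) (m≤n+m _ _)

∑-single : {xs : List A} {x : A} {f : A → ℕ} → Unique xs → x ∈ xs →
  (∀ y → y ∈ xs → y ≢ x → f y ≡ 0) → ∑ xs f ≡ f x
∑-single {xs = y ∷ xs} (y∉ ∷ u) (here refl) h =
  trans (cong (_ +_) (∑-0 xs λ z p → h z (there p) λ { refl → All.lookup y∉ p refl })) (+-identityʳ _)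
∑-single {xs = y ∷ xs} (y∉ ∷ u) (there p) h =
  cong₂ _+_ (h y (here refl) λ { refl → All.lookup y∉ p refl }) (∑-single u p λ z q → h z (there q))

-- The averaging argument behind every greedy choice below: free rows, light columns and sparse
-- lines.
∑-<⇒∃ : (xs : List A) (f : A → ℕ) (c : ℕ) → ∑ xs f < length xs * c → ∃ λ x → x ∈ xs × f x < c
∑-<⇒∃ (x ∷ xs) f c h with f x <? c
... | yes q = x , here refl , q
... | no ¬q with ∑-<⇒∃ xs f c (+-cancelˡ-< c _ _ (≤-<-trans (+-monoˡ-≤ _ (≮⇒≥ ¬q)) h))
...   | y , p , r = y , there p , r

∑-upTo-δ : ∀ p k → ∑ (upTo p) (λ b → ind (does (k ℕ.≟ b))) ≤ 1
∑-upTo-δ p k with k <? p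
... | yes k<p = ≤-reflexive (trans (∑-single (upTo⁺ p) (∈-upTo⁺ k<p) λ y _ ne → ind-no (k ℕ.≟ y) (λ e → ne (sym e)))
                  (ind-yes (k ℕ.≟ k) refl))
... | no k≮p = ≤-trans (≤-reflexive (∑-0 (upTo p) λ y q → ind-no (k ℕ.≟ y) λ { refl → k≮p (∈-upTo⁻ q) })) z≤n

-- Arithmetic modulo p and the lines of the grid

module Modular (p : ℕ) .{{nz : NonZero p}} where

  _≈_ : ℕ → ℕ → Set
  a ≈ b = a % p ≡ b % p

  ≈-+ : ∀ {a b c d} → a ≈ b → c ≈ d → (a + c) ≈ (b + d)
  ≈-+ {a} {b} {c} {d} e e′ = trans (%-distribˡ-+ a c p)
    (trans (cong₂ (λ x y → (x + y) % p) e e′) (sym (%-distribˡ-+ b d p)))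

  ≈-* : ∀ {a b c d} → a ≈ b → c ≈ d → (a * c) ≈ (b * d)
  ≈-* {a} {b} {c} {d} e e′ = trans (%-distribˡ-* a c p)
    (trans (cong₂ (λ x y → (x * y) % p) e e′) (sym (%-distribˡ-* b d p)))

  neg : ℕ → ℕ
  neg c = p ∸ c % p

  neg-+ : ∀ c a → (neg c + (c + a)) ≈ a
  neg-+ c a = trans (cong (_% p) (sym (+-assoc (neg c) c a))) (%-remove-+ˡ a (divides (suc (c / p)) (begin
    neg c + c                         ≡⟨ cong (neg c +_) (m≡m%n+[m/n]*n c p) ⟩
    neg c + (c % p + c / p * p)       ≡⟨ sym (+-assoc (neg c) _ _) ⟩
    neg c + c % p + c / p * p         ≡⟨ cong (_+ c / p * p) (m∸n+n≡m (m%n≤n c p)) ⟩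
    p + c / p * p ∎)))
    where open ≡-Reasoning

  ≈-cancelˡ : ∀ c {a b} → (c + a) ≈ (c + b) → a ≈ b
  ≈-cancelˡ c {a} {b} e = trans (sym (neg-+ c a)) (trans (≈-+ {neg c} refl e) (neg-+ c b))

  ≈⇒≡ : ∀ {a b} → a < p → b < p → a ≈ b → a ≡ b
  ≈⇒≡ a< b< e = trans (sym (m<n⇒m%n≡m a<)) (trans e (m<n⇒m%n≡m b<))

  β : ℕ → ℕ → ℕ → ℕ
  β a x y = (a * x + y) % p

  β<p : ∀ a x y → β a x y < p
  β<p a x y = m%n<n (a * x + y) p

  β-injective : ∀ a x {y y′} → y < p → y′ < p → β a x y ≡ β a x y′ → y ≡ y′
  β-injective a x y< y′< e = ≈⇒≡ y< y′< (≈-cancelˡ (a * x) e)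

  β-solve : ∀ a x b → b < p → ∃ λ y → y < p × β a x y ≡ b
  β-solve a x b b<p = (neg (a * x) + b) % p , m%n<n _ p , (begin
    (a * x + (neg (a * x) + b) % p) % p   ≡⟨ ≈-+ {a * x} refl (m%n%n≡m%n (neg (a * x) + b) p) ⟩
    (a * x + (neg (a * x) + b)) % p       ≡⟨ cong (_% p) (e (a * x) (neg (a * x)) b) ⟩
    (neg (a * x) + (a * x + b)) % p       ≡⟨ neg-+ (a * x) b ⟩
    b % p                                 ≡⟨ m<n⇒m%n≡m b<p ⟩
    b ∎)
    where
    open ≡-Reasoning
    e : ∀ a b c → a + (b + c) ≡ b + (a + c)
    e = solve-∀

  opaque
    inverse : ∀ d → Coprime d p → ∃ λ e → (e * d) ≈ 1
    inverse d cop with coprime-Bézout cop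
    ... | Bézout.+- x y eq = x , trans (cong (_% p) (sym eq)) ([m+kn]%n≡m%n 1 y p)
    -- Here `1 + x * d` is a multiple of `p`, so the inverse is -x, written as (p - 1) * x.
    ... | Bézout.-+ x y eq = q * x , (begin
      (q * x * d) % p                 ≡⟨ sym ([m+n]%n≡m%n (q * x * d) p) ⟩
      (q * x * d + p) % p             ≡⟨ cong (λ z → (q * x * d + z) % p) (sym (suc-pred p)) ⟩
      (q * x * d + suc q) % p         ≡⟨ cong (_% p) (e q x d) ⟩
      (1 + q * (1 + x * d)) % p       ≡⟨ cong (λ z → (1 + q * z) % p) eq ⟩
      (1 + q * (y * p)) % p           ≡⟨ cong (λ z → (1 + z) % p) (sym (*-assoc q y p)) ⟩
      (1 + q * y * p) % p             ≡⟨ [m+kn]%n≡m%n 1 (q * y) p ⟩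
      1 % p ∎)
      where
      open ≡-Reasoning
      q : ℕ
      q = pred p
      e : ∀ q x d → q * x * d + suc q ≡ 1 + q * (1 + x * d)
      e = solve-∀

  module _ (pr : Prime p) where

    private
      -- The difference x - x′ modulo `p`; nothing is truncated as long as x′ < p.
      δ : ℕ → ℕ → ℕ
      δ x x′ = x + (p ∸ x′)

      x′+δ : ∀ x x′ → x′ < p → x′ + δ x x′ ≡ x + p
      x′+δ x x′ x′< = trans (e x′ x (p ∸ x′)) (cong (x +_) (m+[n∸m]≡n (<⇒≤ x′<)))
        where
        e : ∀ a b c → a + (b + c) ≡ b + (a + c)
        e = solve-∀

      δ-inverse : ∀ {x x′} → x < p → x′ < p → x ≢ x′ → ∃ λ e → (e * δ x x′) ≈ 1
      δ-inverse {x} {x′} x< x′< x≢ = inverse (δ x x′) (prime∤⇒coprime pr λ p∣δ → x≢ (≈⇒≡ x< x′< (begin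
        x % p                ≡⟨ sym ([m+n]%n≡m%n x p) ⟩
        (x + p) % p          ≡⟨ cong (_% p) (sym (x′+δ x x′ x′<)) ⟩
        (x′ + δ x x′) % p    ≡⟨ %-remove-+ʳ x′ p∣δ ⟩
        x′ % p ∎)))
        where open ≡-Reasoning

      translate : ∀ a x x′ y → x′ < p → (a * x′ + (a * δ x x′ + y)) ≈ (a * x + y)
      translate a x x′ y x′< = trans (cong (_% p) (begin
        a * x′ + (a * δ x x′ + y)   ≡⟨ e₁ a x′ (δ x x′) y ⟩
        a * (x′ + δ x x′) + y       ≡⟨ cong (λ z → a * z + y) (x′+δ x x′ x′<) ⟩
        a * (x + p) + y             ≡⟨ e₂ a x p y ⟩
        a * x + y + a * p ∎)) ([m+kn]%n≡m%n (a * x + y) a p)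
        where
        open ≡-Reasoning
        e₁ : ∀ a b c d → a * b + (a * c + d) ≡ a * (b + c) + d
        e₁ = solve-∀
        e₂ : ∀ a x p y → a * (x + p) + y ≡ a * x + y + a * p
        e₂ = solve-∀

    -- Two cells share their line of slope `a` iff a * (x - x′) ≈ y′ - y. The difference of the
    -- columns is invertible modulo the prime, so `a` is determined.
    β-meet-unique : ∀ {x x′} y y′ → x < p → x′ < p → x ≢ x′ → ∀ {a a′} → a < p → a′ < p →
      β a x y ≡ β a x′ y′ → β a′ x y ≡ β a′ x′ y′ → a ≡ a′
    β-meet-unique {x} {x′} y y′ x< x′< x≢ {a} {a′} a< a′< e e′ = ≈⇒≡ a< a′< (begin
      a % p               ≡⟨ sym (unit a) ⟩
      (a * d * u) % p     ≡⟨ ≈-* {a * d} {a′ * d} {u} ad refl ⟩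
      (a′ * d * u) % p    ≡⟨ unit a′ ⟩
      a′ % p ∎)
      where
      open ≡-Reasoning
      d = δ x x′
      u = proj₁ (δ-inverse x< x′< x≢)
      unit : ∀ a → (a * d * u) ≈ a
      unit a = begin
        (a * d * u) % p     ≡⟨ cong (_% p) (trans (*-assoc a d u) (cong (a *_) (*-comm d u))) ⟩
        (a * (u * d)) % p   ≡⟨ ≈-* {a} refl (proj₂ (δ-inverse x< x′< x≢)) ⟩
        (a * 1) % p         ≡⟨ cong (_% p) (*-identityʳ a) ⟩
        a % p ∎
      line : ∀ a → β a x y ≡ β a x′ y′ → (a * d + y) ≈ y′
      line a e = ≈-cancelˡ (a * x′) (trans (translate a x x′ y x′<) e)
      ad : (a * d) ≈ (a′ * d)
      ad = ≈-cancelˡ y (trans (cong (_% p) (+-comm y (a * d))) (trans (line a e)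
             (trans (sym (line a′ e′)) (cong (_% p) (+-comm (a′ * d) y)))))

    opaque
      -- The slope is (y′ - y) / (x - x′), the solution of the same linear congruence.
      β-meet : ∀ {x x′} y y′ → x < p → x′ < p → x ≢ x′ → ∃ λ a → a < p × β a x y ≡ β a x′ y′
      β-meet {x} {x′} y y′ x< x′< x≢ = a , m%n<n _ p , trans (sym (translate a x x′ y x′<)) (≈-+ {a * x′} refl (begin
        (a * d + y) % p                     ≡⟨ ≈-+ {a * d} {u * (neg y + y′) * d} (≈-* {a} {u * (neg y + y′)} {d} (m%n%n≡m%n _ p) refl) refl ⟩
        (u * (neg y + y′) * d + y) % p      ≡⟨ cong (_% p) (e u (neg y + y′) d y) ⟩
        ((u * d) * (neg y + y′) + y) % p    ≡⟨ ≈-+ {(u * d) * (neg y + y′)} {1 * (neg y + y′)} (≈-* {u * d} {1} {neg y + y′} (proj₂ (δ-inverse x< x′< x≢)) refl) refl ⟩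
        (1 * (neg y + y′) + y) % p          ≡⟨ cong (_% p) (e₂ (neg y) y′ y) ⟩
        (neg y + (y + y′)) % p              ≡⟨ neg-+ y y′ ⟩
        y′ % p ∎))
        where
        open ≡-Reasoning
        d : ℕ
        d = δ x x′
        u : ℕ
        u = proj₁ (δ-inverse x< x′< x≢)
        a : ℕ
        a = (u * (neg y + y′)) % p
        e : ∀ u n d y → u * n * d + y ≡ (u * d) * n + y
        e = solve-∀
        e₂ : ∀ n y′ y → 1 * (n + y′) + y ≡ n + (y + y′)
        e₂ = solve-∀

-- Rooted forests

-- A rooted forest in first-child / next-sibling form.
data Forest (V : Set) : Set where
  nil  : Forest V
  node : V → (children siblings : Forest V) → Forest V

module _ {V : Set} where

  verts : Forest V → List V
  verts nil = []
  verts (node v c s) = v ∷ verts c ++ verts s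

  roots : Forest V → List V
  roots nil = []
  roots (node v c s) = v ∷ roots s

  size : Forest V → ℕ
  size T = length (verts T)

  root⇒vert : ∀ T {w} → w ∈ roots T → w ∈ verts T
  root⇒vert (node v c s) (here refl) = here refl
  root⇒vert (node v c s) (there p) = there (∈-++⁺ʳ (verts c) (root⇒vert s p))

  roots≤size : ∀ T → length (roots T) ≤ size T
  roots≤size nil = z≤n
  roots≤size (node v c s) = s≤s (≤-trans (roots≤size s)
    (≤-trans (m≤n+m (size s) (size c)) (≤-reflexive (sym (length-++ (verts c))))))

  SmallTrees : ℕ → Forest V → Set
  SmallTrees h nil = ⊤
  SmallTrees h (node v c s) = suc (size c) ≤ h × SmallTrees h s

  hubVerts : List (V × Forest V) → List V
  hubVerts = concatMap (λ (s , T) → s ∷ verts T)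

  hubVerts-++ : ∀ bs bs′ → hubVerts (bs ++ bs′) ≡ hubVerts bs ++ hubVerts bs′
  hubVerts-++ [] bs′ = refl
  hubVerts-++ ((s , T) ∷ bs) bs′ = cong (s ∷_) (trans (cong (verts T ++_) (hubVerts-++ bs bs′))
    (sym (++-assoc (verts T) (hubVerts bs) (hubVerts bs′))))

  -- Bottom-up, a vertex with fewer than h remaining descendants stays; any other vertex
  -- becomes a hub, listed with the forest of its remaining descendants.
  cut : ℕ → Forest V → Forest V × List (V × Forest V)
  cut h nil = nil , []
  cut h (node v c s) with cut h c | cut h s
  ... | T , bs | T′ , bs′ with size T <? h
  ...   | yes _ = node v T T′ , bs ++ bs′
  ...   | no _ = T′ , (v , T) ∷ bs ++ bs′

  cut-↭ : ∀ h T → verts T ↭ verts (proj₁ (cut h T)) ++ hubVerts (proj₂ (cut h T))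
  cut-↭ h nil = ↭-refl
  cut-↭ h (node v c s) with cut h c | cut h s | cut-↭ h c | cut-↭ h s
  ... | T , bs | T′ , bs′ | e | e′ with size T <? h
  ...   | yes _ = prep v (begin
    verts c ++ verts s
      ↭⟨ ++⁺ e e′ ⟩
    (verts T ++ hubVerts bs) ++ (verts T′ ++ hubVerts bs′)
      ≡⟨ ++-assoc (verts T) _ _ ⟩
    verts T ++ (hubVerts bs ++ (verts T′ ++ hubVerts bs′))
      ≡⟨ cong (verts T ++_) (sym (++-assoc (hubVerts bs) (verts T′) _)) ⟩
    verts T ++ ((hubVerts bs ++ verts T′) ++ hubVerts bs′)
      ↭⟨ ++⁺ˡ (verts T) (++⁺ʳ (hubVerts bs′) (++-comm (hubVerts bs) (verts T′))) ⟩
    verts T ++ ((verts T′ ++ hubVerts bs) ++ hubVerts bs′)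
      ≡⟨ cong (verts T ++_) (++-assoc (verts T′) (hubVerts bs) _) ⟩
    verts T ++ (verts T′ ++ (hubVerts bs ++ hubVerts bs′))
      ≡⟨ sym (++-assoc (verts T) (verts T′) _) ⟩
    (verts T ++ verts T′) ++ (hubVerts bs ++ hubVerts bs′)
      ≡⟨ cong ((verts T ++ verts T′) ++_) (sym (hubVerts-++ bs bs′)) ⟩
    (verts T ++ verts T′) ++ hubVerts (bs ++ bs′) ∎)
    where open PermutationReasoning
  ...   | no _ = begin
    v ∷ verts c ++ verts s
      ↭⟨ prep v (++⁺ e e′) ⟩
    v ∷ (verts T ++ hubVerts bs) ++ (verts T′ ++ hubVerts bs′)
      ≡⟨ sym (++-assoc (v ∷ verts T ++ hubVerts bs) (verts T′) _) ⟩
    ((v ∷ verts T ++ hubVerts bs) ++ verts T′) ++ hubVerts bs′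
      ↭⟨ ++⁺ʳ (hubVerts bs′) (++-comm (v ∷ verts T ++ hubVerts bs) (verts T′)) ⟩
    (verts T′ ++ (v ∷ verts T ++ hubVerts bs)) ++ hubVerts bs′
      ≡⟨ ++-assoc (verts T′) _ _ ⟩
    verts T′ ++ (v ∷ (verts T ++ hubVerts bs) ++ hubVerts bs′)
      ≡⟨ cong (λ z → verts T′ ++ (v ∷ z)) (++-assoc (verts T) _ _) ⟩
    verts T′ ++ (v ∷ verts T ++ (hubVerts bs ++ hubVerts bs′))
      ≡⟨ cong (λ z → verts T′ ++ (v ∷ verts T ++ z)) (sym (hubVerts-++ bs bs′)) ⟩
    verts T′ ++ hubVerts ((v , T) ∷ bs ++ bs′) ∎
    where open PermutationReasoning

  cut-roots : ∀ h T {w} → w ∈ roots (proj₁ (cut h T)) → w ∈ roots T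
  cut-roots h (node v c s) p with cut h c | cut h s | cut-roots h s
  ... | T , bs | T′ , bs′ | ih with size T <? h | p
  ...   | yes _ | here refl = here refl
  ...   | yes _ | there q = there (ih q)
  ...   | no _ | q = there (ih q)

  cut-small : ∀ h T → SmallTrees h (proj₁ (cut h T)) × All (λ b → SmallTrees h (proj₂ b)) (proj₂ (cut h T))
  cut-small h nil = tt , []
  cut-small h (node v c s) with cut h c | cut h s | cut-small h c | cut-small h s
  ... | T , bs | T′ , bs′ | i , j | i′ , j′ with size T <? h
  ...   | yes q = (q , i′) , All.++⁺ j j′
  ...   | no _ = i′ , i ∷ All.++⁺ j j′

  -- The forests listed with different hubs are disjoint, so this lower bound on their sizes limits
  -- the number of hubs to n / h.
  cut-big : ∀ h T → All (λ b → h ≤ size (proj₂ b)) (proj₂ (cut h T))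
  cut-big h nil = []
  cut-big h (node v c s) with cut h c | cut h s | cut-big h c | cut-big h s
  ... | T , bs | T′ , bs′ | j | j′ with size T <? h
  ...   | yes q = All.++⁺ j j′
  ...   | no ¬q = ≮⇒≥ ¬q ∷ All.++⁺ j j′

  module _ (par : V → Maybe V) where

    -- The parent function belongs to the whole graph and the roots are left free, so the property
    -- passes to every piece cut out of a coherent forest.
    Coherent : Forest V → Set
    Coherent nil = ⊤
    Coherent (node v c s) = (∀ {w} → w ∈ roots c → par w ≡ just v) × Coherent c × Coherent s

    coherent-parent : ∀ T → Coherent T → ∀ {w} → w ∈ verts T →
      w ∈ roots T ⊎ ∃ λ u → par w ≡ just u × u ∈ verts T
    coherent-parent (node v c s) (r , cc , cs) (here refl) = inj₁ (here refl)
    coherent-parent (node v c s) (r , cc , cs) (there p) with ∈-++⁻ (verts c) p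
    ... | inj₁ q with coherent-parent c cc q
    ...   | inj₁ rt = inj₂ (v , r rt , here refl)
    ...   | inj₂ (u , e , m) = inj₂ (u , e , there (∈-++⁺ˡ m))
    coherent-parent (node v c s) (r , cc , cs) (there p) | inj₂ q with coherent-parent s cs q
    ...   | inj₁ rt = inj₁ (there rt)
    ...   | inj₂ (u , e , m) = inj₂ (u , e , there (∈-++⁺ʳ (verts c) m))

    HubCoherent : V × Forest V → Set
    HubCoherent (s , T) = Coherent T × (∀ {w} → w ∈ roots T → par w ≡ just s)

    cut-coherent : ∀ h T → Coherent T → Coherent (proj₁ (cut h T)) × All HubCoherent (proj₂ (cut h T))
    cut-coherent h nil _ = tt , []
    cut-coherent h (node v c s) (r , cc , cs)
      with cut h c | cut h s | cut-coherent h c cc | cut-coherent h s cs | (λ {w} → cut-roots h c {w})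
    ... | T , bs | T′ , bs′ | i , j | i′ , j′ | sub with size T <? h
    ...   | yes q = ((λ m → r (sub m)) , i , i′) , All.++⁺ j j′
    ...   | no _ = i′ , (i , (λ m → r (sub m))) ∷ All.++⁺ j j′

-- Greedy placement of a forest in the grid

module Placement {V : Set} (p : ℕ) .{{nz : NonZero p}} (h n : ℕ)
  (8h≤p : h * 8 ≤ p) (n≤hp : n ≤ h * p) (n<28hh : n < h * h * 28) where

  open Modular p

  Entry : Set
  Entry = V × ℕ × ℕ

  inLine : ℕ → ℕ → Entry → ℕ
  inLine a b (_ , x , y) = ind (does (β a x y ℕ.≟ b))

  inColumn : ℕ → Entry → ℕ
  inColumn x (_ , x′ , _) = ind (does (x′ ℕ.≟ x))

  inRow : ℕ → Entry → ℕ
  inRow y (_ , _ , y′) = ind (does (y′ ℕ.≟ y))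

  -- Only the cells are required to be distinct. That no vertex is placed twice follows from the
  -- permutations that accompany each placement.
  Valid : List Entry → Set
  Valid P = Unique (map proj₂ P) × All (λ e → proj₁ (proj₂ e) < p × proj₂ (proj₂ e) < p) P

  _⊑_ : List Entry → List Entry → Set
  P ⊑ P′ = ∀ {e} → e ∈ P → e ∈ P′

  At : List Entry → ℕ → V → Set
  At P x w = ∃ λ y → (w , x , y) ∈ P

  At-⊑ : ∀ {P P′ x w} → P ⊑ P′ → At P x w → At P′ x w
  At-⊑ s (y , m) = y , s m

  opaque
    fresh-row : ∀ P x → ∑ P (inColumn x) < p → ∃ λ y → y < p × (x , y) ∉ map proj₂ P
    fresh-row P x few with ∑-<⇒∃ (upTo p) (λ y → ∑ P (λ e → inColumn x e * inRow y e)) 1 (begin-strict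
        ∑ (upTo p) (λ y → ∑ P (λ e → inColumn x e * inRow y e))
          ≡⟨ ∑-swap (upTo p) P _ ⟩
        ∑ P (λ e → ∑ (upTo p) (λ y → inColumn x e * inRow y e))
          ≤⟨ ∑-mono P (λ e _ → ≤-trans (≤-reflexive (∑-* (upTo p) (inColumn x e) _))
               (≤-trans (*-monoʳ-≤ (inColumn x e) (∑-upTo-δ p (proj₂ (proj₂ e)))) (≤-reflexive (*-identityʳ _)))) ⟩
        ∑ P (inColumn x)
          <⟨ few ⟩
        p
          ≡⟨ trans (sym (*-identityʳ p)) (cong (_* 1) (sym (length-upTo p))) ⟩
        length (upTo p) * 1 ∎)
      where open ≤-Reasoning
    ... | y , y∈ , none = y , ∈-upTo⁻ y∈ , free
      where
      free : (x , y) ∉ map proj₂ P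
      free m with ∈-map⁻ proj₂ m
      ... | (v , .x , .y) , e∈ , refl = <⇒≱ none (≤-trans
        (≤-reflexive (sym (cong₂ _*_ (ind-yes (x ℕ.≟ x) refl) (ind-yes (y ℕ.≟ y) refl))))
        (∑-∈ (λ e → inColumn x e * inRow y e) e∈))

  add-valid : ∀ {P v x y} → Valid P → x < p → y < p → (x , y) ∉ map proj₂ P → Valid ((v , x , y) ∷ P)
  add-valid {P} {v} {x} {y} (u , a) x< y< new =
    All.tabulate (λ m e → new (subst (_∈ map proj₂ P) (sym e) m)) ∷ u , (x< , y<) ∷ a

  opaque
    -- The column `x` meets the line `(a , b)` in one cell only, and `v₀` already sits there. Hence
    -- the remaining vertices of the tree, put in other rows of the column, leave the load of the
    -- line unchanged.
    place-rest : ∀ ws P x a b {v₀ y₀} → Valid P → x < p → ∑ P (inColumn x) + length ws ≤ p →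
      (v₀ , x , y₀) ∈ P → β a x y₀ ≡ b →
      ∃ λ P′ → Valid P′ × map proj₁ P′ ↭ ws ++ map proj₁ P × P ⊑ P′ × (∀ {w} → w ∈ ws → At P′ x w)
        × ∑ P′ (inLine a b) ≡ ∑ P (inLine a b)
    place-rest [] P x a b val x< room m₀ e₀ = P , val , ↭-refl , (λ m → m) , (λ ()) , refl
    place-rest (w ∷ ws) P x a b {v₀} {y₀} val x< room m₀ e₀
      with fresh-row P x (≤-trans (≤-trans (≤-reflexive (+-comm 1 _)) (+-monoʳ-≤ _ (s≤s z≤n))) room)
    ... | y , y< , new with place-rest ws ((w , x , y) ∷ P) x a b (add-valid val x< y< new) x<
            (≤-trans (≤-reflexive (trans (cong (λ z → z + ∑ P (inColumn x) + length ws) (ind-yes (x ℕ.≟ x) refl))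
               (sym (+-suc (∑ P (inColumn x)) (length ws))))) room) (there m₀) e₀
    ...   | P′ , val′ , perm , sub , at , occ =
            P′ , val′ , ↭-trans perm (shift w ws (map proj₁ P)) , (λ m → sub (there m))
            , (λ { (here refl) → y , sub (here refl) ; (there m) → at m })
            , trans occ (cong (_+ ∑ P (inLine a b)) (ind-no (β a x y ℕ.≟ b) λ e →
                new (subst (λ z → (x , z) ∈ map proj₂ P)
                  (β-injective a x (proj₂ (All.lookup (proj₂ val) m₀)) y< (trans e₀ (sym e))) (∈-map⁺ proj₂ m₀))))

  -- An entry weighs 1, and w more if it lies on the line. A column of weight less than w thus meets
  -- the line in a free cell and has fewer than w entries.
  available-column : ∀ w P a b → b < p → length P + w * ∑ P (inLine a b) < p * w →
    ∃₂ λ x y → x < p × y < p × β a x y ≡ b × (x , y) ∉ map proj₂ P × ∑ P (inColumn x) < w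
  available-column w P a b b<p few = x , y , ∈-upTo⁻ x∈ , y< , on , free
      , ≤-<-trans (∑-mono P λ e _ → m≤m*n (inColumn x e) (1 + w * inLine a b e)) light
    where
    open ≤-Reasoning
    weight : ℕ → Entry → ℕ
    weight x e = inColumn x e * (1 + w * inLine a b e)
    total : ∑ (upTo p) (λ x → ∑ P (weight x)) < length (upTo p) * w
    total = begin-strict
      ∑ (upTo p) (λ x → ∑ P (weight x))
        ≡⟨ ∑-swap (upTo p) P weight ⟩
      ∑ P (λ e → ∑ (upTo p) (λ x → weight x e))
        ≤⟨ ∑-mono P (λ e _ → each e) ⟩
      ∑ P (λ e → 1 + w * inLine a b e)
        ≡⟨ trans (∑-+ P (λ _ → 1) (λ e → w * inLine a b e)) (cong₂ _+_ (sym (length-∑ P)) (∑-* P w (inLine a b))) ⟩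
      length P + w * ∑ P (inLine a b)
        <⟨ few ⟩
      p * w
        ≡⟨ cong (_* w) (sym (length-upTo p)) ⟩
      length (upTo p) * w ∎
      where
      each : ∀ e → ∑ (upTo p) (λ x → weight x e) ≤ 1 + w * inLine a b e
      each e@(_ , x′ , _) = begin
        ∑ (upTo p) (λ x → weight x e)                    ≡⟨ ∑-cong (upTo p) (λ x _ → *-comm (inColumn x e) c) ⟩
        ∑ (upTo p) (λ x → c * inColumn x e)              ≡⟨ ∑-* (upTo p) c (λ x → inColumn x e) ⟩
        c * ∑ (upTo p) (λ x → inColumn x e)              ≤⟨ *-monoʳ-≤ c (∑-upTo-δ p x′) ⟩
        c * 1                                            ≡⟨ *-identityʳ c ⟩
        c ∎
        where c = 1 + w * inLine a b e
    found = ∑-<⇒∃ (upTo p) (λ x → ∑ P (weight x)) w total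
    x = proj₁ found
    x∈ = proj₁ (proj₂ found)
    light = proj₂ (proj₂ found)
    solution = β-solve a x b b<p
    y = proj₁ solution
    y< = proj₁ (proj₂ solution)
    on = proj₂ (proj₂ solution)
    free : (x , y) ∉ map proj₂ P
    free m with ∈-map⁻ proj₂ m
    ... | (v , x′ , y′) , e∈ , eq = <⇒≱ light (begin
      w                               ≤⟨ n≤1+n w ⟩
      1 + w                           ≡⟨ sym (trans (+-identityʳ (1 + w * 1)) (cong suc (*-identityʳ w))) ⟩
      1 * (1 + w * 1)                 ≡⟨ sym (cong₂ (λ i j → i * (1 + w * j))
                                           (ind-yes (x′ ℕ.≟ x) (sym (cong proj₁ eq)))
                                           (ind-yes (β a x′ y′ ℕ.≟ b) (trans (cong (λ c → β a (proj₁ c) (proj₂ c)) (sym eq)) on))) ⟩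
      weight x (v , x′ , y′)          ≤⟨ ∑-∈ (weight x) e∈ ⟩
      ∑ P (weight x) ∎)

  opaque
    -- The `p` lines of one slope share at most n ≤ h * p entries, so some line carries no more than
    -- the average `h`.
    sparse-line : ∀ P a → length P ≤ n → ∃ λ b → b < p × ∑ P (inLine a b) ≤ h
    sparse-line P a lenP with ∑-<⇒∃ (upTo p) (λ b → ∑ P (inLine a b)) (suc h) (begin-strict
        ∑ (upTo p) (λ b → ∑ P (inLine a b))     ≡⟨ ∑-swap (upTo p) P _ ⟩
        ∑ P (λ e → ∑ (upTo p) (λ b → inLine a b e)) ≤⟨ ∑-≤ P 1 (λ (_ , x , y) _ → ∑-upTo-δ p (β a x y)) ⟩
        length P * 1                            ≡⟨ *-identityʳ _ ⟩
        length P                                ≤⟨ ≤-trans lenP n≤hp ⟩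
        h * p                                   <⟨ *-monoˡ-< p (n<1+n h) ⟩
        suc h * p                               ≡⟨ trans (*-comm (suc h) p) (cong (_* suc h) (sym (length-upTo p))) ⟩
        length (upTo p) * suc h ∎)
      where open ≤-Reasoning
    ... | b , b∈ , lt = b , ∈-upTo⁻ b∈ , s≤s⁻¹ lt

  opaque
    -- The balance of the constants: fewer than 28 h² entries, and the extra weight 7h for each of
    -- the at most 4h entries on the line, together stay below 56 h² = 8h * 7h ≤ p * 7h. So some
    -- column has weight less than 7h.
    few : ∀ l o → l ≤ n → o < h * 4 → l + h * 7 * o < p * (h * 7)
    few l o l≤n o< = begin-strict
      l + h * 7 * o                  <⟨ +-mono-<-≤ (≤-<-trans l≤n n<28hh) (*-monoʳ-≤ (h * 7) (<⇒≤ o<)) ⟩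
      h * h * 28 + h * 7 * (h * 4)   ≡⟨ e h ⟩
      h * 8 * (h * 7)                ≤⟨ *-monoˡ-≤ (h * 7) 8h≤p ⟩
      p * (h * 7) ∎
      where
      open ≤-Reasoning
      e : ∀ h → h * h * 28 + h * 7 * (h * 4) ≡ h * 8 * (h * 7)
      e = solve-∀

    -- A column with fewer than 7h entries still takes a whole tree of at most h vertices, since 8h
    -- ≤ p.
    room : ∀ l k → l < h * 7 → k ≤ h → l + k ≤ p
    room l k l< k≤ = ≤-trans (+-mono-≤ (<⇒≤ l<) k≤)
      (≤-trans (≤-reflexive (trans (+-comm (h * 7) h) (sym (*-suc h 7)))) 8h≤p)

  opaque
    free-column : ∀ P a b → length P ≤ n → ∑ P (inLine a b) < h * 4 → b < p →
      ∃₂ λ x y → x < p × y < p × β a x y ≡ b × (x , y) ∉ map proj₂ P × ∑ P (inColumn x) < h * 7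
    free-column P a b lenP occ b<p = available-column (h * 7) P a b b<p (few (length P) (∑ P (inLine a b)) lenP occ)

  opaque
    -- The root takes a free cell of the line in a light column, and the rest of its tree joins it
    -- there off the line; so a tree of any size raises the load by at most one.
    place-tree : ∀ v c P a b → Valid P → suc (size c) ≤ h → length P + suc (size c) ≤ n →
      ∑ P (inLine a b) < h * 4 → b < p →
      ∃ λ P′ → Valid P′ × map proj₁ P′ ↭ (v ∷ verts c) ++ map proj₁ P × P ⊑ P′
        × (∃ λ x → (∀ {w} → w ∈ v ∷ verts c → At P′ x w) × ∃ λ y → (v , x , y) ∈ P′ × β a x y ≡ b)
        × ∑ P′ (inLine a b) ≤ suc (∑ P (inLine a b))
    place-tree v c P a b val small lenP occ b<p
      with free-column P a b (≤-trans (m≤m+n (length P) (suc (size c))) lenP) occ b<p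
    ... | x , y , x< , y< , on , free , light
      with place-rest (verts c) ((v , x , y) ∷ P) x a b (add-valid val x< y< free) x< crowd (here refl) on
      where
      crowd : ∑ ((v , x , y) ∷ P) (inColumn x) + size c ≤ p
      crowd = ≤-trans (≤-reflexive (trans (cong (λ z → z + ∑ P (inColumn x) + size c) (ind-yes (x ℕ.≟ x) refl))
        (sym (+-suc (∑ P (inColumn x)) (size c))))) (room (∑ P (inColumn x)) (suc (size c)) light small)
    ... | P′ , val′ , perm , sub , at , occ′ = P′ , val′ , ↭-trans perm (shift v (verts c) (map proj₁ P))
        , (λ m → sub (there m))
        , (x , (λ { (here refl) → y , sub (here refl) ; (there m) → at m }) , y , sub (here refl) , on)
        , ≤-trans (≤-reflexive occ′) (+-monoˡ-≤ (∑ P (inLine a b)) (ind≤1 (does (β a x y ℕ.≟ b))))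

  Columnar : List Entry → Forest V → Set
  Columnar P nil = ⊤
  Columnar P (node v c s) = (∃ λ x → ∀ {w} → w ∈ v ∷ verts c → At P x w) × Columnar P s

  Columnar-⊑ : ∀ {P P′} T → P ⊑ P′ → Columnar P T → Columnar P′ T
  Columnar-⊑ nil sub _ = tt
  Columnar-⊑ {P} {P′} (node v c s) sub ((x , at) , cs) =
    (x , λ m → At-⊑ {P} {P′} sub (at m)) , Columnar-⊑ s sub cs

  RootsOn : List Entry → ℕ → List ℕ → Forest V → Set
  RootsOn P a bs T = ∀ {w} → w ∈ roots T → ∃₂ λ x y → (w , x , y) ∈ P × β a x y ∈ bs

  Placed : List Entry → Forest V → List Entry → Set
  Placed P T P′ = Valid P′ × map proj₁ P′ ↭ verts T ++ map proj₁ P × P ⊑ P′ × Columnar P′ T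

  Placed-length : ∀ {P T P′} → Placed P T P′ → length P′ ≡ size T + length P
  Placed-length {P} {T} {P′} (_ , perm , _) = begin
    length P′                          ≡⟨ sym (length-map proj₁ P′) ⟩
    length (map proj₁ P′)              ≡⟨ ↭-length perm ⟩
    length (verts T ++ map proj₁ P)    ≡⟨ length-++ (verts T) ⟩
    size T + length (map proj₁ P)      ≡⟨ cong (size T +_) (length-map proj₁ P) ⟩
    size T + length P ∎
    where open ≡-Reasoning

  -- The line b in use is given up once it carries 4h entries, for a line with at most h of them.
  opaque
    place-forest : ∀ T P a b → Valid P → SmallTrees h T → length P + size T ≤ n →
      ∑ P (inLine a b) ≤ h * 4 → b < p →
      ∃₂ λ P′ bs → Placed P T P′ × RootsOn P′ a (b ∷ bs) T
        × h * 3 * length bs ≤ length (roots T) + ∑ P (inLine a b)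
    place-node : ∀ v c s P a b → Valid P → suc (size c) ≤ h → SmallTrees h s → length P + size (node v c s) ≤ n →
      ∑ P (inLine a b) < h * 4 → b < p →
      ∃₂ λ P′ bs → Placed P (node v c s) P′ × RootsOn P′ a (b ∷ bs) (node v c s)
        × h * 3 * length bs ≤ suc (length (roots s) + ∑ P (inLine a b))
    place-forest nil P a b val small lenP occ b<p =
      P , [] , (val , ↭-refl , (λ m → m) , tt) , (λ ()) , ≤-trans (≤-reflexive (*-zeroʳ (h * 3))) z≤n
    place-forest (node v c s) P a b val (small , smalls) lenP occ b<p with ∑ P (inLine a b) <? h * 4
    ... | yes occ< = place-node v c s P a b val small smalls lenP occ< b<p
    -- The load serves as a potential: it drops from at least 4h to at most h, and this drop of 3h
    -- pays for the new member of `bs`. Between two changes it grows by at most one per root.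
    ... | no ¬occ< with sparse-line P a (≤-trans (m≤m+n _ _) lenP)
    ...   | b′ , b′<p , sparse with place-node v c s P a b′ val small smalls lenP
               (≤-<-trans sparse (m<m*n h 4 {{>-nonZero (≤-trans (s≤s z≤n) small)}} (s≤s (s≤s z≤n)))) b′<p
    ...     | P′ , bs , pl , on , cnt = P′ , b′ ∷ bs , pl
            , (λ m → let (x , y , q , r) = on m in x , y , q , there r)
            , (begin
      h * 3 * suc (length bs)                               ≡⟨ *-suc (h * 3) (length bs) ⟩
      h * 3 + h * 3 * length bs                             ≤⟨ +-monoʳ-≤ (h * 3) cnt ⟩
      h * 3 + suc (length (roots s) + ∑ P (inLine a b′))    ≤⟨ +-monoʳ-≤ (h * 3) (s≤s (+-monoʳ-≤ (length (roots s)) sparse)) ⟩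
      h * 3 + suc (length (roots s) + h)                    ≡⟨ e h (length (roots s)) ⟩
      suc (length (roots s)) + h * 4                        ≤⟨ +-monoʳ-≤ (suc (length (roots s))) (≮⇒≥ ¬occ<) ⟩
      suc (length (roots s)) + ∑ P (inLine a b) ∎)
      where
      open ≤-Reasoning
      e : ∀ h r → h * 3 + suc (r + h) ≡ suc r + h * 4
      e = solve-∀
    place-node v c s P a b val small smalls lenP occ b<p
      with place-tree v c P a b val small (≤-trans (+-monoʳ-≤ (length P) (s≤s (≤-trans (m≤m+n (size c) (size s))
             (≤-reflexive (sym (length-++ (verts c))))))) lenP) occ b<p
    ... | P₁ , val₁ , perm₁ , sub₁ , (x , at , y , m₀ , on₀) , occ₁
      with place-forest s P₁ a b val₁ smalls lenP₁ (≤-trans occ₁ occ) b<p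
      where
      lenP₁ : length P₁ + size s ≤ n
      lenP₁ = ≤-trans (≤-reflexive (begin
        length P₁ + size s                             ≡⟨ cong (_+ size s) (sym (length-map proj₁ P₁)) ⟩
        length (map proj₁ P₁) + size s                 ≡⟨ cong (_+ size s) (↭-length perm₁) ⟩
        suc (length (verts c ++ map proj₁ P)) + size s ≡⟨ cong (λ z → suc z + size s) (trans (length-++ (verts c)) (cong (size c +_) (length-map proj₁ P))) ⟩
        suc (size c + length P) + size s               ≡⟨ e (size c) (length P) (size s) ⟩
        length P + suc (size c + size s)               ≡⟨ cong (λ z → length P + suc z) (sym (length-++ (verts c))) ⟩
        length P + size (node v c s) ∎)) lenP
        where
        open ≡-Reasoning
        e : ∀ c l s → suc (c + l) + s ≡ l + suc (c + s)
        e = solve-∀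
    ... | P′ , bs , (val′ , perm′ , sub′ , cols′) , on′ , cnt′ =
          P′ , bs
          , (val′ , perm , (λ m → sub′ (sub₁ m)) , ((x , λ m → At-⊑ {P₁} {P′} sub′ (at m)) , cols′))
          , (λ { (here refl) → x , y , sub′ m₀ , here on₀ ; (there m) → on′ m })
          , ≤-trans cnt′ (≤-trans (+-monoʳ-≤ (length (roots s)) occ₁) (≤-reflexive (+-suc _ _)))
      where
      open PermutationReasoning
      perm : map proj₁ P′ ↭ verts (node v c s) ++ map proj₁ P
      perm = begin
        map proj₁ P′                                      ↭⟨ perm′ ⟩
        verts s ++ map proj₁ P₁                           ↭⟨ ++⁺ˡ (verts s) perm₁ ⟩
        verts s ++ ((v ∷ verts c) ++ map proj₁ P)         ≡⟨ sym (++-assoc (verts s) (v ∷ verts c) _) ⟩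
        (verts s ++ (v ∷ verts c)) ++ map proj₁ P         ↭⟨ ++⁺ʳ (map proj₁ P) (++-comm (verts s) (v ∷ verts c)) ⟩
        verts (node v c s) ++ map proj₁ P ∎

  itemVerts : List (ℕ × Forest V) → List V
  itemVerts = concatMap (λ i → verts (proj₂ i))

  opaque
    -- Each forest starts on a line of load at most h, so 3h * `length bs` ≤ roots + h. Counting the
    -- starting line as well, h times the number of its lines is at most 2h plus its size; the slack
    -- in `fresh-lines` only rounds the constants up. The sum over the items gives the last bound.
    place-items : ∀ items P → Valid P → All (λ i → SmallTrees h (proj₂ i)) items →
      length P + length (itemVerts items) ≤ n →
      ∃₂ λ P′ bad → Valid P′ × map proj₁ P′ ↭ itemVerts items ++ map proj₁ P × P ⊑ P′
        × (∀ {a T} → (a , T) ∈ items → Columnar P′ T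
            × (∀ {w} → w ∈ roots T → ∃₂ λ x y → (w , x , y) ∈ P′ × (a , β a x y) ∈ bad))
        × h * length bad ≤ length items * (h * 2) + length (itemVerts items)
    place-items [] P val small lenP = P , [] , val , ↭-refl , (λ m → m) , (λ ()) , ≤-reflexive (*-zeroʳ h)
    place-items ((a , T) ∷ items) P val (small ∷ smalls) lenP with sparse-line P a (≤-trans (m≤m+n _ _) lenP)
    ... | b , b<p , sparse with place-forest T P a b val small
             (≤-trans (+-monoʳ-≤ (length P) (≤-trans (m≤m+n (size T) _) (≤-reflexive (sym (length-++ (verts T)))))) lenP)
             (≤-trans sparse (m≤m*n h 4)) b<p
    ...   | P₁ , bs , pl@(val₁ , perm₁ , sub₁ , cols₁) , on₁ , cnt₁
      with place-items items P₁ val₁ smalls lenP₁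
      where
      lenP₁ : length P₁ + length (itemVerts items) ≤ n
      lenP₁ = ≤-trans (≤-reflexive (begin
        length P₁ + R                         ≡⟨ cong (_+ R) (Placed-length {P} {T} pl) ⟩
        (size T + length P) + R               ≡⟨ e (size T) (length P) R ⟩
        length P + (size T + R)               ≡⟨ cong (length P +_) (sym (length-++ (verts T))) ⟩
        length P + length (itemVerts ((a , T) ∷ items)) ∎)) lenP
        where
        open ≡-Reasoning
        R : ℕ
        R = length (itemVerts items)
        e : ∀ a b c → (a + b) + c ≡ b + (a + c)
        e = solve-∀
    ...     | P′ , bad , val′ , perm′ , sub′ , props , cnt′ =
              P′ , map (a ,_) (b ∷ bs) ++ bad , val′ , perm , (λ m → sub′ (sub₁ m)) , props′ , cnt
      where
      perm : map proj₁ P′ ↭ itemVerts ((a , T) ∷ items) ++ map proj₁ P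
      perm = begin
        map proj₁ P′                                          ↭⟨ perm′ ⟩
        itemVerts items ++ map proj₁ P₁                       ↭⟨ ++⁺ˡ (itemVerts items) perm₁ ⟩
        itemVerts items ++ (verts T ++ map proj₁ P)           ≡⟨ sym (++-assoc (itemVerts items) (verts T) _) ⟩
        (itemVerts items ++ verts T) ++ map proj₁ P           ↭⟨ ++⁺ʳ (map proj₁ P) (++-comm (itemVerts items) (verts T)) ⟩
        itemVerts ((a , T) ∷ items) ++ map proj₁ P ∎
        where open PermutationReasoning
      props′ : ∀ {a′ T′} → (a′ , T′) ∈ (a , T) ∷ items → Columnar P′ T′
        × (∀ {w} → w ∈ roots T′ → ∃₂ λ x y → (w , x , y) ∈ P′ × (a′ , β a′ x y) ∈ map (a ,_) (b ∷ bs) ++ bad)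
      props′ (here refl) = Columnar-⊑ {P₁} {P′} T sub′ cols₁
        , λ m → let (x , y , q , r) = on₁ m in x , y , sub′ q , ∈-++⁺ˡ (∈-map⁺ (a ,_) r)
      props′ (there i) = proj₁ (props i)
        , λ m → let (x , y , q , r) = proj₂ (props i) m in x , y , q , ∈-++⁺ʳ (map (a ,_) (b ∷ bs)) r
      open ≤-Reasoning
      fresh-lines : h * suc (length bs) ≤ h * 2 + size T
      fresh-lines = *-cancelʳ-≤ _ _ 3 (begin
        h * suc (length bs) * 3                         ≡⟨ e h (length bs) ⟩
        h * 3 + h * 3 * length bs                       ≤⟨ +-monoʳ-≤ (h * 3) cnt₁ ⟩
        h * 3 + (length (roots T) + ∑ P (inLine a b))   ≤⟨ +-monoʳ-≤ (h * 3) (+-mono-≤ (roots≤size T) sparse) ⟩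
        h * 3 + (size T + h)                            ≤⟨ m≤m+n _ (h * 2 + size T * 2) ⟩
        h * 3 + (size T + h) + (h * 2 + size T * 2)     ≡⟨ e₂ h (size T) ⟩
        (h * 2 + size T) * 3 ∎)
        where
        e : ∀ h l → h * suc l * 3 ≡ h * 3 + h * 3 * l
        e = solve-∀
        e₂ : ∀ h t → h * 3 + (t + h) + (h * 2 + t * 2) ≡ (h * 2 + t) * 3
        e₂ = solve-∀
      cnt : h * length (map (a ,_) (b ∷ bs) ++ bad) ≤ suc (length items) * (h * 2) + length (itemVerts ((a , T) ∷ items))
      cnt = begin
        h * length (map (a ,_) (b ∷ bs) ++ bad)
          ≡⟨ cong (h *_) (trans (length-++ (map (a ,_) (b ∷ bs))) (cong (_+ length bad) (length-map (a ,_) (b ∷ bs)))) ⟩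
        h * (suc (length bs) + length bad)
          ≡⟨ *-distribˡ-+ h (suc (length bs)) (length bad) ⟩
        h * suc (length bs) + h * length bad
          ≤⟨ +-mono-≤ fresh-lines cnt′ ⟩
        (h * 2 + size T) + (length items * (h * 2) + length (itemVerts items))
          ≡⟨ e (h * 2) (size T) (length items * (h * 2)) (length (itemVerts items)) ⟩
        suc (length items) * (h * 2) + (size T + length (itemVerts items))
          ≡⟨ cong (suc (length items) * (h * 2) +_) (sym (length-++ (verts T))) ⟩
        suc (length items) * (h * 2) + length (itemVerts ((a , T) ∷ items)) ∎
        where
        e : ∀ a b c d → (a + b) + (c + d) ≡ (a + c) + (b + d)
        e = solve-∀

-- Clique partitions

∑-≤1 : {xs : List A} {f : A → ℕ} → Unique xs → (∀ x → f x ≤ 1) →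
  (∀ {x y} → f x ≢ 0 → f y ≢ 0 → x ≡ y) → ∑ xs f ≤ 1
∑-≤1 {xs = []} _ _ _ = z≤n
∑-≤1 {xs = x ∷ xs} {f} (x∉ ∷ u) b inj with f x ℕ.≟ 0
... | yes e = ≤-trans (≤-reflexive (cong (_+ ∑ xs f) e)) (∑-≤1 u b inj)
... | no ne = ≤-trans (≤-reflexive (cong (f x +_) (∑-0 xs zeros))) (≤-trans (≤-reflexive (+-identityʳ _)) (b x))
  where
  zeros : ∀ y → y ∈ xs → f y ≡ 0
  zeros y m with f y ℕ.≟ 0
  ... | yes e = e
  ... | no ne′ = ⊥-elim (All.lookup x∉ m (inj ne ne′))

∑-upTo-pick : ∀ {p k} (g : ℕ → ℕ) → k < p → ∑ (upTo p) (λ b → ind (does (k ℕ.≟ b)) * g b) ≡ g k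
∑-upTo-pick {p} {k} g k<p = trans
  (∑-single (upTo⁺ p) (∈-upTo⁺ k<p) λ y _ ne → cong (_* g y) (ind-no (k ℕ.≟ y) λ e → ne (sym e)))
  (trans (cong (_* g k) (ind-yes (k ℕ.≟ k) refl)) (*-identityˡ (g k)))

module Membership {A : Set} (_≟_ : DecidableEquality A) where
  _∈?_ : (x : A) (xs : List A) → Dec (x ∈ xs)
  x ∈? xs = any? (x ≟_) xs

  𝟙 : List A → A → ℕ
  𝟙 L v = ind (does (v ∈? L))

module Cliques {N : ℕ} (F : Graph N) where

  V : Set
  V = Fin N

  open Membership {V} Fin._≟_ public

  ∑V : (V → ℕ) → ℕ
  ∑V = ∑ (allFin N)

  ∑V-single : (v : V) (f : V → ℕ) → (∀ w → w ≢ v → f w ≡ 0) → ∑V f ≡ f v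
  ∑V-single v f h = ∑-single (allFin⁺ N) (∈-allFin v) λ w _ → h w

  ∑V-δ : (v : V) → ∑V (λ w → ind (does (v Fin.≟ w))) ≡ 1
  ∑V-δ v = trans (∑V-single v _ λ w ne → ind-no (v Fin.≟ w) λ e → ne (sym e)) (ind-yes (v Fin.≟ v) refl)

  private
    length-∑∑ : ∀ L → length L ≡ ∑V (λ v → ∑ L (λ w → ind (does (w Fin.≟ v))))
    length-∑∑ L = trans (length-∑ L) (trans (∑-cong L λ w _ → sym (∑V-δ w)) (∑-swap L (allFin N) _))

  ∑-𝟙≤ : ∀ L → ∑V (𝟙 L) ≤ length L
  ∑-𝟙≤ L = ≤-trans (∑-mono (allFin N) λ v _ → le v) (≤-reflexive (sym (length-∑∑ L)))
    where
    le : ∀ v → 𝟙 L v ≤ ∑ L (λ w → ind (does (w Fin.≟ v)))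
    le v with v ∈? L
    ... | yes m = ≤-trans (≤-reflexive (sym (ind-yes (v Fin.≟ v) refl))) (∑-∈ (λ w → ind (does (w Fin.≟ v))) m)
    ... | no _ = z≤n

  length≤∑-𝟙 : ∀ L → Unique L → length L ≤ ∑V (𝟙 L)
  length≤∑-𝟙 L u = ≤-trans (≤-reflexive (length-∑∑ L)) (∑-mono (allFin N) λ v _ → le v)
    where
    le : ∀ v → ∑ L (λ w → ind (does (w Fin.≟ v))) ≤ 𝟙 L v
    le v with v ∈? L
    ... | no v∉ = ≤-reflexive (∑-0 L λ w m → ind-no (w Fin.≟ v) λ { refl → v∉ m })
    ... | yes _ = ∑-≤1 u (λ w → ind≤1 _) λ {x} {y} a b → trans (only x a) (sym (only y b))
      where
      only : ∀ w → ind (does (w Fin.≟ v)) ≢ 0 → w ≡ v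
      only w ne with w Fin.≟ v
      ... | yes e = e
      ... | no _ = ⊥-elim (ne refl)

  Clique : Set
  Clique = V → Bool

  count : List Clique → V → V → ℕ
  count cs u v = ∑ cs (λ c → ind (c u ∧ c v))

  nonEdge : V → V → ℕ
  nonEdge u v = ind (not (F u v))

  -- Singletons are irrelevant: only the pairs u ≢ v are constrained.
  Partition : (V → Bool) → ℕ → Set
  Partition X k = ∃ λ cs → length cs ≤ k × (∀ {u v} → u ≢ v → count cs u v ≡ ind (X u ∧ X v ∧ not (F u v)))

  pair : V → V → Clique
  pair u v w = does (w Fin.≟ u) ∨ does (w Fin.≟ v)

  module Pairs (R : V → V → Bool) (R-sym : ∀ u v → R u v ≡ R v u) where

    -- The order of the indices selects one orientation, so that a related pair yields a single
    -- clique. The bound on the length is content with counting both orientations.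
    chosen : V → V → Bool
    chosen u v = R u v ∧ does (toℕ u <? toℕ v)

    pairsAt : V → V → List Clique
    pairsAt u v = if chosen u v then pair u v ∷ [] else []

    pairs : List Clique
    pairs = concatMap (λ u → concatMap (pairsAt u) (allFin N)) (allFin N)

    ∑-pairsAt : ∀ u v (f : Clique → ℕ) → ∑ (pairsAt u v) f ≡ ind (chosen u v) * f (pair u v)
    ∑-pairsAt u v f with chosen u v
    ... | true = refl
    ... | false = refl

    ∑-pairs : ∀ (f : Clique → ℕ) → ∑ pairs f ≡ ∑V (λ u → ∑V (λ v → ind (chosen u v) * f (pair u v)))
    ∑-pairs f = trans (∑-concatMap (allFin N) _ f) (∑-cong (allFin N) λ u _ →
      trans (∑-concatMap (allFin N) _ f) (∑-cong (allFin N) λ v _ → ∑-pairsAt u v f))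

    pairs-length : length pairs ≤ ∑V (λ u → ∑V (λ v → ind (R u v)))
    pairs-length = ≤-trans (≤-reflexive (trans (length-∑ pairs) (∑-pairs _)))
      (∑-mono (allFin N) λ u _ → ∑-mono (allFin N) λ v _ → le u v)
      where
      le : ∀ u v → ind (chosen u v) * 1 ≤ ind (R u v)
      le u v with R u v | does (toℕ u <? toℕ v)
      ... | true | true = ≤-refl
      ... | true | false = z≤n
      ... | false | _ = z≤n

    private
      only : ∀ {u v x y} → u ≢ v → ind (pair x y u ∧ pair x y v) ≢ 0 → (x ≡ u × y ≡ v) ⊎ (x ≡ v × y ≡ u)
      only {u} {v} {x} {y} u≢v ne with u Fin.≟ x | u Fin.≟ y | v Fin.≟ x | v Fin.≟ y
      ... | yes refl | _ | yes refl | _ = ⊥-elim (u≢v refl)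
      ... | yes refl | _ | no _ | yes refl = inj₁ (refl , refl)
      ... | yes refl | _ | no _ | no _ = ⊥-elim (ne refl)
      ... | no _ | yes refl | yes refl | _ = inj₂ (refl , refl)
      ... | no _ | yes refl | no _ | yes refl = ⊥-elim (u≢v refl)
      ... | no _ | yes refl | no _ | no _ = ⊥-elim (ne refl)
      ... | no _ | no _ | _ | _ = ⊥-elim (ne refl)

      both : ∀ u v → ind (pair u v u ∧ pair u v v) ≡ 1
      both u v with u Fin.≟ u | v Fin.≟ u | v Fin.≟ v
      ... | yes _ | yes _ | _ = refl
      ... | yes _ | no _ | yes _ = refl
      ... | yes _ | no _ | no ne = ⊥-elim (ne refl)
      ... | no ne | _ | _ = ⊥-elim (ne refl)

      count-< : ∀ {u v} → toℕ u < toℕ v → count pairs u v ≡ ind (R u v)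
      count-< {u} {v} u<v = begin
        count pairs u v                              ≡⟨ ∑-pairs _ ⟩
        ∑V (λ x → ∑V (g x))                          ≡⟨ ∑V-single u _ (λ x ne → ∑-0 (allFin N) λ y _ → zero-unless x y λ e → ne (proj₁ e)) ⟩
        ∑V (g u)                                     ≡⟨ ∑V-single v (g u) (λ y ne → zero-unless u y λ e → ne (proj₂ e)) ⟩
        ind (chosen u v) * ind (pair u v u ∧ pair u v v)   ≡⟨ cong₂ _*_ ch (both u v) ⟩
        ind (R u v) * 1                              ≡⟨ *-identityʳ _ ⟩
        ind (R u v) ∎
        where
        open ≡-Reasoning
        g : V → V → ℕ
        g x y = ind (chosen x y) * ind (pair x y u ∧ pair x y v)
        u≢v : u ≢ v
        u≢v refl = <-irrefl refl u<v
        zero-unless : ∀ x y → ¬ (x ≡ u × y ≡ v) → g x y ≡ 0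
        zero-unless x y h with ind (pair x y u ∧ pair x y v) ℕ.≟ 0
        ... | yes e = trans (cong (ind (chosen x y) *_) e) (*-zeroʳ (ind (chosen x y)))
        ... | no ne with only {u} {v} {x} {y} u≢v ne
        ...   | inj₁ e = ⊥-elim (h e)
        ...   | inj₂ (refl , refl) = cong (_* ind (pair x y u ∧ pair x y v)) (trans (ind-∧ (R x y) _)
                (trans (cong (ind (R x y) *_) (ind-no (toℕ x <? toℕ y) λ l → <-asym u<v l)) (*-zeroʳ (ind (R x y)))))
        ch : ind (chosen u v) ≡ ind (R u v)
        ch = trans (ind-∧ (R u v) _) (trans (cong (ind (R u v) *_) (ind-yes (toℕ u <? toℕ v) u<v)) (*-identityʳ _))

    count-sym : ∀ cs u v → count cs u v ≡ count cs v u
    count-sym cs u v = ∑-cong cs λ c _ → cong ind (∧-comm (c u) (c v))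

    count-pairs : ∀ {u v} → u ≢ v → count pairs u v ≡ ind (R u v)
    count-pairs {u} {v} u≢v with <-cmp (toℕ u) (toℕ v)
    ... | tri< l _ _ = count-< l
    ... | tri≈ _ e _ = ⊥-elim (u≢v (toℕ-injective e))
    ... | tri> _ _ l = trans (count-sym pairs u v) (trans (count-< l) (cong ind (R-sym v u)))

  module _ (F-sym : ∀ u v → F u v ≡ F v u) where

    -- Single edges only. The recursion ends with this on forests of bounded size, where the square
    -- is still linear in the size.
    trivial-partition : ∀ L → Partition (λ v → does (v ∈? L)) (length L * length L)
    trivial-partition L = pairs , bound , λ u≢v → count-pairs u≢v
      where
      R : V → V → Bool
      R u v = does (u ∈? L) ∧ does (v ∈? L) ∧ not (F u v)
      R-sym : ∀ u v → R u v ≡ R v u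
      R-sym u v with does (u ∈? L) | does (v ∈? L)
      ... | true | true = cong not (F-sym u v)
      ... | true | false = refl
      ... | false | true = refl
      ... | false | false = refl
      open Pairs R R-sym
      open ≤-Reasoning
      le : ∀ u v → ind (R u v) ≤ 𝟙 L u * 𝟙 L v
      le u v with does (u ∈? L) | does (v ∈? L)
      ... | true | true = ind≤1 _
      ... | true | false = z≤n
      ... | false | _ = z≤n
      bound : length pairs ≤ length L * length L
      bound = begin
        length pairs                              ≤⟨ pairs-length ⟩
        ∑V (λ u → ∑V (λ v → ind (R u v)))         ≤⟨ ∑-mono (allFin N) (λ u _ → ∑-mono (allFin N) λ v _ → le u v) ⟩
        ∑V (λ u → ∑V (λ v → 𝟙 L u * 𝟙 L v))       ≡⟨ ∑-cong (allFin N) (λ u _ → trans (∑-* (allFin N) (𝟙 L u) (𝟙 L)) (*-comm (𝟙 L u) _)) ⟩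
        ∑V (λ u → ∑V (𝟙 L) * 𝟙 L u)               ≡⟨ ∑-* (allFin N) (∑V (𝟙 L)) (𝟙 L) ⟩
        ∑V (𝟙 L) * ∑V (𝟙 L)                       ≤⟨ *-mono-≤ (∑-𝟙≤ L) (∑-𝟙≤ L) ⟩
        length L * length L ∎

-- The role of a vertex in the p × p grid: a hub is the point at infinity of the lines of one slope.
data Role : Set where
  hub  : (a : ℕ) → Role
  cell : (x y : ℕ) → Role
  out  : Role

present isHub : Role → Bool
present (hub _) = true
present (cell _ _) = true
present out = false
isHub (hub _) = true
isHub (cell _ _) = false
isHub out = false

inCol : ℕ → Role → Bool
inCol x (cell x′ _) = does (x′ ℕ.≟ x)
inCol x (hub _) = false
inCol x out = false

does-true : {P : Set} (d : Dec P) → does d ≡ true → P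
does-true (yes p) _ = p

does-false : {P : Set} (d : Dec P) → does d ≡ false → ¬ P
does-false (no ¬p) _ = ¬p

module _ where
  open Membership {ℕ × ℕ} (≡-dec ℕ._≟_ ℕ._≟_)

  abstract
    _∈ᵇ_ : ℕ × ℕ → List (ℕ × ℕ) → Bool
    e ∈ᵇ es = does (e ∈? es)

    ∈⇒∈ᵇ : ∀ {e es} → e ∈ es → e ∈ᵇ es ≡ true
    ∈⇒∈ᵇ {e} {es} m = dec-true (e ∈? es) m

    ∈ᵇ⇒∈ : ∀ {e es} → e ∈ᵇ es ≡ true → e ∈ es
    ∈ᵇ⇒∈ {e} {es} = does-true (e ∈? es)

-- A clique partition from lines, single edges and columns

module Assembly {N : ℕ} (F : Graph N) (F-sym : ∀ u v → F u v ≡ F v u)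
  (p : ℕ) .{{nz : NonZero p}} (pr : Prime p) (role : Fin N → Role) (bad : List (ℕ × ℕ)) where

  open Cliques F
  open Modular p

  isBad : ℕ → ℕ → ℕ → Bool
  isBad a x y = (a , β a x y) ∈ᵇ bad

  -- The last two fields make the lines independent sets of the forest: an edge between a hub and a
  -- cell lies on a line that the hub avoids, and an edge between two cells stays in a column. Edges
  -- between hubs are unrestricted because no line contains two hubs.
  record Layout : Set where
    field
      hub-< : ∀ {u a} → role u ≡ hub a → a < p
      cell-< : ∀ {u x y} → role u ≡ cell x y → x < p × y < p
      hub-injective : ∀ {u v a} → role u ≡ hub a → role v ≡ hub a → u ≡ v
      cell-injective : ∀ {u v x y} → role u ≡ cell x y → role v ≡ cell x y → u ≡ v
      hub-edge : ∀ {u v a x y} → role u ≡ hub a → role v ≡ cell x y → F u v ≡ true → (a , β a x y) ∈ bad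
      cell-edge : ∀ {u v x y x′ y′} → role u ≡ cell x y → role v ≡ cell x′ y′ → F u v ≡ true → x ≡ x′

  module _ (L : Layout) where
    open Layout L

    onLine : ℕ → ℕ → Role → Bool
    onLine a b (hub a′) = does (a′ ℕ.≟ a) ∧ not ((a , b) ∈ᵇ bad)
    onLine a b (cell x y) = does (β a x y ℕ.≟ b)
    onLine a b out = false

    -- These pairs are slopes and intercepts, that is, lines and not cells.
    grid : List (ℕ × ℕ)
    grid = concatMap (λ a → map (a ,_) (upTo p)) (upTo p)

    lines : List Clique
    lines = map (λ (a , b) v → onLine a b (role v)) grid

    ∑-grid : ∀ (f : ℕ × ℕ → ℕ) → ∑ grid f ≡ ∑ (upTo p) (λ a → ∑ (upTo p) (λ b → f (a , b)))
    ∑-grid f = trans (∑-concatMap (upTo p) _ f) (∑-cong (upTo p) λ a _ → ∑-map (upTo p) (a ,_) f)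

    ∑-upTo-1 : ∑ (upTo p) (λ _ → 1) ≡ p
    ∑-upTo-1 = trans (sym (length-∑ (upTo p))) (length-upTo p)

    lines-length : length lines ≡ p * p
    lines-length = begin
      length lines                                        ≡⟨ length-map _ grid ⟩
      length grid                                         ≡⟨ length-∑ grid ⟩
      ∑ grid (λ _ → 1)                                    ≡⟨ ∑-grid (λ _ → 1) ⟩
      ∑ (upTo p) (λ a → ∑ (upTo p) (λ b → 1))             ≡⟨ ∑-cong (upTo p) (λ _ _ → ∑-upTo-1) ⟩
      ∑ (upTo p) (λ a → p)                                ≡⟨ ∑-const (upTo p) p ⟩
      length (upTo p) * p                                 ≡⟨ cong (_* p) (length-upTo p) ⟩
      p * p ∎
      where open ≡-Reasoning

    meet : Role → Role → ℕ
    meet r r′ = ∑ (upTo p) (λ a → ∑ (upTo p) (λ b → ind (onLine a b r ∧ onLine a b r′)))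

    count-lines : ∀ u v → count lines u v ≡ meet (role u) (role v)
    count-lines u v = trans (∑-map grid _ _) (∑-grid _)

    meet-sym : ∀ r r′ → meet r r′ ≡ meet r′ r
    meet-sym r r′ = ∑-cong (upTo p) λ a _ → ∑-cong (upTo p) λ b _ →
      cong ind (∧-comm (onLine a b r) (onLine a b r′))

    meet-out : ∀ r → meet out r ≡ 0
    meet-out r = ∑-0 (upTo p) λ a _ → ∑-0 (upTo p) λ b _ → refl

    -- Given the slope, a cell leaves only one possible intercept, so the double sum over lines
    -- collapses to a sum over slopes.
    meet-cell : ∀ x y r → meet (cell x y) r ≡ ∑ (upTo p) (λ a → ind (onLine a (β a x y) r))
    meet-cell x y r = ∑-cong (upTo p) λ a _ → trans (∑-cong (upTo p) λ b _ → ind-∧ (does (β a x y ℕ.≟ b)) (onLine a b r))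
      (∑-upTo-pick (λ b → ind (onLine a b r)) (β<p a x y))

    meet-hubs : ∀ {a a′} → a ≢ a′ → meet (hub a) (hub a′) ≡ 0
    meet-hubs {a} {a′} ne = ∑-0 (upTo p) λ c _ → ∑-0 (upTo p) λ b _ → disjoint c b
      where
      disjoint : ∀ c b → ind (onLine c b (hub a) ∧ onLine c b (hub a′)) ≡ 0
      disjoint c b with does (a ℕ.≟ c) in e | does (a′ ℕ.≟ c) in e′
      ... | true | true = ⊥-elim (ne (trans (does-true (a ℕ.≟ c) e) (sym (does-true (a′ ℕ.≟ c) e′))))
      ... | true | false = cong ind (∧-zeroʳ _)
      ... | false | _ = refl

    meet-cell-hub : ∀ {a} x y → a < p → meet (cell x y) (hub a) ≡ ind (not (isBad a x y))
    meet-cell-hub {a} x y a<p = trans (meet-cell x y (hub a))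
      (trans (∑-cong (upTo p) λ c _ → ind-∧ (does (a ℕ.≟ c)) _)
        (∑-upTo-pick (λ c → ind (not (isBad c x y))) a<p))

    meet-cells : ∀ {x x′} y y′ → x < p → x′ < p → x ≢ x′ → meet (cell x y) (cell x′ y′) ≡ 1
    meet-cells {x} {x′} y y′ x< x′< x≢ with β-meet pr y y′ x< x′< x≢
    ... | a , a<p , e = trans (meet-cell x y (cell x′ y′)) (trans
      (∑-single (upTo⁺ p) (∈-upTo⁺ a<p) λ a′ m ne → ind-no (β a′ x′ y′ ℕ.≟ β a′ x y) λ e′ →
         ne (β-meet-unique pr y y′ x< x′< x≢ (∈-upTo⁻ m) a<p (sym e′) e))
      (ind-yes (β a x′ y′ ℕ.≟ β a x y) (sym e)))

    meet-column : ∀ {x y y′} → y < p → y′ < p → y ≢ y′ → meet (cell x y) (cell x y′) ≡ 0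
    meet-column {x} {y} {y′} y< y′< ne = trans (meet-cell x y (cell x y′)) (∑-0 (upTo p) λ a _ →
      ind-no (β a x y′ ℕ.≟ β a x y) λ e → ne (β-injective a x y< y′< (sym e)))

    -- The pairs covered neither by a line nor within a column: two hubs, or a hub and a cell whose
    -- line of that slope is bad for the hub.
    extraRole : Role → Role → Bool
    extraRole (hub _) (hub _) = true
    extraRole (hub a) (cell x y) = isBad a x y
    extraRole (cell x y) (hub a) = isBad a x y
    extraRole (hub _) out = false
    extraRole (cell _ _) (cell _ _) = false
    extraRole (cell _ _) out = false
    extraRole out _ = false

    extraRole-sym : ∀ r r′ → extraRole r r′ ≡ extraRole r′ r
    extraRole-sym (hub _) (hub _) = refl
    extraRole-sym (hub _) (cell _ _) = refl
    extraRole-sym (hub _) out = refl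
    extraRole-sym (cell _ _) (hub _) = refl
    extraRole-sym (cell _ _) (cell _ _) = refl
    extraRole-sym (cell _ _) out = refl
    extraRole-sym out (hub _) = refl
    extraRole-sym out (cell _ _) = refl
    extraRole-sym out out = refl

    extra : V → V → Bool
    extra u v = extraRole (role u) (role v) ∧ not (F u v)

    extra-sym : ∀ u v → extra u v ≡ extra v u
    extra-sym u v = cong₂ (λ a b → a ∧ not b) (extraRole-sym (role u) (role v)) (F-sym u v)

    open Pairs extra extra-sym

    hubs : ℕ
    hubs = ∑V (λ v → ind (isHub (role v)))

    private
      atHub : ℕ → Role → ℕ
      atHub a (hub a′) = ind (does (a′ ℕ.≟ a))
      atHub a (cell _ _) = 0
      atHub a out = 0

      cellOn : ℕ → ℕ → Role → ℕ
      cellOn a b (cell x y) = ind (does (β a x y ℕ.≟ b))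
      cellOn a b (hub _) = 0
      cellOn a b out = 0

      -- Charges a pair of hub and cell to the bad lines responsible for it. Summed over all
      -- vertices, a bad line is charged by at most one hub, the owner of its slope, and at most `p`
      -- cells.
      badRoles : Role → Role → ℕ
      badRoles r r′ = ∑ bad (λ (a , b) → atHub a r * cellOn a b r′)

      isBad≤ : ∀ a x y → ind (isBad a x y) ≤ badRoles (hub a) (cell x y)
      isBad≤ a x y with (a , β a x y) ∈ᵇ bad in m
      ... | false = z≤n
      ... | true = ≤-trans (≤-reflexive (sym (cong₂ _*_ (ind-yes (a ℕ.≟ a) refl) (ind-yes (β a x y ℕ.≟ β a x y) refl))))
        (∑-∈ (λ (a′ , b) → atHub a′ (hub a) * cellOn a′ b (cell x y)) (∈ᵇ⇒∈ m))

      extra≤ : ∀ r r′ → ind (extraRole r r′) ≤ ind (isHub r) * ind (isHub r′) + (badRoles r r′ + badRoles r′ r)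
      extra≤ (hub _) (hub _) = s≤s z≤n
      extra≤ (hub a) (cell x y) = ≤-trans (isBad≤ a x y) (m≤m+n _ _)
      extra≤ (cell x y) (hub a) = ≤-trans (isBad≤ a x y) (m≤n+m _ _)
      extra≤ (hub _) out = z≤n
      extra≤ (cell _ _) (cell _ _) = z≤n
      extra≤ (cell _ _) out = z≤n
      extra≤ out _ = z≤n

      atHub≤1 : ∀ a r → atHub a r ≤ 1
      atHub≤1 a (hub _) = ind≤1 _
      atHub≤1 a (cell _ _) = z≤n
      atHub≤1 a out = z≤n

      atHub-≢0 : ∀ a r → atHub a r ≢ 0 → r ≡ hub a
      atHub-≢0 a (hub a′) ne with does (a′ ℕ.≟ a) in e
      ... | true = cong hub (does-true (a′ ℕ.≟ a) e)
      ... | false = ⊥-elim (ne refl)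
      atHub-≢0 a (cell _ _) ne = ⊥-elim (ne refl)
      atHub-≢0 a out ne = ⊥-elim (ne refl)

      ∑-atHub : ∀ a → ∑V (λ u → atHub a (role u)) ≤ 1
      ∑-atHub a = ∑-≤1 (allFin⁺ N) (λ u → atHub≤1 a (role u)) λ {u} {v} ne ne′ →
        hub-injective (atHub-≢0 a (role u) ne) (atHub-≢0 a (role v) ne′)

      -- A line meets each of the `p` columns in one cell, and a cell holds at most one vertex.
      ∑-cellOn : ∀ a b → ∑V (λ v → cellOn a b (role v)) ≤ p
      ∑-cellOn a b = begin
        ∑V (λ v → cellOn a b (role v))
          ≤⟨ ∑-mono (allFin N) (λ v _ → ≤-reflexive (split v)) ⟩
        ∑V (λ v → ∑ (upTo p) (λ x → ind (inCol x (role v)) * cellOn a b (role v)))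
          ≡⟨ ∑-swap (allFin N) (upTo p) _ ⟩
        ∑ (upTo p) (λ x → ∑V (λ v → ind (inCol x (role v)) * cellOn a b (role v)))
          ≤⟨ ∑-≤ (upTo p) 1 (λ x _ → ∑-≤1 (allFin⁺ N) (λ v → le1 x (role v)) (λ {u} {v} → inj x u v)) ⟩
        length (upTo p) * 1
          ≡⟨ trans (*-identityʳ _) (length-upTo p) ⟩
        p ∎
        where
        open ≤-Reasoning
        split : ∀ v → cellOn a b (role v) ≡ ∑ (upTo p) (λ x → ind (inCol x (role v)) * cellOn a b (role v))
        split v with role v in eq
        ... | hub _ = sym (∑-0 (upTo p) λ _ _ → refl)
        ... | out = sym (∑-0 (upTo p) λ _ _ → refl)
        ... | cell x y = sym (∑-upTo-pick (λ _ → ind (does (β a x y ℕ.≟ b))) (proj₁ (cell-< eq)))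
        le1 : ∀ x r → ind (inCol x r) * cellOn a b r ≤ 1
        le1 x (hub _) = z≤n
        le1 x out = z≤n
        le1 x (cell x′ y) = *-mono-≤ (ind≤1 (does (x′ ℕ.≟ x))) (ind≤1 (does (β a x′ y ℕ.≟ b)))
        at : ∀ x r → ind (inCol x r) * cellOn a b r ≢ 0 → ∃ λ y → r ≡ cell x y × β a x y ≡ b
        at x (hub _) ne = ⊥-elim (ne refl)
        at x out ne = ⊥-elim (ne refl)
        at x (cell x′ y) ne with does (x′ ℕ.≟ x) in e | does (β a x′ y ℕ.≟ b) in e′
        ... | true | true with does-true (x′ ℕ.≟ x) e
        ...   | refl = y , refl , does-true (β a x y ℕ.≟ b) e′
        at x (cell x′ y) ne | true | false = ⊥-elim (ne refl)
        at x (cell x′ y) ne | false | _ = ⊥-elim (ne refl)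
        inj : ∀ x u v → ind (inCol x (role u)) * cellOn a b (role u) ≢ 0 →
          ind (inCol x (role v)) * cellOn a b (role v) ≢ 0 → u ≡ v
        inj x u v ne ne′ with at x (role u) ne | at x (role v) ne′
        ... | y , e , on | y′ , e′ , on′ = cell-injective e (trans e′ (cong (cell x)
          (β-injective a x (proj₂ (cell-< e′)) (proj₂ (cell-< e)) (trans on′ (sym on)))))

      ∑-bad : ∑V (λ u → ∑V (λ v → badRoles (role u) (role v))) ≤ length bad * p
      ∑-bad = begin
        ∑V (λ u → ∑V (λ v → badRoles (role u) (role v)))
          ≡⟨ ∑-cong (allFin N) (λ u _ → ∑-swap (allFin N) bad _) ⟩
        ∑V (λ u → ∑ bad (λ (a , b) → ∑V (λ v → atHub a (role u) * cellOn a b (role v))))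
          ≡⟨ ∑-swap (allFin N) bad _ ⟩
        ∑ bad (λ (a , b) → ∑V (λ u → ∑V (λ v → atHub a (role u) * cellOn a b (role v))))
          ≤⟨ ∑-≤ bad p (λ (a , b) _ → one a b) ⟩
        length bad * p ∎
        where
        open ≤-Reasoning
        one : ∀ a b → ∑V (λ u → ∑V (λ v → atHub a (role u) * cellOn a b (role v))) ≤ p
        one a b = begin
          ∑V (λ u → ∑V (λ v → atHub a (role u) * cellOn a b (role v)))
            ≡⟨ ∑-cong (allFin N) (λ u _ → trans (∑-* (allFin N) (atHub a (role u)) on) (*-comm (atHub a (role u)) (∑V on))) ⟩
          ∑V (λ u → ∑V on * atHub a (role u))
            ≡⟨ ∑-* (allFin N) (∑V on) (λ u → atHub a (role u)) ⟩
          ∑V on * ∑V (λ u → atHub a (role u))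
            ≤⟨ *-mono-≤ (∑-cellOn a b) (∑-atHub a) ⟩
          p * 1
            ≡⟨ *-identityʳ p ⟩
          p ∎
          where
          on : V → ℕ
          on v = cellOn a b (role v)

    -- The sum runs over ordered pairs, so a hub and a cell appear in both orders; this is why
    -- `length bad * p` occurs twice.
    extra-length : length pairs ≤ hubs * hubs + (length bad * p + length bad * p)
    extra-length = begin
      length pairs
        ≤⟨ pairs-length ⟩
      ∑V (λ u → ∑V (λ v → ind (extra u v)))
        ≤⟨ ∑-mono (allFin N) (λ u _ → ∑-mono (allFin N) λ v _ → ≤-trans (le u v) (extra≤ (role u) (role v))) ⟩
      ∑V (λ u → ∑V (λ v → H u * H v + (D u v + D v u)))
        ≡⟨ ∑-cong (allFin N) (λ u _ → trans (∑-+ (allFin N) _ _) (cong₂ _+_ (trans (∑-* (allFin N) (H u) H) (*-comm (H u) hubs)) (∑-+ (allFin N) _ _))) ⟩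
      ∑V (λ u → hubs * H u + (∑V (D u) + ∑V (λ v → D v u)))
        ≡⟨ trans (∑-+ (allFin N) _ _) (cong₂ _+_ (∑-* (allFin N) hubs H) (∑-+ (allFin N) _ _)) ⟩
      hubs * hubs + (∑V (λ u → ∑V (D u)) + ∑V (λ u → ∑V (λ v → D v u)))
        ≡⟨ cong (λ z → hubs * hubs + (∑V (λ u → ∑V (D u)) + z)) (∑-swap (allFin N) (allFin N) _) ⟩
      hubs * hubs + (∑V (λ u → ∑V (D u)) + ∑V (λ u → ∑V (D u)))
        ≤⟨ +-monoʳ-≤ (hubs * hubs) (+-mono-≤ ∑-bad ∑-bad) ⟩
      hubs * hubs + (length bad * p + length bad * p) ∎
      where
      open ≤-Reasoning
      H : V → ℕ
      H v = ind (isHub (role v))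
      D : V → V → ℕ
      D u v = badRoles (role u) (role v)
      le : ∀ u v → ind (extra u v) ≤ ind (extraRole (role u) (role v))
      le u v with extraRole (role u) (role v)
      ... | true = ind≤1 _
      ... | false = z≤n

    module _ (cost : ℕ → ℕ) (columns : ∀ x → Partition (λ v → inCol x (role v)) (cost x)) where

      columnCliques : List Clique
      columnCliques = concatMap (λ x → proj₁ (columns x)) (upTo p)

      columnCliques-length : length columnCliques ≤ ∑ (upTo p) cost
      columnCliques-length = ≤-trans (≤-reflexive (trans (length-∑ columnCliques) (∑-concatMap (upTo p) _ _)))
        (∑-mono (upTo p) λ x _ → ≤-trans (≤-reflexive (sym (length-∑ (proj₁ (columns x))))) (proj₁ (proj₂ (columns x))))

      inside : V → V → Role → Role → ℕ
      inside u v r r′ = ∑ (upTo p) (λ x → ind (inCol x r ∧ inCol x r′ ∧ not (F u v)))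

      count-columns : ∀ {u v} → u ≢ v → count columnCliques u v ≡ inside u v (role u) (role v)
      count-columns u≢v = trans (∑-concatMap (upTo p) _ _) (∑-cong (upTo p) λ x _ → proj₂ (proj₂ (columns x)) u≢v)

      inside-0ˡ : ∀ u v r r′ → (∀ x → inCol x r ≡ false) → inside u v r r′ ≡ 0
      inside-0ˡ u v r r′ h = ∑-0 (upTo p) λ x _ → cong (λ b → ind (b ∧ inCol x r′ ∧ not (F u v))) (h x)

      inside-0ʳ : ∀ u v r r′ → (∀ x → inCol x r′ ≡ false) → inside u v r r′ ≡ 0
      inside-0ʳ u v r r′ h = ∑-0 (upTo p) λ x _ → trans (cong (λ b → ind (inCol x r ∧ b ∧ not (F u v))) (h x))
        (cong ind (∧-zeroʳ (inCol x r)))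

      inside-cells : ∀ {u v x x′} y y′ → x < p → inside u v (cell x y) (cell x′ y′) ≡ ind (does (x′ ℕ.≟ x)) * nonEdge u v
      inside-cells {u} {v} {x} {x′} y y′ x<p = trans (∑-cong (upTo p) λ z _ → ind-∧ (does (x ℕ.≟ z)) _)
        (trans (∑-upTo-pick (λ z → ind (does (x′ ℕ.≟ z) ∧ not (F u v))) x<p) (ind-∧ (does (x′ ℕ.≟ x)) (not (F u v))))

      family : List Clique
      family = lines ++ pairs ++ columnCliques

      family-length : length family ≤ p * p + ((hubs * hubs + (length bad * p + length bad * p)) + ∑ (upTo p) cost)
      family-length = ≤-trans (≤-reflexive (trans (length-++ lines) (cong₂ _+_ lines-length (length-++ pairs))))
        (+-monoʳ-≤ (p * p) (+-mono-≤ extra-length columnCliques-length))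

      private
        bad-or-not : ∀ {u v} a x y → (F u v ≡ true → (a , β a x y) ∈ bad) →
          ind (not (isBad a x y)) + (ind (isBad a x y ∧ not (F u v)) + 0) ≡ nonEdge u v
        bad-or-not {u} {v} a x y h with (a , β a x y) ∈ᵇ bad in m | F u v
        ... | true | true = refl
        ... | true | false = refl
        ... | false | true = ⊥-elim (true≢false (trans (sym (∈⇒∈ᵇ (h refl))) m))
          where
          true≢false : true ≢ false
          true≢false ()
        ... | false | false = refl

        total-hub-cell : ∀ {u v a x y} → role u ≡ hub a → role v ≡ cell x y →
          meet (hub a) (cell x y) + (ind (isBad a x y ∧ not (F u v)) + inside u v (hub a) (cell x y)) ≡ nonEdge u v
        total-hub-cell {u} {v} {a} {x} {y} e e′ = trans
          (cong₂ (λ i j → i + (ind (isBad a x y ∧ not (F u v)) + j))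
            (trans (meet-sym (hub a) (cell x y)) (meet-cell-hub x y (hub-< e)))
            (inside-0ˡ u v (hub a) (cell x y) λ _ → refl))
          (bad-or-not a x y (hub-edge e e′))

        total-cell-hub : ∀ {u v a x y} → role u ≡ cell x y → role v ≡ hub a →
          meet (cell x y) (hub a) + (ind (isBad a x y ∧ not (F u v)) + inside u v (cell x y) (hub a)) ≡ nonEdge u v
        total-cell-hub {u} {v} {a} {x} {y} e e′ = trans
          (cong₂ (λ i j → i + (ind (isBad a x y ∧ not (F u v)) + j))
            (meet-cell-hub x y (hub-< e′)) (inside-0ʳ u v (cell x y) (hub a) λ _ → refl))
          (bad-or-not a x y λ f → hub-edge e′ e (trans (F-sym v u) f))

        total-cells : ∀ {u v x y x′ y′} → u ≢ v → role u ≡ cell x y → role v ≡ cell x′ y′ →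
          meet (cell x y) (cell x′ y′) + (0 + inside u v (cell x y) (cell x′ y′)) ≡ nonEdge u v
        total-cells {u} {v} {x} {y} {x′} {y′} u≢v e e′ with does (x′ ℕ.≟ x) in d | inside-cells {u} {v} {x} {x′} y y′ (proj₁ (cell-< e))
        ... | true | i with does-true (x′ ℕ.≟ x) d
        ...   | refl = trans (cong₂ (λ i j → i + (0 + j))
                (meet-column (proj₂ (cell-< e)) (proj₂ (cell-< e′)) λ { refl → u≢v (cell-injective e e′) }) i)
                (+-identityʳ _)
        total-cells {u} {v} {x} {y} {x′} {y′} u≢v e e′ | false | i = trans (cong₂ (λ i j → i + (0 + j))
                (meet-cells y y′ (proj₁ (cell-< e)) (proj₁ (cell-< e′)) (λ q → ne (sym q))) i) (one (F u v) refl)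
          where
          ne : x′ ≢ x
          ne = does-false (x′ ℕ.≟ x) d
          one : ∀ b → F u v ≡ b → 1 ≡ ind (not b)
          one true f = ⊥-elim (ne (sym (cell-edge e e′ f)))
          one false f = refl

        -- For each pair of roles exactly one source is responsible. Two hubs: a single edge. Hub
        -- and cell: their line if it is good, otherwise a single edge. Two cells: their unique line
        -- if the columns differ, otherwise the partition of the column. Lines never cover an edge
        -- of the forest, by `Layout`; the other two sources exclude such edges explicitly.
        total-correct : ∀ {u v} → u ≢ v → ∀ r r′ → role u ≡ r → role v ≡ r′ →
          meet r r′ + (ind (extraRole r r′ ∧ not (F u v)) + inside u v r r′) ≡ ind (present r ∧ present r′ ∧ not (F u v))
        total-correct {u} {v} u≢v (hub a) (hub a′) e e′ = trans (cong₂ (λ i j → i + (nonEdge u v + j))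
          (meet-hubs {a} {a′} λ { refl → u≢v (hub-injective e e′) }) (inside-0ˡ u v (hub a) (hub a′) λ _ → refl)) (+-identityʳ _)
        total-correct u≢v (hub a) (cell x y) e e′ = total-hub-cell e e′
        total-correct u≢v (cell x y) (hub a) e e′ = total-cell-hub e e′
        total-correct u≢v (cell x y) (cell x′ y′) e e′ = total-cells u≢v e e′
        total-correct {u} {v} u≢v out r e e′ = cong₂ _+_ (meet-out r) (inside-0ˡ u v out r λ _ → refl)
        total-correct {u} {v} u≢v (hub a) out e e′ =
          cong₂ _+_ (trans (meet-sym (hub a) out) (meet-out (hub a))) (inside-0ʳ u v (hub a) out λ _ → refl)
        total-correct {u} {v} u≢v (cell x y) out e e′ =
          cong₂ _+_ (trans (meet-sym (cell x y) out) (meet-out (cell x y))) (inside-0ʳ u v (cell x y) out λ _ → refl)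

      assembled : Partition (λ v → present (role v))
        (p * p + ((hubs * hubs + (length bad * p + length bad * p)) + ∑ (upTo p) cost))
      assembled = family , family-length , λ {u} {v} u≢v → trans (∑-++ lines _ _) (trans
        (cong₂ _+_ (count-lines u v) (trans (∑-++ pairs _ _) (cong₂ _+_ (count-pairs u≢v) (count-columns u≢v))))
        (total-correct u≢v (role u) (role v) refl refl))

-- Taking whole trees out of forests

Unique-resp-↭ : {xs ys : List A} → xs ↭ ys → Unique xs → Unique ys
Unique-resp-↭ {A} p = PermSetoid.Unique-resp-↭ (setoid A) (↭⇒↭ₛ p)

Unique-map-injective : {f : A → B} {xs : List A} {a b : A} → Unique (map f xs) → a ∈ xs → b ∈ xs → f a ≡ f b → a ≡ b
Unique-map-injective (_ ∷ _) (here refl) (here refl) e = refl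
Unique-map-injective {f = f} (x∉ ∷ _) (here refl) (there q) e = ⊥-elim (All.lookup x∉ (∈-map⁺ f q) e)
Unique-map-injective {f = f} (x∉ ∷ _) (there p) (here refl) e = ⊥-elim (All.lookup x∉ (∈-map⁺ f p) (sym e))
Unique-map-injective (_ ∷ u) (there p) (there q) e = Unique-map-injective u p q e

Unique-++⁻ : (xs : List A) {ys : List A} → Unique (xs ++ ys) → Unique xs × Unique ys × (∀ {x} → x ∈ xs → x ∉ ys)
Unique-++⁻ [] u = [] , u , λ ()
Unique-++⁻ (x ∷ xs) (x∉ ∷ u) with Unique-++⁻ xs u
... | a , b , c = All.++⁻ˡ xs x∉ ∷ a , b , λ { (here refl) m → All.lookup (All.++⁻ʳ xs x∉) m refl ; (there p) → c p }

module _ {V : Set} where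

  _⋈_ : Forest V → Forest V → Forest V
  nil ⋈ T = T
  node v c s ⋈ T = node v c (s ⋈ T)

  -- Only the root of a tree is tested. This amounts to filtering the vertices when `f` is constant
  -- on each tree, which holds for membership in a column because every tree lies in one column.
  select : (V → Bool) → Forest V → Forest V
  select f nil = nil
  select f (node v c s) = if f v then node v c (select f s) else select f s

  verts-⋈ : ∀ S T → verts (S ⋈ T) ≡ verts S ++ verts T
  verts-⋈ nil T = refl
  verts-⋈ (node v c s) T = cong (v ∷_) (trans (cong (verts c ++_) (verts-⋈ s T)) (sym (++-assoc (verts c) (verts s) (verts T))))

  roots-⋈ : ∀ S T {w} → w ∈ roots (S ⋈ T) → w ∈ roots S ⊎ w ∈ roots T
  roots-⋈ nil T p = inj₂ p
  roots-⋈ (node v c s) T (here refl) = inj₁ (here refl)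
  roots-⋈ (node v c s) T (there p) with roots-⋈ s T p
  ... | inj₁ q = inj₁ (there q)
  ... | inj₂ q = inj₂ q

  roots-select : ∀ f T {w} → w ∈ roots (select f T) → w ∈ roots T
  roots-select f (node v c s) p with f v
  ... | false = there (roots-select f s p)
  roots-select f (node v c s) (here refl) | true = here refl
  roots-select f (node v c s) (there p) | true = there (roots-select f s p)

  TreeWise : (V → Bool) → Forest V → Set
  TreeWise f nil = ⊤
  TreeWise f (node v c s) = All (λ w → f w ≡ f v) (verts c) × TreeWise f s

  keep? : (f : V → Bool) (v : V) → Dec (f v ≡ true)
  keep? f v = f v Bool.≟ true

  verts-select : ∀ f T → TreeWise f T → verts (select f T) ≡ filter (keep? f) (verts T)
  verts-select f nil _ = refl
  verts-select f (node v c s) (a , t) = trans (step (f v) refl) (sym (filter-++ (keep? f) (v ∷ verts c) (verts s)))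
    where
    step : ∀ b → f v ≡ b → verts (if b then node v c (select f s) else select f s)
      ≡ filter (keep? f) (v ∷ verts c) ++ filter (keep? f) (verts s)
    step true e = cong₂ _++_ (sym (filter-all (keep? f) (e ∷ All.map (λ q → trans q e) a))) (verts-select f s t)
    step false e = trans (verts-select f s t) (cong (_++ filter (keep? f) (verts s))
      (sym (filter-none (keep? f) (not-true e ∷ All.map (λ q → not-true (trans q e)) a))))
      where
      not-true : ∀ {b} → b ≡ false → ¬ (b ≡ true)
      not-true refl ()

  module _ (par : V → Maybe V) where

    ⋈-coherent : ∀ S T → Coherent par S → Coherent par T → Coherent par (S ⋈ T)
    ⋈-coherent nil T _ ct = ct
    ⋈-coherent (node v c s) T (r , cc , cs) ct = r , cc , ⋈-coherent s T cs ct

    select-coherent : ∀ f T → Coherent par T → Coherent par (select f T)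
    select-coherent f nil _ = tt
    select-coherent f (node v c s) (r , cc , cs) with f v
    ... | true = r , cc , select-coherent f s cs
    ... | false = select-coherent f s cs

  forestVerts : List (Forest V) → List V
  forestVerts = concatMap verts

  selectAll : (V → Bool) → List (Forest V) → Forest V
  selectAll f [] = nil
  selectAll f (T ∷ Ts) = select f T ⋈ selectAll f Ts

  verts-selectAll : ∀ f Ts → (∀ {T} → T ∈ Ts → TreeWise f T) → verts (selectAll f Ts) ≡ filter (keep? f) (forestVerts Ts)
  verts-selectAll f [] _ = refl
  verts-selectAll f (T ∷ Ts) h = trans (verts-⋈ (select f T) (selectAll f Ts))
    (trans (cong₂ _++_ (verts-select f T (h (here refl))) (verts-selectAll f Ts λ m → h (there m)))
      (sym (filter-++ (keep? f) (verts T) (forestVerts Ts))))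

  roots-selectAll : ∀ f Ts {w} → w ∈ roots (selectAll f Ts) → ∃ λ T → T ∈ Ts × w ∈ roots T
  roots-selectAll f (T ∷ Ts) p with roots-⋈ (select f T) (selectAll f Ts) p
  ... | inj₁ q = T , here refl , roots-select f T q
  ... | inj₂ q with roots-selectAll f Ts q
  ...   | T′ , m , r = T′ , there m , r

  selectAll-coherent : ∀ par f Ts → (∀ {T} → T ∈ Ts → Coherent par T) → Coherent par (selectAll f Ts)
  selectAll-coherent par f [] _ = tt
  selectAll-coherent par f (T ∷ Ts) h = ⋈-coherent par (select f T) (selectAll f Ts)
    (select-coherent par f T (h (here refl))) (selectAll-coherent par f Ts λ m → h (there m))

  hubVerts-↭ : ∀ bs → hubVerts bs ↭ map proj₁ bs ++ forestVerts (map proj₂ bs)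
  hubVerts-↭ [] = ↭-refl
  hubVerts-↭ ((s , T) ∷ bs) = prep s (begin
    verts T ++ hubVerts bs                                         ↭⟨ ++⁺ˡ (verts T) (hubVerts-↭ bs) ⟩
    verts T ++ (map proj₁ bs ++ forestVerts (map proj₂ bs))        ≡⟨ sym (++-assoc (verts T) (map proj₁ bs) _) ⟩
    (verts T ++ map proj₁ bs) ++ forestVerts (map proj₂ bs)        ↭⟨ ++⁺ʳ _ (++-comm (verts T) (map proj₁ bs)) ⟩
    (map proj₁ bs ++ verts T) ++ forestVerts (map proj₂ bs)        ≡⟨ ++-assoc (map proj₁ bs) (verts T) _ ⟩
    map proj₁ bs ++ forestVerts (map proj₂ ((s , T) ∷ bs)) ∎)
    where open PermutationReasoning

  hubs*h≤ : ∀ h (bs : List (V × Forest V)) → All (λ b → h ≤ size (proj₂ b)) bs →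
    h * length bs ≤ length (forestVerts (map proj₂ bs))
  hubs*h≤ h [] [] = ≤-reflexive (*-zeroʳ h)
  hubs*h≤ h ((s , T) ∷ bs) (q ∷ qs) = ≤-trans (≤-reflexive (*-suc h (length bs)))
    (≤-trans (+-mono-≤ q (hubs*h≤ h bs qs)) (≤-reflexive (sym (length-++ (verts T)))))

-- One round of the recursion

module FinLists {N : ℕ} where

  V : Set
  V = Fin N

  open Membership {V} Fin._≟_ public

  -- The position of a hub in the list of hubs serves as its slope.
  index : List V → V → ℕ
  index [] v = 0
  index (s ∷ S) v = if does (v Fin.≟ s) then 0 else suc (index S v)

  index-< : ∀ {S v} → v ∈ S → index S v < length S
  index-< {s ∷ S} {v} m with v Fin.≟ s | m
  ... | yes _ | _ = s≤s z≤n
  ... | no ne | here e = ⊥-elim (ne e)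
  ... | no _ | there m′ = s≤s (index-< m′)

  index-injective : ∀ {S u v} → u ∈ S → v ∈ S → index S u ≡ index S v → u ≡ v
  index-injective {s ∷ S} {u} {v} m m′ e with u Fin.≟ s | v Fin.≟ s | m | m′
  ... | yes refl | yes refl | _ | _ = refl
  ... | no ne | _ | here q | _ = ⊥-elim (ne q)
  ... | _ | no ne | _ | here q = ⊥-elim (ne q)
  ... | no _ | no _ | there q | there q′ = index-injective q q′ (suc-injective e)

  locate : List (V × ℕ × ℕ) → V → Role
  locate [] v = out
  locate ((w , x , y) ∷ P) v = if does (v Fin.≟ w) then cell x y else locate P v

  locate-∈ : ∀ P {v x y} → locate P v ≡ cell x y → (v , x , y) ∈ P
  locate-∈ ((w , x′ , y′) ∷ P) {v} e with v Fin.≟ w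
  locate-∈ ((w , x′ , y′) ∷ P) {v} refl | yes refl = here refl
  ... | no _ = there (locate-∈ P e)

  locate-≢hub : ∀ P {v a} → locate P v ≢ hub a
  locate-≢hub ((w , x′ , y′) ∷ P) {v} e with v Fin.≟ w
  locate-≢hub ((w , x′ , y′) ∷ P) {v} () | yes refl
  ... | no _ = locate-≢hub P e

  ∈-locate : ∀ {P v x y} → Unique (map proj₁ P) → (v , x , y) ∈ P → locate P v ≡ cell x y
  ∈-locate {(w , x , y) ∷ P} {v} (w∉ ∷ u) m with v Fin.≟ w | m
  ... | yes refl | here refl = refl
  ... | yes refl | there q = ⊥-elim (All.lookup w∉ (∈-map⁺ proj₁ q) refl)
  ... | no ne | here refl = ⊥-elim (ne refl)
  ... | no _ | there q = ∈-locate u q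

module Hereditary {N : ℕ} (F : Graph N) (F-sym : ∀ u v → F u v ≡ F v u)
  (par : Fin N → Maybe (Fin N))
  (par-edge : ∀ {u v} → F u v ≡ true → par v ≡ just u ⊎ par u ≡ just v) where

  open Cliques F
  open FinLists {N} using (index; index-<; index-injective; locate; locate-∈; locate-≢hub; ∈-locate)

  -- `rootless` lets a root have a parent outside the forest. This weak form is what survives a
  -- round: the roots of a column may have hubs, or vertices of earlier rounds, as parents.
  record Rooted (T : Forest V) : Set where
    field
      unique : Unique (verts T)
      coherent : Coherent par T
      rootless : ∀ {w u} → w ∈ roots T → par w ≡ just u → u ∉ verts T

  PartitionOf : Forest V → ℕ → Set
  PartitionOf T = Partition (λ v → does (v ∈? verts T))

  Partition-cong : ∀ {X Y k l} → (∀ v → X v ≡ Y v) → k ≤ l → Partition X k → Partition Y l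
  Partition-cong {X} {Y} e k≤l (cs , len , cnt) = cs , ≤-trans len k≤l , λ {u} {v} ne →
    trans (cnt ne) (cong₂ (λ a b → ind (a ∧ b ∧ not (F u v))) (e u) (e v))

  module Step (p : ℕ) .{{nz : NonZero p}} (pr : Prime p) (h n : ℕ)
    (8h≤p : h * 8 ≤ p) (n≤hp : n ≤ h * p) (n<28hh : n < h * h * 28)
    (T : Forest V) (rooted : Rooted T) (size≤n : size T ≤ n)
    (pend : Forest V) (bs : List (V × Forest V))
    (perm : verts T ↭ verts pend ++ hubVerts bs)
    (pend-roots : ∀ {w} → w ∈ roots pend → w ∈ roots T)
    (pend-coherent : Coherent par pend) (bs-coherent : All (HubCoherent par) bs)
    (bs-big : All (λ b → h ≤ size (proj₂ b)) bs)
    where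

    open Rooted rooted
    open Modular p
    open Placement {V} p h n 8h≤p n≤hp n<28hh

    S : List V
    S = map proj₁ bs

    Ts : List (Forest V)
    Ts = pend ∷ map proj₂ bs

    -- The forest left over by the cut hangs from no hub and is placed with slope 0. The lines used
    -- by its roots are then listed as bad as well, which adds to the cost but not to the cases.
    items : List (ℕ × Forest V)
    items = (0 , pend) ∷ map (λ (s , U) → index S s , U) bs

    itemVerts-items : itemVerts items ≡ forestVerts Ts
    itemVerts-items = cong (verts pend ++_) (go bs)
      where
      go : ∀ bs → itemVerts (map (λ (s , U) → index S s , U) bs) ≡ forestVerts (map proj₂ bs)
      go [] = refl
      go ((s , U) ∷ bs) = cong (verts U ++_) (go bs)

    perm-S : verts T ↭ S ++ forestVerts Ts
    perm-S = begin
      verts T                                                   ↭⟨ perm ⟩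
      verts pend ++ hubVerts bs                                 ↭⟨ ++⁺ˡ (verts pend) (hubVerts-↭ bs) ⟩
      verts pend ++ (S ++ forestVerts (map proj₂ bs))           ≡⟨ sym (++-assoc (verts pend) S _) ⟩
      (verts pend ++ S) ++ forestVerts (map proj₂ bs)           ↭⟨ ++⁺ʳ _ (++-comm (verts pend) S) ⟩
      (S ++ verts pend) ++ forestVerts (map proj₂ bs)           ≡⟨ ++-assoc S (verts pend) _ ⟩
      S ++ forestVerts Ts ∎
      where open PermutationReasoning

    private
      split = Unique-++⁻ S (Unique-resp-↭ perm-S unique)

    uniqueTs : Unique (forestVerts Ts)
    uniqueTs = proj₁ (proj₂ split)

    S-disjoint : ∀ {v} → v ∈ S → v ∉ forestVerts Ts
    S-disjoint = proj₂ (proj₂ split)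

    S⊆T : ∀ {v} → v ∈ S → v ∈ verts T
    S⊆T m = ∈-resp-↭ (↭-sym perm-S) (∈-++⁺ˡ m)

    Ts⊆T : ∀ {v} → v ∈ forestVerts Ts → v ∈ verts T
    Ts⊆T m = ∈-resp-↭ (↭-sym perm-S) (∈-++⁺ʳ S m)

    sizes : length S + length (forestVerts Ts) ≡ size T
    sizes = trans (sym (length-++ S)) (sym (↭-length perm-S))

    h*S≤n : h * length S ≤ n
    h*S≤n = begin
      h * length S                             ≡⟨ cong (h *_) (length-map proj₁ bs) ⟩
      h * length bs                            ≤⟨ hubs*h≤ h bs bs-big ⟩
      length (forestVerts (map proj₂ bs))      ≤⟨ m≤n+m _ (size pend) ⟩
      size pend + length (forestVerts (map proj₂ bs)) ≡⟨ sym (length-++ (verts pend)) ⟩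
      length (forestVerts Ts)                  ≤⟨ m≤n+m _ (length S) ⟩
      length S + length (forestVerts Ts)       ≡⟨ sizes ⟩
      size T                                   ≤⟨ size≤n ⟩
      n ∎
      where open ≤-Reasoning

    instance
      h≢0 : NonZero h
      h≢0 = pos h n<28hh
        where
        pos : ∀ h → n < h * h * 28 → NonZero h
        pos (suc _) _ = _

    -- There are enough slopes to give each hub its own.
    S≤p : length S ≤ p
    S≤p = *-cancelˡ-≤ h (≤-trans h*S≤n n≤hp)

    module Placed (P : List Entry) (bad₁ : List (ℕ × ℕ)) (valid : Valid P)
      (perm-P : map proj₁ P ↭ itemVerts items ++ [])
      (props : ∀ {a U} → (a , U) ∈ items → Columnar P U
          × (∀ {w} → w ∈ roots U → ∃₂ λ x y → (w , x , y) ∈ P × (a , β a x y) ∈ bad₁))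
      where

      perm-P′ : map proj₁ P ↭ forestVerts Ts
      perm-P′ = ↭-trans perm-P (↭-reflexive (trans (++-identityʳ (itemVerts items)) itemVerts-items))

      uniqueP : Unique (map proj₁ P)
      uniqueP = Unique-resp-↭ (↭-sym perm-P′) uniqueTs

      role : V → Role
      role v = if does (v ∈? S) then hub (index S v) else locate P v

      role-S : ∀ {v} → v ∈ S → role v ≡ hub (index S v)
      role-S {v} m = cong (λ b → if b then hub (index S v) else locate P v) (dec-true (v ∈? S) m)

      P⇒Ts : ∀ {v x y} → (v , x , y) ∈ P → v ∈ forestVerts Ts
      P⇒Ts m = ∈-resp-↭ perm-P′ (∈-map⁺ proj₁ m)

      role-P : ∀ {v x y} → (v , x , y) ∈ P → role v ≡ cell x y
      role-P {v} m = trans (cong (λ b → if b then hub (index S v) else locate P v)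
        (dec-false (v ∈? S) λ s → S-disjoint s (P⇒Ts m))) (∈-locate uniqueP m)

      role-cell : ∀ {v x y} → role v ≡ cell x y → (v , x , y) ∈ P
      role-cell {v} e with v ∈? S
      ... | no _ = locate-∈ P e

      role-hub : ∀ {v a} → role v ≡ hub a → v ∈ S × a ≡ index S v
      role-hub {v} e with v ∈? S
      role-hub {v} refl | yes m = m , refl
      ... | no _ = ⊥-elim (locate-≢hub P e)

      Ts⇒P : ∀ {v} → v ∈ forestVerts Ts → ∃₂ λ x y → (v , x , y) ∈ P
      Ts⇒P m with ∈-map⁻ proj₁ (∈-resp-↭ (↭-sym perm-P′) m)
      ... | (v , x , y) , q , refl = x , y , q

      present-role : ∀ v → present (role v) ≡ does (v ∈? verts T)
      present-role v = go (role v) refl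
        where
        go : ∀ r → role v ≡ r → present r ≡ does (v ∈? verts T)
        go (hub a) e = sym (dec-true (v ∈? verts T) (S⊆T (proj₁ (role-hub e))))
        go (cell x y) e = sym (dec-true (v ∈? verts T) (Ts⊆T (P⇒Ts (role-cell e))))
        go out e = sym (dec-false (v ∈? verts T) absent)
          where
          absent : v ∉ verts T
          absent m with ∈-++⁻ S (∈-resp-↭ perm-S m)
          ... | inj₁ s with trans (sym e) (role-S s)
          ...   | ()
          absent m | inj₂ t with Ts⇒P t
          ...   | x , y , q with trans (sym e) (role-P q)
          ...     | ()

      inC : ℕ → V → Bool
      inC x v = inCol x (role v)

      inC-cell : ∀ {x v} → inC x v ≡ true → ∃ λ y → role v ≡ cell x y
      inC-cell {x} {v} = go (role v) refl
        where
        go : ∀ r → role v ≡ r → inCol x r ≡ true → ∃ λ y → role v ≡ cell x y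
        go (cell x′ y) e q with does-true (x′ ℕ.≟ x) q
        ... | refl = y , e

      cell-inC : ∀ {x y v} → role v ≡ cell x y → inC x v ≡ true
      cell-inC {x} {y} e = trans (cong (inCol x) e) (dec-true (x ℕ.≟ x) refl)

      columnar⇒treeWise : ∀ x U → Columnar P U → TreeWise (inC x) U
      columnar⇒treeWise x nil _ = tt
      columnar⇒treeWise x (node v c s) ((x′ , at) , cs) =
        All.tabulate (λ m → trans (val (there m)) (sym (val (here refl)))) , columnar⇒treeWise x s cs
        where
        val : ∀ {w} → w ∈ v ∷ verts c → inC x w ≡ does (x′ ℕ.≟ x)
        val m = cong (inCol x) (role-P (proj₂ (at m)))

      column : ℕ → Forest V
      column x = selectAll (inC x) Ts

      Ts⇒item : ∀ {U} → U ∈ Ts → ∃ λ a → (a , U) ∈ items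
      Ts⇒item (here refl) = 0 , here refl
      Ts⇒item (there m) with ∈-map⁻ proj₂ m
      ... | (s , U) , q , refl = index S s , there (∈-map⁺ _ q)

      verts-column : ∀ x → verts (column x) ≡ filter (keep? (inC x)) (forestVerts Ts)
      verts-column x = verts-selectAll (inC x) Ts λ {U} m →
        columnar⇒treeWise x U (proj₁ (props (proj₂ (Ts⇒item m))))

      ∈-column : ∀ {x v} → inC x v ≡ true → v ∈ verts (column x)
      ∈-column {x} {v} e = subst (v ∈_) (sym (verts-column x))
        (∈-filter⁺ (keep? (inC x)) (P⇒Ts (role-cell (proj₂ (inC-cell e)))) e)

      column-∈ : ∀ {x v} → v ∈ verts (column x) → inC x v ≡ true
      column-∈ {x} {v} m = proj₂ (∈-filter⁻ (keep? (inC x)) {xs = forestVerts Ts} (subst (v ∈_) (verts-column x) m))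

      column-member : ∀ x v → does (v ∈? verts (column x)) ≡ inC x v
      column-member x v with inC x v in e
      ... | true = dec-true (v ∈? verts (column x)) (∈-column e)
      ... | false = dec-false (v ∈? verts (column x)) λ m → false≢true (trans (sym e) (column-∈ {x} m))
        where
        false≢true : false ≢ true
        false≢true ()

      hub-tree : ∀ {U} → U ∈ map proj₂ bs → ∃ λ s → (s , U) ∈ bs
      hub-tree m with ∈-map⁻ proj₂ m
      ... | (s , U) , q , refl = s , q

      Ts-coherent : ∀ {U} → U ∈ Ts → Coherent par U
      Ts-coherent (here refl) = pend-coherent
      Ts-coherent (there m) = proj₁ (All.lookup bs-coherent (proj₂ (hub-tree m)))

      column-coherent : ∀ x → Coherent par (column x)
      column-coherent x = selectAll-coherent par (inC x) Ts Ts-coherent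

      -- The roots of the leftover forest are roots of `T`, with parents outside `T`; those of a
      -- hanging forest have their hub as parent. In neither case does the parent occupy a cell.
      root-parent : ∀ {U w u} → U ∈ Ts → w ∈ roots U → par w ≡ just u →
        u ∉ verts T ⊎ ((u , U) ∈ bs × u ∈ S)
      root-parent (here refl) r e = inj₁ (rootless (pend-roots r) e)
      root-parent (there m) r e with hub-tree m
      ... | s , q with trans (sym (proj₂ (All.lookup bs-coherent q) r)) e
      ...   | refl = inj₂ (q , ∈-map⁺ proj₁ q)

      root-parent-not-cell : ∀ {U w u x y} → U ∈ Ts → w ∈ roots U → par w ≡ just u → role u ≢ cell x y
      root-parent-not-cell m r e c with root-parent m r e
      ... | inj₁ u∉ = u∉ (Ts⊆T (P⇒Ts (role-cell c)))
      ... | inj₂ (_ , s) with trans (sym (role-S s)) c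
      ...   | ()

      -- Trees are kept whole, so inside the forest of its column a vertex is either a root or has
      -- its parent in the same column.
      cell-parent : ∀ {w u x y} → role w ≡ cell x y → par w ≡ just u →
        (∃ λ y′ → role u ≡ cell x y′) ⊎ (∃ λ U → U ∈ Ts × w ∈ roots U)
      cell-parent {w} {u} {x} c e with coherent-parent par (column x) (column-coherent x) (∈-column {x} {w} (cell-inC c))
      ... | inj₁ r = inj₂ (roots-selectAll (inC x) Ts r)
      ... | inj₂ (u′ , e′ , m) with trans (sym e′) e
      ...   | refl = inj₁ (inC-cell (column-∈ {x} m))

      column-rooted : ∀ x → Rooted (column x)
      column-rooted x = record
        { unique = subst Unique (sym (verts-column x)) (filter⁺ (keep? (inC x)) uniqueTs)
        ; coherent = column-coherent x
        ; rootless = λ r e m → let (U , m′ , r′) = roots-selectAll (inC x) Ts r in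
            root-parent-not-cell m′ r′ e (proj₂ (inC-cell (column-∈ {x} m)))
        }

      -- The parent of a hub is a neighbour that the placement did not control. If it occupies a
      -- cell, its line is declared bad, at most one per hub.
      up : ℕ → Maybe Role → List (ℕ × ℕ)
      up a (just (cell x y)) = (a , β a x y) ∷ []
      up a _ = []

      up≤1 : ∀ a r → length (up a r) ≤ 1
      up≤1 a (just (cell x y)) = ≤-refl
      up≤1 a (just (hub _)) = z≤n
      up≤1 a (just out) = z≤n
      up≤1 a nothing = z≤n

      ups : V → List (ℕ × ℕ)
      ups s = up (index S s) (Maybe.map role (par s))

      bad : List (ℕ × ℕ)
      bad = bad₁ ++ concatMap ups S

      open Assembly F F-sym p pr role bad

      up-bad : ∀ {u v x y} → u ∈ S → par u ≡ just v → role v ≡ cell x y → (index S u , β (index S u) x y) ∈ bad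
      up-bad {u} {v} {x} {y} m e c = ∈-++⁺ʳ bad₁ (in-concat S m)
        where
        here′ : (index S u , β (index S u) x y) ∈ ups u
        here′ = subst (λ z → _ ∈ up (index S u) z) (sym (trans (cong (Maybe.map role) e) (cong just c))) (here refl)
        in-concat : ∀ S′ → u ∈ S′ → (index S u , β (index S u) x y) ∈ concatMap ups S′
        in-concat (s ∷ S′) (here refl) = ∈-++⁺ˡ here′
        in-concat (s ∷ S′) (there q) = ∈-++⁺ʳ (ups s) (in-concat S′ q)

      -- A child of the hub in a cell cannot have its parent in its column, so it is a root, and its
      -- forest can only be the one hanging from this hub. The placement has listed the line of such
      -- a root.
      down-bad : ∀ {u v x y} → u ∈ S → par v ≡ just u → role v ≡ cell x y → (index S u , β (index S u) x y) ∈ bad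
      down-bad {u} {v} {x} {y} m e c with cell-parent c e
      ... | inj₁ (_ , c′) with trans (sym (role-S m)) c′
      ...   | ()
      down-bad {u} {v} {x} {y} m e c | inj₂ (U , mU , r) with root-parent mU r e
      ...   | inj₁ u∉ = ⊥-elim (u∉ (S⊆T m))
      ...   | inj₂ (q , _) with proj₂ (props {index S u} {U} (there (∈-map⁺ _ q))) r
      ...     | x′ , y′ , mP , b with trans (sym (role-P mP)) c
      ...       | refl = ∈-++⁺ˡ b

      layout : Layout
      layout = record
        { hub-< = λ e → let (m , q) = role-hub e in <-≤-trans (subst (_< length S) (sym q) (index-< m)) S≤p
        ; cell-< = λ e → All.lookup (proj₂ valid) (role-cell e)
        ; hub-injective = λ e e′ → let (m , q) = role-hub e ; (m′ , q′) = role-hub e′ in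
            index-injective m m′ (trans (sym q) q′)
        ; cell-injective = λ e e′ → cong proj₁ (Unique-map-injective (proj₁ valid) (role-cell e) (role-cell e′) refl)
        ; hub-edge = hub-edge′
        ; cell-edge = cell-edge′
        }
        where
        hub-edge′ : ∀ {u v a x y} → role u ≡ hub a → role v ≡ cell x y → F u v ≡ true → (a , β a x y) ∈ bad
        hub-edge′ e c f with role-hub e | par-edge f
        ... | m , refl | inj₁ q = down-bad m q c
        ... | m , refl | inj₂ q = up-bad m q c
        parent-column : ∀ {u v x y x′ y′} → role u ≡ cell x y → role v ≡ cell x′ y′ → par v ≡ just u → x ≡ x′
        parent-column c c′ e with cell-parent c′ e
        ... | inj₁ (_ , d) with trans (sym c) d
        ...   | refl = refl
        parent-column c c′ e | inj₂ (U , m , r) = ⊥-elim (root-parent-not-cell m r e c)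
        cell-edge′ : ∀ {u v x y x′ y′} → role u ≡ cell x y → role v ≡ cell x′ y′ → F u v ≡ true → x ≡ x′
        cell-edge′ c c′ f with par-edge f
        ... | inj₁ q = parent-column c c′ q
        ... | inj₂ q = sym (parent-column c′ c q)

      open Layout layout using (cell-<)

      size-column : ∀ x → size (column x) ≡ ∑V (λ v → ind (inC x v))
      size-column x = ≤-antisym
        (≤-trans (length≤∑-𝟙 (verts (column x)) (Rooted.unique (column-rooted x))) (≤-reflexive e))
        (≤-trans (≤-reflexive (sym e)) (∑-𝟙≤ (verts (column x))))
        where
        e : ∑V (𝟙 (verts (column x))) ≡ ∑V (λ v → ind (inC x v))
        e = ∑-cong (allFin N) λ v _ → cong ind (column-member x v)

      size-column≤p : ∀ x → size (column x) ≤ p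
      size-column≤p x = begin
        size (column x)
          ≡⟨ size-column x ⟩
        ∑V (λ v → ind (inC x v))
          ≤⟨ ∑-mono (allFin N) (λ v _ → some-row (role v) refl) ⟩
        ∑V (λ v → ∑ (upTo p) (λ y → atCell y (role v)))
          ≡⟨ ∑-swap (allFin N) (upTo p) _ ⟩
        ∑ (upTo p) (λ y → ∑V (λ v → atCell y (role v)))
          ≤⟨ ∑-≤ (upTo p) 1 (λ y _ → ∑-≤1 (allFin⁺ N) (λ v → atCell≤1 y (role v))
               λ {u} {v} a b → Layout.cell-injective layout (atCell-≢0 y (role u) a) (atCell-≢0 y (role v) b)) ⟩
        length (upTo p) * 1
          ≡⟨ trans (*-identityʳ _) (length-upTo p) ⟩
        p ∎
        where
        open ≤-Reasoning
        atCell : ℕ → Role → ℕ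
        atCell y (cell x′ y′) = ind (does (y′ ℕ.≟ y)) * ind (does (x′ ℕ.≟ x))
        atCell y _ = 0
        atCell≤1 : ∀ y r → atCell y r ≤ 1
        atCell≤1 y (cell x′ y′) = *-mono-≤ (ind≤1 (does (y′ ℕ.≟ y))) (ind≤1 (does (x′ ℕ.≟ x)))
        atCell≤1 y (hub _) = z≤n
        atCell≤1 y out = z≤n
        atCell-≢0 : ∀ y r → atCell y r ≢ 0 → r ≡ cell x y
        atCell-≢0 y (hub _) ne = ⊥-elim (ne refl)
        atCell-≢0 y out ne = ⊥-elim (ne refl)
        atCell-≢0 y (cell x′ y′) ne with does (y′ ℕ.≟ y) in e | does (x′ ℕ.≟ x) in e′
        ... | true | true = cong₂ cell (does-true (x′ ℕ.≟ x) e′) (does-true (y′ ℕ.≟ y) e)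
        ... | true | false = ⊥-elim (ne refl)
        ... | false | _ = ⊥-elim (ne refl)
        some-row : ∀ {v} r → role v ≡ r → ind (inCol x r) ≤ ∑ (upTo p) (λ y → atCell y r)
        some-row (hub _) _ = z≤n
        some-row out _ = z≤n
        some-row (cell x′ y′) e = ≤-reflexive (sym (∑-upTo-pick (λ _ → ind (does (x′ ℕ.≟ x))) (proj₂ (cell-< e))))

      -- The columns are disjoint. Together with a bound linear in the size, this keeps the total
      -- cost of all deeper rounds linear in `n`.
      ∑-size-column : ∑ (upTo p) (λ x → size (column x)) ≤ n
      ∑-size-column = begin
        ∑ (upTo p) (λ x → size (column x))
          ≡⟨ ∑-cong (upTo p) (λ x _ → size-column x) ⟩
        ∑ (upTo p) (λ x → ∑V (λ v → ind (inC x v)))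
          ≡⟨ ∑-swap (upTo p) (allFin N) _ ⟩
        ∑V (λ v → ∑ (upTo p) (λ x → ind (inC x v)))
          ≤⟨ ∑-mono (allFin N) (λ v _ → ≤-trans (once (role v)) (≤-reflexive (cong ind (present-role v)))) ⟩
        ∑V (𝟙 (verts T))
          ≤⟨ ∑-𝟙≤ (verts T) ⟩
        size T
          ≤⟨ size≤n ⟩
        n ∎
        where
        open ≤-Reasoning
        once : ∀ r → ∑ (upTo p) (λ x → ind (inCol x r)) ≤ ind (present r)
        once (hub _) = ≤-trans (≤-reflexive (∑-0 (upTo p) λ _ _ → refl)) z≤n
        once out = ≤-trans (≤-reflexive (∑-0 (upTo p) λ _ _ → refl)) z≤n
        once (cell x y) = ∑-upTo-δ p x

      hubs≤ : hubs layout ≤ length S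
      hubs≤ = ≤-trans (∑-mono (allFin N) (λ v _ → le v (role v) refl)) (∑-𝟙≤ S)
        where
        le : ∀ v r → role v ≡ r → ind (isHub r) ≤ 𝟙 S v
        le v (hub a) e = ≤-reflexive (sym (ind-yes (v ∈? S) (proj₁ (role-hub e))))
        le v (cell _ _) e = z≤n
        le v out e = z≤n

      bad-length : length bad ≤ length bad₁ + length S
      bad-length = ≤-trans (≤-reflexive (length-++ bad₁)) (+-monoʳ-≤ (length bad₁) (≤-trans
        (≤-reflexive (trans (length-∑ (concatMap ups S)) (∑-concatMap S ups (λ _ → 1))))
        (≤-trans (∑-≤ S 1 (λ s _ → ≤-trans (≤-reflexive (sym (length-∑ (ups s)))) (up≤1 (index S s) (Maybe.map role (par s))))) (≤-reflexive (*-identityʳ _)))))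

      round : ∀ g → (∀ U → Rooted U → size U ≤ p → PartitionOf U (g * size U)) →
        PartitionOf T (p * p + ((length S * length S + ((length bad₁ + length S) * p + (length bad₁ + length S) * p)) + g * n))
      round g rec = Partition-cong present-role
        (+-monoʳ-≤ (p * p) (+-mono-≤ (+-mono-≤ (*-mono-≤ hubs≤ hubs≤)
            (+-mono-≤ (*-monoˡ-≤ p bad-length) (*-monoˡ-≤ p bad-length)))
          (≤-trans (≤-reflexive (∑-* (upTo p) g _)) (*-monoʳ-≤ g ∑-size-column))))
        (assembled layout (λ x → g * size (column x)) λ x →
          Partition-cong (column-member x) ≤-refl (rec (column x) (column-rooted x) (size-column≤p x)))

-- The cost of a round and the recursion

module _ where
  open ≤-Reasoning

  opaque
    -- Each factor `p`, or one factor `s`, is traded for 16h; then h * s ≤ n and h * b ≤ 2h + 2n + n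
    -- apply. The square gives 16n and each of the two products 64n + 32h.
    step-cost : ∀ {p h n s b} → p ≤ h * 16 → s ≤ p → h * s ≤ n → h * b ≤ suc s * (h * 2) + n →
      s * s + ((b + s) * p + (b + s) * p) ≤ n * 144 + h * 64
    step-cost {p} {h} {n} {s} {b} p≤ s≤p hs hb = begin
      s * s + ((b + s) * p + (b + s) * p)                    ≤⟨ +-mono-≤ sq (+-mono-≤ bp bp) ⟩
      n * 16 + ((h * 32 + n * 64) + (h * 32 + n * 64))       ≡⟨ e n h ⟩
      n * 144 + h * 64 ∎
      where
      e : ∀ n h → n * 16 + ((h * 32 + n * 64) + (h * 32 + n * 64)) ≡ n * 144 + h * 64
      e = solve-∀
      e₁ : ∀ s h → s * (h * 16) ≡ h * s * 16
      e₁ = solve-∀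
      e₂ : ∀ b s h → (b + s) * (h * 16) ≡ (h * b + h * s) * 16
      e₂ = solve-∀
      e₃ : ∀ s h n → (suc s * (h * 2) + n + n) * 16 ≡ (h * 2 + h * s * 2 + n + n) * 16
      e₃ = solve-∀
      e₄ : ∀ h n → (h * 2 + n * 2 + n + n) * 16 ≡ h * 32 + n * 64
      e₄ = solve-∀
      sq : s * s ≤ n * 16
      sq = begin
        s * s          ≤⟨ *-monoʳ-≤ s (≤-trans s≤p p≤) ⟩
        s * (h * 16)   ≡⟨ e₁ s h ⟩
        h * s * 16     ≤⟨ *-monoˡ-≤ 16 hs ⟩
        n * 16 ∎
      bp : (b + s) * p ≤ h * 32 + n * 64
      bp = begin
        (b + s) * p                            ≤⟨ *-monoʳ-≤ (b + s) p≤ ⟩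
        (b + s) * (h * 16)                     ≡⟨ e₂ b s h ⟩
        (h * b + h * s) * 16                   ≤⟨ *-monoˡ-≤ 16 (+-mono-≤ hb hs) ⟩
        (suc s * (h * 2) + n + n) * 16         ≡⟨ e₃ s h n ⟩
        (h * 2 + h * s * 2 + n + n) * 16       ≤⟨ *-monoˡ-≤ 16 (+-monoˡ-≤ n (+-monoˡ-≤ n (+-monoʳ-≤ (h * 2) (*-monoˡ-≤ 2 hs)))) ⟩
        (h * 2 + n * 2 + n + n) * 16           ≡⟨ e₄ h n ⟩
        h * 32 + n * 64 ∎

    below-next-multiple : ∀ p → p < 8 + p / 8 * 8
    below-next-multiple p = begin-strict
      p                    ≡⟨ m≡m%n+[m/n]*n p 8 ⟩
      p % 8 + p / 8 * 8    <⟨ +-monoˡ-< (p / 8 * 8) (m%n<n p 8) ⟩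
      8 + p / 8 * 8 ∎

    -- From 4 ≤ n follows 64 ≤ p * p, so p ≥ 8 and h ≥ 1, which makes the rounding harmless: p ≤
    -- 16h. Then 16n ≤ p * p ≤ 16h * p gives n ≤ h * p ≤ 16 h², below 28 h².
    eighth : ∀ p n h → 4 ≤ n → n * 16 ≤ p * p → p < 8 + h * 8 → p ≤ h * 16 × n ≤ h * p × n < h * h * 28
    eighth p n h 4≤n lo p< = p≤ , n≤ , n<
      where
      8≤p : 8 ≤ p
      8≤p = ≮⇒≥ λ p<8 → <⇒≱ (*-mono-< p<8 p<8) (≤-trans (*-monoˡ-≤ 16 4≤n) lo)
      1≤h : 1 ≤ h
      1≤h = positive h p<
        where
        positive : ∀ h → p < 8 + h * 8 → 1 ≤ h
        positive zero q = contradiction 8≤p (<⇒≱ q)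
        positive (suc _) _ = s≤s z≤n
      p≤ : p ≤ h * 16
      p≤ = begin
        p                ≤⟨ <⇒≤ p< ⟩
        8 + h * 8        ≤⟨ +-monoˡ-≤ (h * 8) (*-monoˡ-≤ 8 1≤h) ⟩
        h * 8 + h * 8    ≡⟨ sym (*-distribˡ-+ h 8 8) ⟩
        h * 16 ∎
      n≤ : n ≤ h * p
      n≤ = *-cancelʳ-≤ n (h * p) 16 (begin
        n * 16           ≤⟨ lo ⟩
        p * p            ≤⟨ *-monoˡ-≤ p p≤ ⟩
        h * 16 * p       ≡⟨ e h p ⟩
        h * p * 16 ∎)
        where
        e : ∀ h p → h * 16 * p ≡ h * p * 16
        e = solve-∀
      n< : n < h * h * 28
      n< = begin-strict
        n                ≤⟨ n≤ ⟩
        h * p            ≤⟨ *-monoʳ-≤ h p≤ ⟩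
        h * (h * 16)     ≡⟨ sym (*-assoc h h 16) ⟩
        h * h * 16       <⟨ *-monoʳ-< (h * h) {{>-nonZero (*-mono-≤ 1≤h 1≤h)}} (m<m+n 16 {12} z<s) ⟩
        h * h * 28 ∎

module Recursion {N : ℕ} (F : Graph N) (F-sym : ∀ u v → F u v ≡ F v u)
  (par : Fin N → Maybe (Fin N))
  (par-edge : ∀ {u v} → F u v ≡ true → par v ≡ just u ⊎ par u ≡ just v) where

  open Cliques F using (V; trivial-partition; _∈?_)
  open Hereditary F F-sym par par-edge

  PartitionOf-mono : ∀ T {k l} → k ≤ l → PartitionOf T k → PartitionOf T l
  PartitionOf-mono T = Partition-cong {λ v → does (v ∈? verts T)} (λ _ → refl)

  opaque
    step : ∀ p .{{_ : NonZero p}} → Prime p → ∀ h T → h * 8 ≤ p → p ≤ h * 16 → size T ≤ h * p → size T < h * h * 28 →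
      Rooted T → ∀ g → (∀ U → Rooted U → size U ≤ p → PartitionOf U (g * size U)) →
      PartitionOf T (p * p + ((size T * 144 + h * 64) + g * size T))
    step p pr h T 8h≤p p≤16h n≤hp n<28hh rooted g rec = use (place-items items [] ([] , []) small fits)
      where
      cs : Coherent par (proj₁ (cut h T)) × All (HubCoherent par) (proj₂ (cut h T))
      cs = cut-coherent par h T (Rooted.coherent rooted)
      open Step p pr h (size T) 8h≤p n≤hp n<28hh T rooted ≤-refl (proj₁ (cut h T)) (proj₂ (cut h T))
        (cut-↭ h T) (cut-roots h T) (proj₁ cs) (proj₂ cs) (cut-big h T)
      open Placement {V} p h (size T) 8h≤p n≤hp n<28hh
      small : All (λ i → SmallTrees h (proj₂ i)) items
      small = proj₁ (cut-small h T) ∷ All.map⁺ (proj₂ (cut-small h T))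
      verts≤ : length (itemVerts items) ≤ size T
      verts≤ = ≤-trans (≤-reflexive (cong length itemVerts-items)) (≤-trans (m≤n+m _ (length S)) (≤-reflexive sizes))
      fits : length {A = Entry} [] + length (itemVerts items) ≤ size T
      fits = verts≤
      items-length : length items ≡ suc (length S)
      items-length = cong suc (trans (length-map _ (proj₂ (cut h T))) (sym (length-map proj₁ (proj₂ (cut h T)))))
      use : (∃₂ λ P bad₁ → Valid P × map proj₁ P ↭ (itemVerts items ++ []) × [] ⊑ P
              × (∀ {a U} → (a , U) ∈ items → Columnar P U
                  × (∀ {w} → w ∈ roots U → ∃₂ λ x y → (w , x , y) ∈ P × (a , Modular.β p a x y) ∈ bad₁))
              × h * length bad₁ ≤ length items * (h * 2) + length (itemVerts items)) →
        PartitionOf T (p * p + ((size T * 144 + h * 64) + g * size T))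
      use (P , bad₁ , valid , perm , _ , props , cost) = PartitionOf-mono T
        (+-monoʳ-≤ (p * p) (+-monoˡ-≤ (g * size T) (step-cost {p} {h} {size T} {length S} {length bad₁} p≤16h S≤p h*S≤n
          (≤-trans cost (+-mono-≤ (≤-reflexive (cong (_* (h * 2)) items-length)) verts≤)))))
        (Placed.round P bad₁ valid perm props g rec)

  -- `B k` bounds the forests that `k` rounds can finish, and `B-suc` says that a column, of at most
  -- `p` vertices, falls one level lower. The numerals stay abstract here.
  module Levels (c B₀ : ℕ) (B : ℕ → ℕ) (4≤B₀ : 4 ≤ B₀) (B-zero : B 0 ≤ B₀)
    (B-suc : ∀ k p → p * p ≤ B (suc k) * c → p ≤ B k)
    (near : ∀ n → B₀ < n → ∃ λ p → Prime p × n * 16 ≤ p * p × p * p ≤ n * c) where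

    -- One summand per expense: `B₀` for the base case, `c` for the p * p lines, and 144 + 64c for
    -- the single edges, using the crude h ≤ p * p ≤ n * c.
    rate : ℕ
    rate = B₀ + (c + (144 + c * 64))

    small-case : ∀ k T → size T ≤ B₀ → PartitionOf T (rate * suc k * size T)
    small-case k T small = PartitionOf-mono T
      (*-monoˡ-≤ (size T) (≤-trans small (≤-trans (m≤m+n B₀ _) (m≤m*n rate (suc k)))))
      (trivial-partition F-sym (verts T))

    levels : ∀ k T → Rooted T → size T ≤ B k → PartitionOf T (rate * suc k * size T)
    levels zero T rooted le = small-case zero T (≤-trans le B-zero)
    levels (suc k) T rooted le = choose (size T ≤? B₀)
      where
      n = size T
      choose : Dec (n ≤ B₀) → PartitionOf T (rate * suc (suc k) * n)
      choose (yes small) = small-case (suc k) T small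
      choose (no large) = build (near n (≰⇒> large))
        where
        build : (∃ λ p → Prime p × n * 16 ≤ p * p × p * p ≤ n * c) → PartitionOf T (rate * suc (suc k) * n)
        build (p , pr , lo , hi) = split (eighth p n h (≤-trans 4≤B₀ (<⇒≤ (≰⇒> large))) lo (below-next-multiple p))
          where
          h : ℕ
          h = p / 8
          instance
            p≢0 : NonZero p
            p≢0 = prime⇒nonZero pr
          split : p ≤ h * 16 × n ≤ h * p × n < h * h * 28 → PartitionOf T (rate * suc (suc k) * n)
          split (p≤16h , n≤hp , n<) = PartitionOf-mono T bound
            (step p pr h T (m/n*n≤m p 8) p≤16h n≤hp n< rooted (rate * suc k)
              λ U r small → levels k U r (≤-trans small (B-suc k p (≤-trans hi (*-monoˡ-≤ c le)))))
            where
            open ≤-Reasoning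
            h≤ : h ≤ n * c
            h≤ = begin
              h        ≤⟨ m≤m*n h 8 ⟩
              h * 8    ≤⟨ m/n*n≤m p 8 ⟩
              p        ≤⟨ m≤m*n p p ⟩
              p * p    ≤⟨ hi ⟩
              n * c ∎
            e : ∀ n c d → n * c + (n * d + n * c * 64) ≡ (c + (d + c * 64)) * n
            e = solve-∀
            e′ : ∀ r k n → r * n + r * suc k * n ≡ r * suc (suc k) * n
            e′ = solve-∀
            bound : p * p + ((n * 144 + h * 64) + rate * suc k * n) ≤ rate * suc (suc k) * n
            bound = begin
              p * p + ((n * 144 + h * 64) + rate * suc k * n)   ≡⟨ sym (+-assoc (p * p) _ _) ⟩
              (p * p + (n * 144 + h * 64)) + rate * suc k * n   ≤⟨ +-monoˡ-≤ (rate * suc k * n) (begin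
                p * p + (n * 144 + h * 64)                      ≤⟨ +-mono-≤ hi (+-monoʳ-≤ (n * 144) (*-monoˡ-≤ 64 h≤)) ⟩
                n * c + (n * 144 + n * c * 64)                  ≡⟨ e n c 144 ⟩
                (c + (144 + c * 64)) * n                        ≤⟨ *-monoˡ-≤ n (m≤n+m _ B₀) ⟩
                rate * n ∎) ⟩
              rate * n + rate * suc k * n                       ≡⟨ e′ rate k n ⟩
              rate * suc (suc k) * n ∎

-- Rooting an acyclic graph

lookup-injective : {xs : List A} → Unique xs → ∀ {i j} → lookup xs i ≡ lookup xs j → i ≡ j
lookup-injective (_ ∷ _) {zero} {zero} _ = refl
lookup-injective {xs = x ∷ xs} (x∉ ∷ _) {zero} {suc j} e = ⊥-elim (All.lookup x∉ (∈-lookup {xs = xs} j) e)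
lookup-injective {xs = x ∷ xs} (x∉ ∷ _) {suc i} {zero} e = ⊥-elim (All.lookup x∉ (∈-lookup {xs = xs} i) (sym e))
lookup-injective (_ ∷ u) {suc i} {suc j} e = cong suc (lookup-injective u e)

last : A → List A → A
last x [] = x
last x (y ∷ ys) = last y ys

last-∷ʳ : (x : A) (xs : List A) {y : A} → last x (xs ++ y ∷ []) ≡ y
last-∷ʳ x [] = refl
last-∷ʳ x (z ∷ zs) = last-∷ʳ z zs

lookup-last : (x : A) (xs : List A) → lookup (x ∷ xs) (fromℕ (length xs)) ≡ last x xs
lookup-last x [] = refl
lookup-last x (y ∷ ys) = lookup-last y ys

lookup-linked : {R : A → A → Set} (x : A) (xs : List A) → Linked R (x ∷ xs) → (i : Fin (length xs)) →
  R (lookup (x ∷ xs) (inject₁ i)) (lookup (x ∷ xs) (suc i))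
lookup-linked x (y ∷ ys) (r ∷ l) zero = r
lookup-linked x (y ∷ ys) (r ∷ l) (suc i) = lookup-linked y ys l i

linked-++⁻ˡ : {R : A → A → Set} (xs : List A) {ys : List A} → Linked R (xs ++ ys) → Linked R xs
linked-++⁻ˡ [] _ = []
linked-++⁻ˡ (x ∷ []) _ = [-]
linked-++⁻ˡ (x ∷ y ∷ xs) (r ∷ l) = r ∷ linked-++⁻ˡ (y ∷ xs) l

module _ {V : Set} where

  coherent-cong : ∀ {par par′ : V → Maybe V} T → (∀ {w} → w ∈ verts T → par w ≡ par′ w) → Coherent par T → Coherent par′ T
  coherent-cong nil h _ = tt
  coherent-cong (node v c s) h (r , cc , cs) =
    (λ m → trans (sym (h (there (∈-++⁺ˡ (root⇒vert c m))))) (r m))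
    , coherent-cong c (λ m → h (there (∈-++⁺ˡ m))) cc
    , coherent-cong s (λ m → h (there (∈-++⁺ʳ (verts c) m))) cs

  -- Coherence is promised for every parent function with the right value at `v`, because the
  -- function of the enlarged forest differs from the old one.
  attach-leaf : ∀ (v u : V) T → u ∈ verts T → ∃ λ T′ → verts T′ ↭ v ∷ verts T × roots T′ ≡ roots T
    × (∀ par → par v ≡ just u → Coherent par T → Coherent par T′)
  attach-leaf v u (node w c s) (here refl) = node w (node v nil c) s , shift v (w ∷ []) (verts c ++ verts s) , refl
    , λ { par e (r , cc , cs) → (λ { (here refl) → e ; (there m) → r m }) , ((λ ()) , tt , cc) , cs }
  attach-leaf v u (node w c s) (there m) with ∈-++⁻ (verts c) m
  ... | inj₁ q with attach-leaf v u c q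
  ...   | c′ , perm , rt , coh = node w c′ s
          , ↭-trans (prep w (++⁺ʳ (verts s) perm)) (shift v (w ∷ []) (verts c ++ verts s)) , refl
          , λ { par e (r , cc , cs) → (λ m → r (subst (_ ∈_) rt m)) , coh par e cc , cs }
  attach-leaf v u (node w c s) (there m) | inj₂ q with attach-leaf v u s q
  ...   | s′ , perm , rt , coh = node w c s′
          , ↭-trans (prep w (++⁺ˡ (verts c) perm)) (shift v (w ∷ verts c) (verts s)) , cong (w ∷_) rt
          , λ { par e (r , cc , cs) → r , cc , coh par e cs }

module _ {N : ℕ} (F : Graph N) (simple : IsSimple F) where

  open Cliques F using (V; _∈?_; ∑V; 𝟙; length≤∑-𝟙)

  F-sym : ∀ u v → F u v ≡ F v u
  F-sym = proj₁ simple

  private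
    irreflexive : ∀ {v} → F v v ≢ true
    irreflexive {v} e with trans (sym e) (proj₂ simple v)
    ... | ()

  cycle : ∀ a b m M → Unique (a ∷ b ∷ m ∷ M) → Linked (Edge F) (a ∷ b ∷ m ∷ M) → Edge F (last m M) a → HasCycle F
  cycle a b m M u l e = length M , lookup (a ∷ b ∷ m ∷ M) , lookup-injective u
    , lookup-linked a (b ∷ m ∷ M) l
    , subst (λ z → Edge F z a) (sym (lookup-last m M)) e

  -- The walk from `a` up to `w` closes to a cycle. It has at least three vertices, as `w` comes
  -- after `b`.
  close-walk : ∀ a b rest {w} → Unique (a ∷ b ∷ rest) → Linked (Edge F) (a ∷ b ∷ rest) → w ∈ rest → Edge F a w → HasCycle F
  close-walk a b rest {w} u l m e with ∈-∃++ m
  ... | [] , qs , refl = cycle a b w [] (proj₁ (Unique-++⁻ (a ∷ b ∷ w ∷ []) u)) (linked-++⁻ˡ (a ∷ b ∷ w ∷ []) l)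
        (trans (F-sym w a) e)
  ... | p ∷ ps , qs , refl = cycle a b p (ps ++ w ∷ [])
        (proj₁ (Unique-++⁻ (a ∷ b ∷ p ∷ ps ++ w ∷ []) (subst Unique split u)))
        (linked-++⁻ˡ (a ∷ b ∷ p ∷ ps ++ w ∷ []) (subst (Linked (Edge F)) split l))
        (subst (λ z → Edge F z a) (sym (last-∷ʳ p ps)) (trans (F-sym w a) e))
    where
    split : a ∷ b ∷ p ∷ ps ++ w ∷ qs ≡ (a ∷ b ∷ p ∷ ps ++ w ∷ []) ++ qs
    split = cong (λ z → a ∷ b ∷ p ∷ z) (sym (++-assoc ps (w ∷ []) qs))

  unique-length : ∀ {xs : List V} → Unique xs → length xs ≤ N
  unique-length {xs} u = begin
    length xs                   ≤⟨ length≤∑-𝟙 xs u ⟩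
    ∑V (𝟙 xs)                   ≤⟨ ∑-≤ (allFin N) 1 (λ v _ → ind≤1 _) ⟩
    length (allFin N) * 1       ≡⟨ trans (*-identityʳ _) (length-tabulate _) ⟩
    N ∎
    where open ≤-Reasoning

  -- Degree at most one relative to `X`, since the induction below deletes vertices from `X` and not
  -- from the graph.
  Leaf : List V → Set
  Leaf X = ∃ λ v → v ∈ X × ((∀ {w} → w ∈ X → ¬ Edge F v w)
    ⊎ ∃ λ u → u ∈ X × u ≢ v × (∀ {w} → w ∈ X → Edge F v w → w ≡ u))

  module _ (acyclic : ¬ HasCycle F) where

    neighbour? : ∀ X a → (∃ λ w → w ∈ X × Edge F a w) ⊎ (∀ {w} → w ∈ X → ¬ Edge F a w)
    neighbour? X a with any? (λ w → F a w Bool.≟ true) X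
    ... | yes m = let (w , i , e) = find m in inj₁ (w , i , e)
    ... | no ¬m = inj₂ λ m e → ¬m (lose m e)

    another? : ∀ X a b → (∃ λ w → w ∈ X × Edge F a w × w ≢ b) ⊎ (∀ {w} → w ∈ X → Edge F a w → w ≡ b)
    another? X a b with any? (λ w → (F a w Bool.≟ true) ×-dec ¬? (w Fin.≟ b)) X
    ... | yes m = let (w , i , e) = find m in inj₁ (w , i , e)
    ... | no ¬m = inj₂ other
      where
      other : ∀ {w} → w ∈ X → Edge F a w → w ≡ b
      other {w} m e with w Fin.≟ b
      ... | yes q = q
      ... | no ne = ⊥-elim (¬m (lose m (e , ne)))

    -- The path is extended at its front `a` by a neighbour other than `b`, until there is none. A
    -- neighbour already on the path would close a cycle, and the fuel cannot run out because the
    -- path would then have more than `N` distinct vertices.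
    walk : ∀ fuel X a b rest → N < length (a ∷ b ∷ rest) + fuel → Unique (a ∷ b ∷ rest) →
      Linked (Edge F) (a ∷ b ∷ rest) → All (_∈ X) (a ∷ b ∷ rest) → Leaf X
    walk zero X a b rest short u l ins =
      ⊥-elim (<⇒≱ short (≤-trans (≤-reflexive (+-identityʳ _)) (unique-length u)))
    walk (suc fuel) X a b rest short u@((a≢b ∷ a∉) ∷ _) l ins@(a∈ ∷ b∈ ∷ _) with another? X a b
    ... | inj₂ only = a , a∈ , inj₂ (b , b∈ , (λ e → a≢b (sym e)) , only)
    ... | inj₁ (w , w∈ , e , w≢b) with w ∈? rest
    ...   | yes m = ⊥-elim (acyclic (close-walk a b rest u l m e))
    ...   | no w∉ = walk fuel X w a (b ∷ rest) (≤-trans short (≤-reflexive (+-suc _ fuel)))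
            (((λ { refl → irreflexive e }) ∷ w≢b ∷ All.tabulate (λ m q → w∉ (subst (_∈ rest) (sym q) m))) ∷ u)
            (trans (F-sym w a) e ∷ l) (w∈ ∷ ins)

    leaf : ∀ x X → Leaf (x ∷ X)
    leaf x X with neighbour? (x ∷ X) x
    ... | inj₂ none = x , here refl , inj₁ none
    ... | inj₁ (w , w∈ , e) = walk N (x ∷ X) w x [] (m<n+m N (s≤s z≤n))
            (((λ { refl → irreflexive e }) ∷ []) ∷ [] ∷ []) (trans (F-sym w x) e ∷ [-]) (w∈ ∷ here refl ∷ [])

    record RootedOn (X : List V) : Set where
      field
        parent : V → Maybe V
        tree : Forest V
        vertices : verts tree ↭ X
        coherent : Coherent parent tree
        orphans : ∀ {w} → w ∈ roots tree → parent w ≡ nothing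
        edges : ∀ {u v} → u ∈ X → v ∈ X → Edge F u v → parent v ≡ just u ⊎ parent u ≡ just v

    -- A leaf is removed, the rest is rooted, and the leaf is put back as a child of its only
    -- neighbour, or as a new root if it is isolated. Only the parent of the leaf changes, so all
    -- older facts persist.
    rooted-on : ∀ k X → length X ≡ k → Unique X → RootedOn X
    rooted-on zero [] _ _ = record
      { parent = λ _ → nothing ; tree = nil ; vertices = ↭-refl ; coherent = tt
      ; orphans = λ () ; edges = λ () }
    rooted-on (suc k) X@(x ∷ X₀) len uniq with leaf x X₀
    ... | v , v∈ , rest with ∈-∃++ v∈
    ...   | ps , qs , eq = extend rest
      where
      X′ : List V
      X′ = ps ++ qs
      perm : X ↭ v ∷ X′
      perm = ↭-trans (↭-reflexive eq) (shift v ps qs)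
      uniq′ : Unique (v ∷ X′)
      uniq′ = Unique-resp-↭ perm uniq
      v∉ : v ∉ X′
      v∉ m with uniq′
      ... | a ∷ _ = All.lookup a m refl
      sub : Unique X′
      sub with uniq′
      ... | _ ∷ b = b
      open RootedOn (rooted-on k X′ (suc-injective (trans (sym (↭-length perm)) len)) sub)
      newParent : Maybe V → V → Maybe V
      newParent q w with w Fin.≟ v
      ... | yes _ = q
      ... | no _ = parent w
      new-v : ∀ q → newParent q v ≡ q
      new-v q with v Fin.≟ v
      ... | yes _ = refl
      ... | no ne = ⊥-elim (ne refl)
      new-other : ∀ q {w} → w ≢ v → newParent q w ≡ parent w
      new-other q {w} ne with w Fin.≟ v
      ... | yes e = ⊥-elim (ne e)
      ... | no _ = refl
      old : ∀ {w} → w ∈ X′ → w ≢ v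
      old m refl = v∉ m
      in-tree : ∀ {w} → w ∈ verts tree → w ∈ X′
      in-tree = ∈-resp-↭ vertices
      keep : ∀ q → Coherent (newParent q) tree
      keep q = coherent-cong tree (λ m → sym (new-other q (old (in-tree m)))) coherent
      new-edges : ∀ q → (∀ {w} → w ∈ X′ → Edge F v w → q ≡ just w) →
        ∀ {a b} → a ∈ X → b ∈ X → Edge F a b → newParent q b ≡ just a ⊎ newParent q a ≡ just b
      new-edges q h {a} {b} a∈ b∈ e with ∈-resp-↭ perm a∈ | ∈-resp-↭ perm b∈
      ... | here refl | here refl = ⊥-elim (irreflexive e)
      ... | here refl | there m = inj₂ (trans (new-v q) (h m e))
      ... | there m | here refl = inj₁ (trans (new-v q) (h m (trans (F-sym v a) e)))
      ... | there m | there m′ with edges m m′ e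
      ...   | inj₁ r = inj₁ (trans (new-other q (old m′)) r)
      ...   | inj₂ r = inj₂ (trans (new-other q (old m)) r)
      X′⊆X : ∀ {w} → w ∈ X′ → w ∈ X
      X′⊆X m = ∈-resp-↭ (↭-sym perm) (there m)
      extend : ((∀ {w} → w ∈ X → ¬ Edge F v w) ⊎ ∃ λ u → u ∈ X × u ≢ v × (∀ {w} → w ∈ X → Edge F v w → w ≡ u)) → RootedOn X
      extend (inj₁ isolated) = record
        { parent = newParent nothing
        ; tree = node v nil tree
        ; vertices = ↭-trans (prep v vertices) (↭-sym perm)
        ; coherent = (λ ()) , tt , keep nothing
        ; orphans = λ { (here refl) → new-v nothing
                      ; (there m) → trans (new-other nothing (old (in-tree (root⇒vert tree m)))) (orphans m) }
        ; edges = new-edges nothing λ m e → ⊥-elim (isolated (X′⊆X m) e)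
        }
      extend (inj₂ (u , u∈ , u≢v , only)) with ∈-resp-↭ perm u∈
      ... | here e = ⊥-elim (u≢v e)
      ... | there u∈′ with attach-leaf v u tree (∈-resp-↭ (↭-sym vertices) u∈′)
      ...   | tree′ , perm′ , same-roots , coh = record
        { parent = newParent (just u)
        ; tree = tree′
        ; vertices = ↭-trans perm′ (↭-trans (prep v vertices) (↭-sym perm))
        ; coherent = coh (newParent (just u)) (new-v (just u)) (keep (just u))
        ; orphans = λ m → let m′ = subst (_ ∈_) same-roots m in
            trans (new-other (just u) (old (in-tree (root⇒vert tree m′)))) (orphans m′)
        ; edges = new-edges (just u) λ m e → cong just (sym (only (X′⊆X m) e))
        }

-- The bound

-- Uniqueness concerns positions: a clique listed twice would already count two.
∑-≡1⇒∃! : (xs : List A) (f : A → Bool) → ∑ xs (λ x → ind (f x)) ≡ 1 →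
  Σ (Fin (length xs)) λ i → f (lookup xs i) ≡ true × (∀ j → f (lookup xs j) ≡ true → j ≡ i)
∑-≡1⇒∃! (x ∷ xs) f e with f x in fx
... | true = zero , fx , λ { zero _ → refl ; (suc j) q → ⊥-elim (0≢1 (suc-injective e) j q) }
  where
  0≢1 : ∑ xs (λ x → ind (f x)) ≡ 0 → ∀ j → f (lookup xs j) ≢ true
  0≢1 z j q = <⇒≱ (s≤s z≤n) (subst₂ _≤_ (cong ind q) z (∑-∈ (λ x → ind (f x)) (∈-lookup {xs = xs} j)))
... | false with ∑-≡1⇒∃! xs f e
...   | i , fi , only = suc i , fi , λ { zero q → ⊥-elim (true≢false (trans (sym q) fx)) ; (suc j) q → cong suc (only j q) }
  where
  true≢false : true ≢ false
  true≢false ()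

module _ {n : ℕ} (F : Graph n) where

  open Cliques F

  partition⇒CpAtMost : ∀ {X k} → (∀ v → X v ≡ true) → Partition X k → CpAtMost (complement F) k
  partition⇒CpAtMost {X} {k} everywhere (cs , len , cnt) =
    subsets , (sound , complete) , ≤-trans (≤-reflexive (length-map tabulate cs)) len
    where
    subsets : List (Subset n)
    subsets = map tabulate cs
    both : V → V → Subset n → Bool
    both u v s = Vec.lookup s u ∧ Vec.lookup s v
    both⁺ : ∀ {u v s} → u ∈ˢ s → v ∈ˢ s → both u v s ≡ true
    both⁺ p q = cong₂ _∧_ ([]=⇒lookup p) ([]=⇒lookup q)
    both⁻ : ∀ {u v s} → both u v s ≡ true → u ∈ˢ s × v ∈ˢ s
    both⁻ {u} {v} {s} e with Vec.lookup s u in p | Vec.lookup s v in q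
    ... | true | true = lookup⇒[]= u s p , lookup⇒[]= v s q
    total : ∀ {u v} → u ≢ v → ∑ subsets (λ s → ind (both u v s)) ≡ ind (not (F u v))
    total {u} {v} ne = begin
      ∑ subsets (λ s → ind (both u v s))            ≡⟨ ∑-map cs tabulate (λ s → ind (both u v s)) ⟩
      ∑ cs (λ c → ind (both u v (tabulate c)))      ≡⟨ ∑-cong cs (λ c _ → cong ind (cong₂ _∧_ (lookup∘tabulate c u) (lookup∘tabulate c v))) ⟩
      count cs u v                                  ≡⟨ cnt ne ⟩
      ind (X u ∧ X v ∧ not (F u v))                 ≡⟨ cong₂ (λ a b → ind (a ∧ b ∧ not (F u v))) (everywhere u) (everywhere v) ⟩
      ind (not (F u v)) ∎
      where open ≡-Reasoning
    complement-edge : ∀ {u v} → u ≢ v → not (F u v) ≡ true → Edge (complement F) u v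
    complement-edge {u} {v} ne e with u Fin.≟ v
    ... | yes q = ⊥-elim (ne q)
    ... | no _ = cong (_∧ true) e
    complement-edge⁻ : ∀ {u v} → Edge (complement F) u v → u ≢ v × not (F u v) ≡ true
    complement-edge⁻ {u} {v} e with u Fin.≟ v | not (F u v)
    complement-edge⁻ () | yes _ | true
    complement-edge⁻ () | yes _ | false
    ... | no ne | true = ne , refl
    sound : ∀ i u v → u ∈ˢ lookup subsets i → v ∈ˢ lookup subsets i → u ≢ v → Edge (complement F) u v
    -- The clique itself contributes 1 to the count of the pair, so the count, which is the
    -- indicator of a non-edge of `F`, cannot be 0.
    sound i u v p q ne = complement-edge ne (positive (not (F u v)) (≤-trans
        (≤-reflexive (sym (cong ind (both⁺ p q))))
        (≤-trans (∑-∈ (λ s → ind (both u v s)) (∈-lookup {xs = subsets} i)) (≤-reflexive (total ne)))))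
      where
      positive : ∀ b → 1 ≤ ind b → b ≡ true
      positive true _ = refl
    complete : ∀ u v → Edge (complement F) u v → Σ (Fin (length subsets)) λ i →
      (u ∈ˢ lookup subsets i × v ∈ˢ lookup subsets i) × (∀ j → u ∈ˢ lookup subsets j → v ∈ˢ lookup subsets j → j ≡ i)
    complete u v e with complement-edge⁻ {u} {v} e
    ... | ne , q with ∑-≡1⇒∃! subsets (both u v) (trans (total ne) (cong ind q))
    ...   | i , on , only = i , both⁻ on , λ j a b → only j (both⁺ a b)

<2^[1+⌊log₂⌋] : ∀ n → n < 2 ^ suc ⌊log₂ n ⌋
<2^[1+⌊log₂⌋] n = ≰⇒> λ le → <-irrefl refl (≤-trans (≤-reflexive (sym (⌊log₂[2^n]⌋≡n (suc ⌊log₂ n ⌋)))) (⌊log₂⌋-mono-≤ le))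

1≤loglog : ∀ n → 4 ≤ n → 1 ≤ ⌊log₂ ⌊log₂ n ⌋ ⌋
1≤loglog n 4≤n = ≤-trans (≤-reflexive (sym (⌊log₂[2^n]⌋≡n 1)))
  (⌊log₂⌋-mono-≤ (≤-trans (≤-reflexive (sym (⌊log₂[2^n]⌋≡n 2))) (⌊log₂⌋-mono-≤ 4≤n)))

-- Forests of at most tower k vertices are exhausted by k rounds, as p² ≤ 2^14 * n with p prime near √n.
tower : ℕ → ℕ
tower k = 2 ^ (14 + 2 ^ k)

-- The summand 14 in the exponent is a fixed point of the round: (14 + 2 * 2^k + 14) / 2 = 14 + 2^k.
-- So the factor 2^14 does not accumulate.
tower-√ : ∀ k p → p * p ≤ tower (suc k) * 2 ^ 14 → p ≤ tower k
tower-√ k p le = ≮⇒≥ λ lt → <⇒≱ (*-mono-< lt lt) (≤-trans le (≤-reflexive (begin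
  2 ^ (14 + 2 ^ suc k) * 2 ^ 14             ≡⟨ sym (^-distribˡ-+-* 2 (14 + 2 ^ suc k) 14) ⟩
  2 ^ (14 + 2 ^ suc k + 14)                 ≡⟨ cong (2 ^_) (e 14 (2 ^ k)) ⟩
  2 ^ ((14 + 2 ^ k) + (14 + 2 ^ k))         ≡⟨ ^-distribˡ-+-* 2 (14 + 2 ^ k) (14 + 2 ^ k) ⟩
  tower k * tower k ∎)))
  where
  open ≡-Reasoning
  e : ∀ c x → c + 2 * x + c ≡ (c + x) + (c + x)
  e = solve-∀

module _ (c B₀ : ℕ) (B : ℕ → ℕ) (4≤B₀ : 4 ≤ B₀) (B-zero : B 0 ≤ B₀)
  (B-suc : ∀ k p → p * p ≤ B (suc k) * c → p ≤ B k)
  (B-large : ∀ k → 2 ^ (2 ^ k) ≤ B k)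
  (near : ∀ n → B₀ < n → ∃ λ p → Prime p × n * 16 ≤ p * p × p * p ≤ n * c) where

  forest-bound : ∃ λ (C : ℕ) → ∀ (n : ℕ) → 4 ≤ n → (F : Graph n) → IsForest F →
    CpAtMost (complement F) (C * n * ⌊log₂ ⌊log₂ n ⌋ ⌋)
  forest-bound = rate₀ * 3 , bound
    where
    rate₀ : ℕ
    rate₀ = B₀ + (c + (144 + c * 64))
    bound : ∀ n → 4 ≤ n → (F : Graph n) → IsForest F → CpAtMost (complement F) (rate₀ * 3 * n * ⌊log₂ ⌊log₂ n ⌋ ⌋)
    bound n 4≤n F (simple , acyclic) = partition⇒CpAtMost F everywhere
      (PartitionOf-mono tree cost (levels (suc L) tree rooted small))
      where
      L : ℕ
      L = ⌊log₂ ⌊log₂ n ⌋ ⌋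
      open RootedOn (rooted-on F simple acyclic (length (allFin n)) (allFin n) refl (allFin⁺ n))
      par-edge : ∀ {u v} → F u v ≡ true → parent v ≡ just u ⊎ parent u ≡ just v
      par-edge {u} {v} = edges (∈-allFin u) (∈-allFin v)
      open Hereditary F (proj₁ simple) parent par-edge
      open Recursion F (proj₁ simple) parent par-edge
      open Levels c B₀ B 4≤B₀ B-zero B-suc near
      open Cliques F using (_∈?_)
      everywhere : ∀ v → does (v ∈? verts tree) ≡ true
      everywhere v = dec-true (v ∈? verts tree) (∈-resp-↭ (↭-sym vertices) (∈-allFin v))
      rooted : Rooted tree
      rooted = record
        { unique = Unique-resp-↭ (↭-sym vertices) (allFin⁺ n)
        ; coherent = coherent
        ; rootless = λ r e → ⊥-elim (nothing≢just (trans (sym (orphans r)) e))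
        }
        where
        nothing≢just : ∀ {u : Fin n} → nothing ≢ just u
        nothing≢just ()
      size≡n : size tree ≡ n
      size≡n = trans (↭-length vertices) (length-tabulate (λ i → i))
      -- Both logarithms are rounded down; starting one level above `L` makes up for this.
      small : size tree ≤ B (suc L)
      small = begin
        size tree            ≡⟨ size≡n ⟩
        n                    ≤⟨ <⇒≤ (<2^[1+⌊log₂⌋] n) ⟩
        2 ^ suc ⌊log₂ n ⌋    ≤⟨ ^-monoʳ-≤ 2 (<2^[1+⌊log₂⌋] ⌊log₂ n ⌋) ⟩
        2 ^ (2 ^ suc L)      ≤⟨ B-large (suc L) ⟩
        B (suc L) ∎
        where open ≤-Reasoning
      cost : rate * suc (suc L) * size tree ≤ rate₀ * 3 * n * L
      cost = begin
        rate * suc (suc L) * size tree   ≡⟨ cong (rate * suc (suc L) *_) size≡n ⟩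
        -- The additive 2 is absorbed into 2 * L, as L ≥ 1 for n ≥ 4.
        rate * suc (suc L) * n           ≤⟨ *-monoˡ-≤ n (*-monoʳ-≤ rate (+-monoˡ-≤ L (*-monoʳ-≤ 2 (1≤loglog n 4≤n)))) ⟩
        rate * (2 * L + L) * n           ≡⟨ e rate L n ⟩
        rate * 3 * n * L ∎
        where
        open ≤-Reasoning
        e : ∀ r l n → r * (2 * l + l) * n ≡ r * 3 * n * l
        e = solve-∀

theorem6p1 : ∃ λ (C : ℕ) → ∀ (n : ℕ) → 4 ≤ n → (F : Graph n) → IsForest F →
                 CpAtMost (complement F) (C * n * ⌊log₂ ⌊log₂ n ⌋ ⌋)
-- 2^14 is the upper constant of `prime-near-√`, and 2^15 is `tower 0`; the latter exceeds the 2^10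
-- from which primes are available.
theorem6p1 = forest-bound (2 ^ 14) (2 ^ 15) tower (≤ᵇ⇒≤ 4 (2 ^ 15) _) ≤-refl tower-√
  (λ k → ^-monoʳ-≤ 2 (m≤n+m (2 ^ k) 14))
  (λ n lt → prime-near-√ n (<-trans (<ᵇ⇒< (2 ^ 10) (2 ^ 15) _) lt))
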